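{- For every positive integer $m$, every $w\in\widetilde S_n$ and every $w'\in S_n$, $$D_{{\bf p}_m}(A_wA_{w'})=D_{{\bf p}_m}(A_w)A_{w'}.$$
   Context: Fix $n\ge2$. $\widetilde S_n$ is the affine symmetric group (bijections $w$ of $\mathbb Z$ with $w(i+n)=w(i)+n$, $\sum_{i=1}^nw(i)=\sum_{i=1}^ni$), Coxeter generators $s_0,\dots,s_{n-1}$, length $\ell$; $S_n\subset\widetilde S_n$ is the subgroup generated by $s_1,\dots,s_{n-1}$. For $i<j$, $i\not\equiv j\pmod n$, $t_{ij}$ swaps $i+rn$ and $j+rn$ for all $r$. $\mathbb A$ is the affine nilCoxeter algebra over $\mathbb Q$ with basis $A_w$ (generated by $A_0,\dots,A_{n-1}$, $A_i^2=0$, braid relations, $A_w$ the product along a reduced word; $A_uA_v=A_{uv}$ if $\ell(uv)=\ell(u)+\ell(v)$ and $0$ otherwise). Symbols $[ij]$ ($i<j$, $i\not\equiv j$) act on the right on $\mathbb A$ by $A_w\cdot[ij]=A_{wt_{ij}}$ if $\ell(wt_{ij})=\ell(w)-1$, else $0$, extended multiplicatively to words and linearly to (formal) sums; $D_{\bf x}(A_w):=A_w\cdot{\bf x}$. MN element ${\bf p}_m={\bf p}_m(0)$: for $a\in\mathbb Z$, a connected tree on $\mathcal D_a$ is a finite set $D$ of boxes $(i,j)$ with $i\le a<j$ such that the graph on $\mathbb Z$ with an edge $\{i,j\}$ per box has its non-isolated vertices forming a single tree with pairwise distinct residues mod $n$; $c(D)$ is the number of tree vertices $\le a$. For a bijection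 $L:\{1,\dots,|D|\}\to D$, $L(t)=(i_t,j_t)$, put $x_{D_L}=[i_1j_1]\cdots[i_{|D|}j_{|D|}]$; labelings are equivalent if their words differ by swaps of adjacent letters with disjoint supports. With $l$ the number of distinct second coordinates in $D$ and $v=|D|-l$, $M(D)$ is a set of one representative from each equivalence class containing a labeling with $i_1,\dots,i_{l-1}$ distinct, $j_1\le\dots\le j_{l-1}$, $j_l,\dots,j_{l+v}$ distinct, $i_l\le\dots\le i_{l+v}$. ${\bf p}_m(a)=\sum_D\sum_{L\in M(D)}(-1)^{c(D)-1}x_{D_L}$ over connected trees on $\mathcal D_a$ with $m$ boxes. -}

module Defs where

open import Data.Bool using (Bool; true; false; _∧_; _∨_; not; if_then_else_; T)
open import Data.Nat as ℕ using (ℕ; zero; suc; _≤_)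
import Data.Nat.Properties as ℕP
open import Data.Integer as ℤ using (ℤ; +_; -[1+_])
import Data.Integer.Properties as ℤP
open import Data.Integer.DivMod using (_/ℕ_; _%ℕ_)
open import Data.Rational as ℚ using (ℚ; 0ℚ; 1ℚ)
open import Data.List as L using (List; []; _∷_; map; concatMap; length; filterᵇ; foldl; foldr; upTo; take; drop)
open import Data.Bool.ListAction using (any; all)
import Data.List.Properties as LP
open import Data.List.Relation.Unary.Unique.Propositional using (Unique)
open import Data.List.Relation.Binary.Permutation.Propositional using (_↭_)
open import Data.Product using (_×_; _,_; proj₁; proj₂)
open import Relation.Nullary.Decidable using (⌊_⌋)
open import Relation.Binary.PropositionalEquality using (_≡_)

infix 4 _==ℕ_ _==ℤ_ _==W_ _<ℤ_ _≤ℤ_ _==B_ _==Wd_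

_==ℕ_ : ℕ → ℕ → Bool
a ==ℕ b = ⌊ a ℕ.≟ b ⌋

_==ℤ_ : ℤ → ℤ → Bool
a ==ℤ b = ⌊ a ℤ.≟ b ⌋

_==W_ : List ℤ → List ℤ → Bool
u ==W v = ⌊ LP.≡-dec ℤ._≟_ u v ⌋

_<ℤ_ : ℤ → ℤ → Bool
a <ℤ b = ⌊ a ℤ.<? b ⌋

_≤ℤ_ : ℤ → ℤ → Bool
a ≤ℤ b = ⌊ a ℤ.≤? b ⌋

distinctB : {A : Set} → (A → A → Bool) → List A → Bool
distinctB eq [] = true
distinctB eq (x ∷ xs) = not (any (eq x) xs) ∧ distinctB eq xs

sortedℤ : List ℤ → Bool
sortedℤ [] = true
sortedℤ (x ∷ []) = true
sortedℤ (x ∷ y ∷ ys) = (x ≤ℤ y) ∧ sortedℤ (y ∷ ys)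

dedupB : {A : Set} → (A → A → Bool) → List A → List A
dedupB eq [] = []
dedupB eq (x ∷ xs) = x ∷ filterᵇ (λ y → not (eq x y)) (dedupB eq xs)

choose : {A : Set} → ℕ → List A → List (List A)
choose zero xs = [] ∷ []
choose (suc k) [] = []
choose (suc k) (x ∷ xs) = map (x ∷_) (choose k xs) L.++ choose (suc k) xs

select : {A : Set} → List A → List (A × List A)
select [] = []
select (x ∷ xs) = (x , xs) ∷ map (λ p → proj₁ p , x ∷ proj₂ p) (select xs)

-- all orderings (= all bijections {1..|D|} → D) of a list
permsF : {A : Set} → ℕ → List A → List (List A)
permsF zero xs = [] ∷ []
permsF (suc f) [] = [] ∷ []
permsF (suc f) xs = concatMap (λ p → map (proj₁ p ∷_) (permsF f (proj₂ p))) (select xs)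

orderings : {A : Set} → List A → List (List A)
orderings xs = permsF (length xs) xs

lookupD : List ℤ → ℕ → ℤ
lookupD [] _ = + 0
lookupD (x ∷ xs) zero = x
lookupD (x ∷ xs) (suc k) = lookupD xs k

maxℕ : List ℕ → ℕ
maxℕ = foldr ℕ._⊔_ 0

sumℚ : List ℚ → ℚ
sumℚ = foldr ℚ._+_ 0ℚ

-- Affine permutations of period n, in window notation [w(1),…,w(n)]

res : ℕ → ℤ → ℕ
res zero i = 0
res (suc k) i = i %ℕ suc k

quo : ℕ → ℤ → ℤ
quo zero i = + 0
quo (suc k) i = i /ℕ suc k

oneTo : ℕ → List ℤ
oneTo n = map (λ k → + suc k) (upTo n)

-- w is an element of the affine symmetric group: w(1),…,w(n) have
-- pairwise distinct residues mod n (⇔ w is a bijection of ℤ) and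
-- Σ w(i) = Σ i
IsAffPerm : ℕ → List ℤ → Set
IsAffPerm n ws = (length ws ≡ n) × Unique (map (res n) ws)
                 × (foldr ℤ._+_ (+ 0) ws ≡ foldr ℤ._+_ (+ 0) (oneTo n))

IsFinPerm : ℕ → List ℤ → Set
IsFinPerm n ws = ws ↭ oneTo n

-- evaluation w(i), using w(i + r n) = w(i) + r n
ev : ℕ → List ℤ → ℤ → ℤ
ev n ws i = lookupD ws (res n (i ℤ.- + 1)) ℤ.+ quo n (i ℤ.- + 1) ℤ.* + n

comp : ℕ → List ℤ → List ℤ → List ℤ
comp n u v = map (λ k → ev n u (ev n v k)) (oneTo n)

tr : ℕ → ℤ → ℤ → ℤ → ℤ
tr n i j k =
  if res n k ==ℕ res n i then k ℤ.+ (j ℤ.- i)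
  else if res n k ==ℕ res n j then k ℤ.- (j ℤ.- i)
  else k

mulT : ℕ → List ℤ → ℤ → ℤ → List ℤ
mulT n ws i j = map (λ k → ev n ws (tr n i j k)) (oneTo n)

-- Length: number of inversions (i,j), 1 ≤ i ≤ n, i < j, w(i) > w(j)
-- (Björner–Brenti Prop. 8.3.1).  With B = max_k |w(k) - k| every such
-- inversion has j - i < 2B, so ranging over j = i+1,…,i+2B is exact.
bnd : ℕ → List ℤ → ℕ
bnd n ws = maxℕ (map (λ k → ℤ.∣ ev n ws k ℤ.- k ∣) (oneTo n))

len : ℕ → List ℤ → ℕ
len n ws =
  length (concatMap
    (λ i → filterᵇ (λ d → ev n ws (i ℤ.+ + suc d) <ℤ ev n ws i)
                   (upTo (2 ℕ.* bnd n ws)))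
    (oneTo n))

-- The affine nilCoxeter algebra 𝔸 over ℚ: finite formal combinations
-- Σ c_w A_w, represented as lists of (c_w , window of w).

Alg : Set
Alg = List (ℚ × List ℤ)

A : List ℤ → Alg
A w = (1ℚ , w) ∷ []

coeff : Alg → List ℤ → ℚ
coeff x u = sumℚ (map proj₁ (filterᵇ (λ p → proj₂ p ==W u) x))

scale : ℚ → Alg → Alg
scale c = map (λ p → c ℚ.* proj₁ p , proj₂ p)

mulA : ℕ → Alg → Alg → Alg
mulA n x y = concatMap (λ p → concatMap (λ q →
    let uv = comp n (proj₂ p) (proj₂ q) in
    if len n uv ==ℕ (len n (proj₂ p) ℕ.+ len n (proj₂ q))
    then (proj₁ p ℚ.* proj₁ q , uv) ∷ [] else []) y) x

actSym : ℕ → ℤ × ℤ → Alg → Alg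
actSym n (i , j) x = concatMap (λ p →
    let u = mulT n (proj₂ p) i j in
    if (len n u ℕ.+ 1) ==ℕ len n (proj₂ p) then (proj₁ p , u) ∷ [] else []) x

actWord : ℕ → List (ℤ × ℤ) → Alg → Alg
actWord n w x = foldl (λ y b → actSym n b y) x w

Box : Set
Box = ℤ × ℤ

_==B_ : Box → Box → Bool
(a , b) ==B (c , d) = (a ==ℤ c) ∧ (b ==ℤ d)

-- vertices of the graph of D (non-isolated vertices)
verts : List Box → List ℤ
verts D = dedupB _==ℤ_ (concatMap (λ b → proj₁ b ∷ proj₂ b ∷ []) D)

grow : List Box → List ℤ → List ℤ
grow D S = S L.++ concatMap (λ b →
   if any (_==ℤ_ (proj₁ b)) S ∨ any (_==ℤ_ (proj₂ b)) S
   then proj₁ b ∷ proj₂ b ∷ [] else []) D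

growF : ℕ → List Box → List ℤ → List ℤ
growF zero D S = S
growF (suc f) D S = growF f D (grow D S)

connectedB : List Box → Bool
connectedB D with verts D
... | [] = true
... | v ∷ vs = all (λ u → any (_==ℤ_ u) (growF (length (v ∷ vs)) D (v ∷ []))) (v ∷ vs)

-- D (a list of distinct boxes) is a connected tree on 𝒟_a with pairwise
-- distinct residues: every box (i,j) has i ≤ a < j, the graph is connected
-- with #vertices = #edges + 1 (i.e. a tree), and residues are distinct.
isTreeB : ℕ → ℤ → List Box → Bool
isTreeB n a D =
  all (λ b → (proj₁ b ≤ℤ a) ∧ (a <ℤ proj₂ b)) D
  ∧ connectedB D
  ∧ (length (verts D) ==ℕ suc (length D))
  ∧ distinctB _==ℕ_ (map (res n) (verts D))

cD : List Box → ℕ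
cD D = length (filterᵇ (λ v → v ≤ℤ + 0) (verts D))

signQ : ℕ → ℚ
signQ zero = 1ℚ
signQ (suc k) = go k
  where
    go : ℕ → ℚ
    go zero = 1ℚ
    go (suc zero) = ℚ.- 1ℚ
    go (suc (suc k)) = go k

rangeℤ : ℤ → ℕ → List ℤ
rangeℤ lo k = map (λ d → lo ℤ.+ + d) (upTo k)

boxesN : ℕ → List Box
boxesN N = concatMap (λ i → map (λ j → i , j) (rangeℤ (+ 1) N)) (rangeℤ (ℤ.- + N) (suc N))

treesN : ℕ → ℕ → ℕ → List (List Box)
treesN n N m = filterᵇ (isTreeB n (+ 0)) (choose m (boxesN N))

goodLab : List Box → List Box → Bool
goodLab D Lw =
  let l = length (dedupB _==ℤ_ (map proj₂ D))
      p = take (l ℕ.∸ 1) Lw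
      q = drop (l ℕ.∸ 1) Lw
  in distinctB _==ℤ_ (map proj₁ p) ∧ sortedℤ (map proj₂ p)
     ∧ distinctB _==ℤ_ (map proj₂ q) ∧ sortedℤ (map proj₁ q)

disjB : Box → Box → Bool
disjB (a , b) (c , d) = not ((a ==ℤ c) ∨ (a ==ℤ d) ∨ (b ==ℤ c) ∨ (b ==ℤ d))

swaps : List Box → List (List Box)
swaps [] = []
swaps (x ∷ []) = []
swaps (x ∷ y ∷ ys) =
  (if disjB x y then (y ∷ x ∷ ys) ∷ [] else [])
  L.++ map (x ∷_) (swaps (y ∷ ys))

reachF : ℕ → List Box → List (List Box)
reachF zero w = w ∷ []
reachF (suc f) w = let r = reachF f w in r L.++ concatMap swaps r

_==Wd_ : List Box → List Box → Bool
[] ==Wd [] = true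
(x ∷ xs) ==Wd (y ∷ ys) = (x ==B y) ∧ (xs ==Wd ys)
_ ==Wd _ = false

-- equivalence of labelings: the words are connected by a sequence of swaps
-- of adjacent letters with disjoint supports (a shortest such sequence
-- visits each of the |D|! orderings at most once, so this fuel is exact)
equivLab : List Box → List Box → Bool
equivLab w w' = any (_==Wd_ w') (reachF (length (orderings w)) w)

reps : ℕ → List (List Box) → List (List Box)
reps zero ws = ws
reps (suc f) [] = []
reps (suc f) (w ∷ ws) = w ∷ reps f (filterᵇ (λ w' → not (equivLab w w')) ws)

MD : List Box → List (List Box)
MD D = let g = filterᵇ (goodLab D) (orderings D) in reps (length g) g

-- D_{p_m^{≤N}}(x): action of the truncation of p_m(0) to trees with all
-- vertices in [-N, N]
actPN : ℕ → ℕ → ℕ → Alg → Alg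
actPN n N m x = concatMap (λ D → concatMap (λ Lw →
     scale (signQ (cD D)) (actWord n Lw x)) (MD D)) (treesN n N m)

{-# OPTIONS --safe #-}

-- Write σ for w′ as a permutation of ℤ; it preserves {x ≤ 0} and {x > 0}.  Since
-- w w′ t_{ij} = w t_{σi,σj} w′, and ℓ is subadditive and drops under t_{ij} exactly when w(i) > w(j), one gets
-- (A_w A_{w′})·[ij] = (A_w·[σi,σj]) A_{w′} for every letter with i ≤ 0 < j.  It remains to see that σ permutes
-- the signed terms of p_m.  It does so up to commuting letters: the two sorting conditions in the definition of
-- M(D) can always be achieved by exchanging adjacent letters with disjoint supports, so the set of classes that
-- M(D) represents depends only on distinctness conditions, and those are σ-equivariant.  Terms with a letter
-- outside a bounded range kill A_w, so truncating p_m does no harm.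

module Submission where

open import Defs
open import Data.Nat using (ℕ; _≤_)
open import Data.Integer using (ℤ)
open import Data.List using (List)
open import Data.Product using (∃)
open import Relation.Binary.PropositionalEquality using (_≡_)

open import Data.Bool using (Bool; true; false; T; not; if_then_else_; _∧_; _∨_)
open import Data.Bool.ListAction using (any; all)
open import Data.Bool.Properties using (T?; T-∧; T-∨)
open import Data.Empty using (⊥; ⊥-elim)
open import Data.Integer as ℤ using (+_; -[1+_]; 0ℤ)
open import Data.Integer.DivMod using (a≡a%ℕn+[a/ℕn]*n; n%ℕd<d)
import Data.Integer.Properties as ℤP
open import Data.Integer.Tactic.RingSolver using (solve-∀)
open import Algebra.Properties.AbelianGroup ℤP.+-0-abelianGroup using () renaming (∙-cancelˡ to +-cancelˡ; ∙-cancelʳ to +-cancelʳ)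
open import Data.List using ([]; _∷_; _++_; map; concatMap; length; filterᵇ; filter; take; drop; upTo; applyUpTo)
import Data.List.Properties as LP
open import Data.List.Membership.Propositional using (_∈_; _∉_; find; lose)
open import Data.List.Membership.Propositional.Properties
open import Data.List.Relation.Binary.Permutation.Propositional as Perm using (_↭_; ↭-refl; ↭-sym; ↭-trans; ↭-reflexive; prep)
import Data.List.Relation.Binary.Permutation.Propositional.Properties as PermP
open import Data.List.Relation.Unary.All as All using (All; []; _∷_)
import Data.List.Relation.Unary.All.Properties as AllP
open import Data.List.Relation.Unary.AllPairs as AllPairs using (AllPairs; []; _∷_)
import Data.List.Relation.Unary.AllPairs.Properties as AllPairsP
open import Data.List.Relation.Unary.Any as Any using (here; there)
import Data.List.Relation.Unary.Any.Properties as AnyP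
open import Data.List.Relation.Unary.Unique.Propositional using (Unique)
import Data.List.Relation.Unary.Unique.Propositional.Properties as UniqueP
open import Data.Nat as ℕ using (zero; suc; z≤n; s≤s)
import Data.Nat.Properties as ℕP
open import Data.Product using (_×_; _,_; proj₁; proj₂; Σ)
open import Data.Product.Properties using () renaming (≡-dec to ×-≡-dec)
open import Data.Rational as ℚ using (ℚ; 0ℚ; 1ℚ)
import Data.Rational.Properties as ℚP
open import Data.Sum using (_⊎_; inj₁; inj₂)
open import Data.Unit using (⊤; tt)
open import Function using (_∘_; Equivalence)
open import Relation.Binary.Definitions using (DecidableEquality; tri<; tri≈; tri>)
open import Relation.Binary.PropositionalEquality using (_≢_; refl; sym; trans; cong; cong₂; subst; subst₂; module ≡-Reasoning)
open import Relation.Nullary using (¬_; yes; no; Dec)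
open import Relation.Nullary.Decidable using (toWitness; fromWitness; ⌊_⌋)

-- Two obstacles rule out a plain bijection of terms. The representatives selected in M(D) are not
-- carried by σ to selected representatives, and the truncated range is not stable under σ. The
-- comparison is therefore between two lists of terms, each meeting every equivalence class at most
-- once, which have the same classes among those of nonzero weight. The truncation carries a margin
-- of n for this purpose: σ and its inverse displace integers by at most n, so the preimage of a
-- word that can act nontrivially is still enumerated.
--
-- Commutation of letters depends on residues, while equivalence of labelings speaks of integers.
-- Distinctness of the residues of tree vertices closes this gap.
--
-- Length enters through two inequalities, subadditivity and strict decrease at an inversion, both
-- proved by matching inversions with inversions. They are enough because a letter must lower the
-- length by exactly one: strict decrease gives at least one, and the known total leaves room for no
-- more.

T-ext : ∀ {a b : Bool} → (T a → T b) → (T b → T a) → a ≡ b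
T-ext {true} {true} _ _ = refl
T-ext {true} {false} f _ = ⊥-elim (f tt)
T-ext {false} {true} _ g = ⊥-elim (g tt)
T-ext {false} {false} _ _ = refl

¬T⇒T-not : ∀ {b} → ¬ T b → T (not b)
¬T⇒T-not {true} ¬b = ⊥-elim (¬b tt)
¬T⇒T-not {false} _ = tt

T-not⇒¬T : ∀ {b} → T (not b) → ¬ T b
T-not⇒¬T {true} ()
T-not⇒¬T {false} _ ()

-- Lists up to permutation, and counting by matching

module _ {X : Set} where

  ∈-split-↭ : ∀ {x : X} {xs} → x ∈ xs → ∃ λ ys → xs ↭ x ∷ ys
  ∈-split-↭ {x} x∈xs with ∈-∃++ x∈xs
  ... | ys , zs , refl = ys ++ zs , PermP.shift x ys zs

  ∈-∷⁻ : ∀ {x y : X} {xs} → x ∈ y ∷ xs → x ≢ y → x ∈ xs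
  ∈-∷⁻ (here x≡y) x≢y = ⊥-elim (x≢y x≡y)
  ∈-∷⁻ (there x∈xs) _ = x∈xs

  ∉⇒All≢ : ∀ {x : X} {xs} → x ∉ xs → All (x ≢_) xs
  ∉⇒All≢ x∉xs = All.tabulate λ y∈xs x≡y → x∉xs (subst (_∈ _) (sym x≡y) y∈xs)

  AllPairs-resp-↭ : ∀ {R : X → X → Set} → (∀ {x y} → R x y → R y x) →
                    ∀ {xs ys} → xs ↭ ys → AllPairs R xs → AllPairs R ys
  AllPairs-resp-↭ s Perm.refl ps = ps
  AllPairs-resp-↭ s (prep x p) (px ∷ ps) = PermP.All-resp-↭ p px ∷ AllPairs-resp-↭ s p ps
  AllPairs-resp-↭ s (Perm.swap x y p) ((xy ∷ px) ∷ py ∷ ps) =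
    (s xy ∷ PermP.All-resp-↭ p py) ∷ PermP.All-resp-↭ p px ∷ AllPairs-resp-↭ s p ps
  AllPairs-resp-↭ s (Perm.trans p q) ps = AllPairs-resp-↭ s q (AllPairs-resp-↭ s p ps)

  Unique-resp-↭ : ∀ {xs ys : List X} → xs ↭ ys → Unique xs → Unique ys
  Unique-resp-↭ = AllPairs-resp-↭ (λ x≢y y≡x → x≢y (sym y≡x))

  Unique∧⊆∧⊇⇒↭ : ∀ {xs ys : List X} → Unique xs → Unique ys →
                 (∀ {x} → x ∈ xs → x ∈ ys) → (∀ {x} → x ∈ ys → x ∈ xs) → xs ↭ ys
  Unique∧⊆∧⊇⇒↭ {[]} {[]} _ _ _ _ = ↭-refl
  Unique∧⊆∧⊇⇒↭ {[]} {y ∷ ys} _ _ _ g with () ← g (here refl)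
  Unique∧⊆∧⊇⇒↭ {x ∷ xs} {ys} (px ∷ uxs) uys f g with ∈-split-↭ (f (here refl))
  ... | zs , ys↭ with Unique-resp-↭ ys↭ uys
  ... | pz ∷ uzs = ↭-trans (prep x (Unique∧⊆∧⊇⇒↭ uxs uzs f′ g′)) (↭-sym ys↭)
    where
    f′ : ∀ {z} → z ∈ xs → z ∈ zs
    f′ z∈xs = ∈-∷⁻ (PermP.∈-resp-↭ ys↭ (f (there z∈xs))) (λ z≡x → All.lookup px z∈xs (sym z≡x))
    g′ : ∀ {z} → z ∈ zs → z ∈ xs
    g′ z∈zs = ∈-∷⁻ (g (PermP.∈-resp-↭ (↭-sym ys↭) (there z∈zs))) (λ z≡x → All.lookup pz z∈zs (sym z≡x))

module _ {X Y : Set} (R : X → Y → Set) where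

  -- The pigeonhole principle for a relation instead of a function. Inversions are matched only up
  -- to translation by a period, so `R` says more directly what is meant than a chosen map would.
  -- Each step removes the partner of `x` from `ys`; injectivity keeps it from being the partner of
  -- any later element.
  matching-length-≤ : ∀ {xs ys} → Unique xs →
    (∀ {x} → x ∈ xs → ∃ λ y → y ∈ ys × R x y) →
    (∀ {x x′ y} → x ∈ xs → x′ ∈ xs → R x y → R x′ y → x ≡ x′) →
    length xs ℕ.≤ length ys
  matching-length-≤ {[]} _ _ _ = z≤n
  matching-length-≤ {x ∷ xs} {ys} (px ∷ uxs) total inj with total (here refl)
  ... | y , y∈ys , Rxy with ∈-split-↭ y∈ys
  ... | zs , ys↭ = ℕP.≤-trans
          (s≤s (matching-length-≤ uxs total′ (λ p q → inj (there p) (there q))))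
          (ℕP.≤-reflexive (sym (PermP.↭-length ys↭)))
    where
    total′ : ∀ {x′} → x′ ∈ xs → ∃ λ y′ → y′ ∈ zs × R x′ y′
    total′ x′∈xs with total (there x′∈xs)
    ... | y′ , y′∈ys , Rx′y′ = y′ , ∈-∷⁻ (PermP.∈-resp-↭ ys↭ y′∈ys)
          (λ { refl → All.lookup px x′∈xs (inj (here refl) (there x′∈xs) Rxy Rx′y′) }) , Rx′y′

  -- Deleting the missed element `y₀` from `ys` leaves a list that still contains all partners.
  matching-length-< : ∀ {xs ys y₀} → Unique xs →
    (∀ {x} → x ∈ xs → ∃ λ y → y ∈ ys × R x y) →
    (∀ {x x′ y} → x ∈ xs → x′ ∈ xs → R x y → R x′ y → x ≡ x′) →
    y₀ ∈ ys → (∀ {x} → x ∈ xs → ¬ R x y₀) →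
    length xs ℕ.< length ys
  matching-length-< {xs} {ys} {y₀} uxs total inj y₀∈ys missed with ∈-split-↭ y₀∈ys
  ... | zs , ys↭ = ℕP.≤-trans (s≤s (matching-length-≤ uxs total′ inj))
                              (ℕP.≤-reflexive (sym (PermP.↭-length ys↭)))
    where
    total′ : ∀ {x′} → x′ ∈ xs → ∃ λ y′ → y′ ∈ zs × R x′ y′
    total′ x′∈xs with total x′∈xs
    ... | y′ , y′∈ys , Rx′y′ = y′ , ∈-∷⁻ (PermP.∈-resp-↭ ys↭ y′∈ys)
          (λ { refl → missed x′∈xs Rx′y′ }) , Rx′y′

Unique⊆⇒length-≤ : ∀ {X : Set} {xs ys : List X} → Unique xs → (∀ {x} → x ∈ xs → x ∈ ys) → length xs ℕ.≤ length ys
Unique⊆⇒length-≤ u xs⊆ys = matching-length-≤ _≡_ u (λ x∈ → _ , xs⊆ys x∈ , refl) (λ { _ _ refl refl → refl })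

-- Sums over representatives of equivalence classes

sumℚ-++ : ∀ xs ys → sumℚ (xs ++ ys) ≡ sumℚ xs ℚ.+ sumℚ ys
sumℚ-++ [] ys = sym (ℚP.+-identityˡ _)
sumℚ-++ (x ∷ xs) ys = trans (cong (x ℚ.+_) (sumℚ-++ xs ys)) (sym (ℚP.+-assoc x _ _))

sumℚ-↭ : ∀ {xs ys} → xs ↭ ys → sumℚ xs ≡ sumℚ ys
sumℚ-↭ Perm.refl = refl
sumℚ-↭ (prep x p) = cong (x ℚ.+_) (sumℚ-↭ p)
sumℚ-↭ (Perm.swap x y p) = trans (sym (ℚP.+-assoc x y _))
  (trans (cong₂ ℚ._+_ (ℚP.+-comm x y) (sumℚ-↭ p)) (ℚP.+-assoc y x _))
sumℚ-↭ (Perm.trans p q) = trans (sumℚ-↭ p) (sumℚ-↭ q)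

module _ {X : Set} (_~_ : X → X → Set)
         (~-sym : ∀ {x y} → x ~ y → y ~ x) (~-trans : ∀ {x y z} → x ~ y → y ~ z → x ~ z)
         (f : X → ℚ) (P : X → Set) (f-resp : ∀ {x y} → P x → x ~ y → f x ≡ f y) where

  Inequivalent : List X → Set
  Inequivalent = AllPairs (λ x y → ¬ (x ~ y))

  sum-of-zeros : ∀ {ys} → (∀ {y} → y ∈ ys → f y ≢ 0ℚ → ⊥) → sumℚ (map f ys) ≡ 0ℚ
  sum-of-zeros {[]} _ = refl
  sum-of-zeros {y ∷ ys} h with f y ℚ.≟ 0ℚ
  ... | yes fy≡0 = trans (cong₂ ℚ._+_ fy≡0 (sum-of-zeros (h ∘ there))) (ℚP.+-identityˡ 0ℚ)
  ... | no fy≢0 = ⊥-elim (h (here refl) fy≢0)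

  -- Classes on which f vanishes need not be matched; this absorbs the truncation of p_m.
  transversal-sum : ∀ {xs ys} → Inequivalent xs → Inequivalent ys → All P xs → All P ys →
    (∀ {x} → x ∈ xs → f x ≢ 0ℚ → ∃ λ y → y ∈ ys × x ~ y) →
    (∀ {y} → y ∈ ys → f y ≢ 0ℚ → ∃ λ x → x ∈ xs × x ~ y) →
    sumℚ (map f xs) ≡ sumℚ (map f ys)
  transversal-sum {[]} _ _ _ _ to from = sym (sum-of-zeros λ y∈ys fy≢0 → no-member (from y∈ys fy≢0))
    where
    no-member : ∀ {Q : X → Set} → (∃ λ x → x ∈ [] × Q x) → ⊥
    no-member (_ , () , _)
  transversal-sum {x ∷ xs} {ys} (px ∷ axs) ays (Px ∷ Pxs) Pys to from with f x ℚ.≟ 0ℚ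
  ... | yes fx≡0 = trans (cong₂ ℚ._+_ fx≡0 (transversal-sum axs ays Pxs Pys (to ∘ there) from′)) (ℚP.+-identityˡ _)
    where
    from′ : ∀ {y} → y ∈ ys → f y ≢ 0ℚ → ∃ λ x′ → x′ ∈ xs × x′ ~ y
    from′ y∈ys fy≢0 with from y∈ys fy≢0
    ... | _ , here refl , x~y = ⊥-elim (fy≢0 (trans (sym (f-resp Px x~y)) fx≡0))
    ... | x′ , there x′∈xs , x′~y = x′ , x′∈xs , x′~y
  ... | no fx≢0 with to (here refl) fx≢0
  ... | y , y∈ys , x~y with ∈-split-↭ y∈ys
  ... | zs , ys↭ with AllPairs-resp-↭ (λ ¬s s → ¬s (~-sym s)) ys↭ ays | PermP.All-resp-↭ ys↭ Pys
  ... | py ∷ azs | Py ∷ Pzs = trans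
          (cong₂ ℚ._+_ (f-resp Px x~y) (transversal-sum axs azs Pxs Pzs to′ from′))
          (sym (sumℚ-↭ (PermP.map⁺ f ys↭)))
    where
    to′ : ∀ {x′} → x′ ∈ xs → f x′ ≢ 0ℚ → ∃ λ z → z ∈ zs × x′ ~ z
    to′ x′∈xs fx′≢0 with to (there x′∈xs) fx′≢0
    ... | z , z∈ys , x′~z = z , ∈-∷⁻ (PermP.∈-resp-↭ ys↭ z∈ys)
          (λ { refl → All.lookup px x′∈xs (~-trans x~y (~-sym x′~z)) }) , x′~z
    from′ : ∀ {z} → z ∈ zs → f z ≢ 0ℚ → ∃ λ x′ → x′ ∈ xs × x′ ~ z
    from′ z∈zs fz≢0 with from (PermP.∈-resp-↭ (↭-sym ys↭) (there z∈zs)) fz≢0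
    ... | _ , here refl , x~z = ⊥-elim (All.lookup py z∈zs (~-trans (~-sym x~y) x~z))
    ... | x′ , there x′∈xs , x′~z = x′ , x′∈xs , x′~z

-- Walks and loop erasure

module _ {X : Set} (_≟_ : DecidableEquality X) (R : X → X → Set) where

  -- Used for two searches with fuel: swaps of adjacent letters between words, and edges between the
  -- vertices of a tree.
  data Path : X → X → Set where
    stop : ∀ {x} → Path x x
    step : ∀ {x y z} → R x y → Path y z → Path x z

  path-trans : ∀ {x y z} → Path x y → Path y z → Path x z
  path-trans stop q = q
  path-trans (step r p) q = step r (path-trans p q)

  path-sym : (∀ {x y} → R x y → R y x) → ∀ {x y} → Path x y → Path y x
  path-sym s stop = stop
  path-sym s (step r p) = path-trans (path-sym s p) (step (s r) stop)

  visited : ∀ {x y} → Path x y → List X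
  visited {x} stop = x ∷ []
  visited {x} (step _ p) = x ∷ visited p

  suffix-from : ∀ {x y z} (p : Path x y) → Unique (visited p) → z ∈ visited p →
                Σ (Path z y) λ q → Unique (visited q)
  suffix-from stop u (here refl) = stop , u
  suffix-from p@(step _ _) u (here refl) = p , u
  suffix-from (step _ p) (_ ∷ u) (there z∈) = suffix-from p u z∈

  open import Data.List.Membership.DecPropositional _≟_ using (_∈?_)

  -- Loop erasure: if the start occurs again on the simplified remainder, only the part from that
  -- occurrence on is kept.
  simple-path : ∀ {x y} → Path x y → Σ (Path x y) λ q → Unique (visited q)
  simple-path stop = stop , ([] ∷ [])
  simple-path {x} (step r p) with simple-path p
  ... | q , u with x ∈? visited q
  ... | yes x∈q = suffix-from q u x∈q
  ... | no x∉q = step r q , (∉⇒All≢ x∉q ∷ u)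

  visited-closed : ∀ {P : X → Set} → (∀ {x y} → R x y → P x → P y) →
                   ∀ {x y} (p : Path x y) → P x → All P (visited p)
  visited-closed h stop Px = Px ∷ []
  visited-closed h (step r p) Px = Px ∷ visited-closed h p (h r Px)

  -- Within a finite R-closed set of vertices, fuel equal to the size of the set suffices.
  bounded-path : ∀ {xs x y} → x ∈ xs → (∀ {a b} → R a b → a ∈ xs → b ∈ xs) → Path x y →
                 Σ (Path x y) λ q → length (visited q) ℕ.≤ length xs
  bounded-path x∈xs closed p with simple-path p
  ... | q , u = q , Unique⊆⇒length-≤ u (All.lookup (visited-closed closed q x∈xs))

concatMap-pairs-unique : ∀ {X Y : Set} (g : X → List Y) {xs} → Unique xs → (∀ x → Unique (g x)) →
  Unique (concatMap (λ x → map (x ,_) (g x)) xs)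
concatMap-pairs-unique g [] _ = []
concatMap-pairs-unique {X} {Y} g {x ∷ xs} (px ∷ u) ug = UniqueP.++⁺ (UniqueP.map⁺ (cong proj₂) (ug x)) (concatMap-pairs-unique g u ug)
  λ (p∈ , p∈′) → disjoint p∈ p∈′
  where
  disjoint : ∀ {p : X × Y} → p ∈ map (x ,_) (g x) → p ∈ concatMap (λ i → map (i ,_) (g i)) xs → ⊥
  disjoint p∈ p∈′ with ∈-map⁻ (x ,_) p∈ | find (∈-concatMap⁻ (λ i → map (i ,_) (g i)) {xs} p∈′)
  ... | d , _ , refl | i , i∈ , p∈″ with ∈-map⁻ (i ,_) p∈″
  ... | _ , _ , refl = All.lookup px i∈ refl

-- Affine permutations

private
  shift-by-difference : ∀ {a b c d} → b ℤ.- a ≡ d ℤ.- c → b ℤ.+ (c ℤ.- a) ≡ d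
  shift-by-difference {a} {b} {c} {d} eq = trans (e₁ a b c) (trans (cong (ℤ._+ c) eq) (e₂ c d))
    where
    e₁ : ∀ a b c → b ℤ.+ (c ℤ.- a) ≡ (b ℤ.- a) ℤ.+ c
    e₁ = solve-∀
    e₂ : ∀ c d → (d ℤ.- c) ℤ.+ c ≡ d
    e₂ = solve-∀

  a+[c-a]≡c : ∀ a c → a ℤ.+ (c ℤ.- a) ≡ c
  a+[c-a]≡c = solve-∀

-- With the difference identity left to the ring solver, these two lemmas replace linear arithmetic.
<-by-difference : ∀ {a b c d} → a ℤ.< b → b ℤ.- a ≡ d ℤ.- c → c ℤ.< d
<-by-difference {a} {b} {c} {d} a<b eq =
  subst₂ ℤ._<_ (a+[c-a]≡c a c) (shift-by-difference {a} {b} {c} {d} eq) (ℤP.+-monoˡ-< (c ℤ.- a) a<b)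

≤-by-difference : ∀ {a b c d} → a ℤ.≤ b → b ℤ.- a ≡ d ℤ.- c → c ℤ.≤ d
≤-by-difference {a} {b} {c} {d} a≤b eq =
  subst₂ ℤ._≤_ (a+[c-a]≡c a c) (shift-by-difference {a} {b} {c} {d} eq) (ℤP.+-monoˡ-≤ (c ℤ.- a) a≤b)

<⇒+suc : ∀ {a b} → a ℤ.< b → ∃ λ d → b ≡ a ℤ.+ + suc d
<⇒+suc {a} {b} a<b with b ℤ.- a in eq | <-by-difference {c = 0ℤ} {d = b ℤ.- a} a<b (e₀ (b ℤ.- a))
  where
  e₀ : ∀ x → x ≡ x ℤ.- 0ℤ
  e₀ = solve-∀
... | + suc d | _ = d , trans (e a b) (cong (λ z → a ℤ.+ z) eq)
  where
  e : ∀ a b → b ≡ a ℤ.+ (b ℤ.- a)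
  e = solve-∀
... | + zero | ℤ.+<+ ()

a<a+suc : ∀ a d → a ℤ.< a ℤ.+ + suc d
a<a+suc a d = subst (ℤ._< a ℤ.+ + suc d) (ℤP.+-identityʳ a) (ℤP.+-monoʳ-< a (ℤ.+<+ (s≤s z≤n)))

lookupD-map : ∀ f (xs : List ℤ) {r} → r ℕ.< length xs → lookupD (map f xs) r ≡ f (lookupD xs r)
lookupD-map f (x ∷ xs) {zero} _ = refl
lookupD-map f (x ∷ xs) {suc r} (s≤s r<) = lookupD-map f xs r<

lookupD-applyUpTo : ∀ (f : ℕ → ℤ) n {r} → r ℕ.< n → lookupD (applyUpTo f n) r ≡ f r
lookupD-applyUpTo f (suc n) {zero} _ = refl
lookupD-applyUpTo f (suc n) {suc r} (s≤s r<n) = lookupD-applyUpTo (f ∘ suc) n r<n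

lookupD-∈ : ∀ (xs : List ℤ) {r} → r ℕ.< length xs → lookupD xs r ∈ xs
lookupD-∈ (x ∷ xs) {zero} _ = here refl
lookupD-∈ (x ∷ xs) {suc r} (s≤s r<) = there (lookupD-∈ xs r<)

∈-lookupD : ∀ {xs : List ℤ} {x} → x ∈ xs → ∃ λ r → r ℕ.< length xs × lookupD xs r ≡ x
∈-lookupD (here refl) = 0 , s≤s z≤n , refl
∈-lookupD (there x∈) with ∈-lookupD x∈
... | r , r< , eq = suc r , s≤s r< , eq

lookupD-ext : ∀ (xs ys : List ℤ) → length xs ≡ length ys →
              (∀ {r} → r ℕ.< length xs → lookupD xs r ≡ lookupD ys r) → xs ≡ ys
lookupD-ext [] [] _ _ = refl
lookupD-ext (x ∷ xs) (y ∷ ys) eq h =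
  cong₂ _∷_ (h (s≤s z≤n)) (lookupD-ext xs ys (ℕP.suc-injective eq) (λ r< → h (s≤s r<)))

lookupD-injective-on : ∀ (g : ℤ → ℕ) (xs : List ℤ) → Unique (map g xs) →
  ∀ {r s} → r ℕ.< length xs → s ℕ.< length xs → g (lookupD xs r) ≡ g (lookupD xs s) → r ≡ s
lookupD-injective-on g (x ∷ xs) u {zero} {zero} _ _ _ = refl
lookupD-injective-on g (x ∷ xs) (p ∷ u) {zero} {suc s} _ (s≤s s<) eq =
  ⊥-elim (All.lookup p (∈-map⁺ g (lookupD-∈ xs s<)) eq)
lookupD-injective-on g (x ∷ xs) (p ∷ u) {suc r} {zero} (s≤s r<) _ eq =
  ⊥-elim (All.lookup p (∈-map⁺ g (lookupD-∈ xs r<)) (sym eq))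
lookupD-injective-on g (x ∷ xs) (p ∷ u) {suc r} {suc s} (s≤s r<) (s≤s s<) eq =
  cong suc (lookupD-injective-on g xs u r< s< eq)

∈⇒≤maxℕ : ∀ {x xs} → x ∈ xs → x ℕ.≤ maxℕ xs
∈⇒≤maxℕ {xs = y ∷ xs} (here refl) = ℕP.m≤m⊔n y _
∈⇒≤maxℕ {xs = y ∷ xs} (there x∈) = ℕP.≤-trans (∈⇒≤maxℕ x∈) (ℕP.m≤n⊔m y _)

module Affine (k : ℕ) where

  n : ℕ
  n = suc k

  infixl 6 _⊹_
  opaque
    -- Translation by `c` periods. It is opaque so that goals keep this shape instead of unfolding
    -- into integer multiplication.
    _⊹_ : ℤ → ℤ → ℤ
    x ⊹ c = x ℤ.+ c ℤ.* + n

    ⊹-def : ∀ x c → x ⊹ c ≡ x ℤ.+ c ℤ.* + n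
    ⊹-def x c = refl

    ⊹-assoc : ∀ x c d → (x ⊹ c) ⊹ d ≡ x ⊹ (c ℤ.+ d)
    ⊹-assoc x c d = e x c d (+ n)
      where
      e : ∀ x c d n → (x ℤ.+ c ℤ.* n) ℤ.+ d ℤ.* n ≡ x ℤ.+ (c ℤ.+ d) ℤ.* n
      e = solve-∀

    ⊹-0 : ∀ x → x ⊹ 0ℤ ≡ x
    ⊹-0 x = ℤP.+-identityʳ x

    ⊹-+ : ∀ x y c → (x ℤ.+ y) ⊹ c ≡ x ℤ.+ (y ⊹ c)
    ⊹-+ x y c = ℤP.+-assoc x y (c ℤ.* + n)

    ⊹-mono-< : ∀ {x y} c → x ℤ.< y → x ⊹ c ℤ.< y ⊹ c
    ⊹-mono-< c = ℤP.+-monoˡ-< (c ℤ.* + n)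

    ⊹-cancel-< : ∀ {x y} c → x ⊹ c ℤ.< y ⊹ c → x ℤ.< y
    ⊹-cancel-< {x} {y} c lt = <-by-difference lt (e x y (c ℤ.* + n))
      where
      e : ∀ x y z → (y ℤ.+ z) ℤ.- (x ℤ.+ z) ≡ y ℤ.- x
      e = solve-∀

    ⊹-cancelˡ : ∀ {x c d} → x ⊹ c ≡ x ⊹ d → c ≡ d
    ⊹-cancelˡ {x} {c} {d} eq = ℤP.*-cancelʳ-≡ c d (+ n) (+-cancelˡ x (c ℤ.* + n) (d ℤ.* + n) eq)

    ⊹-cancelʳ : ∀ {x y c} → x ⊹ c ≡ y ⊹ c → x ≡ y
    ⊹-cancelʳ {x} {y} {c} eq = +-cancelʳ (c ℤ.* + n) x y eq

    -- A remainder below n keeps the left side under (q + 1) n, and q + 1 is at most q′.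
    lower-quotient-< : ∀ {r r′ q q′} → r ℕ.< n → q ℤ.< q′ → (+ r) ⊹ q ℤ.< (+ r′) ⊹ q′
    lower-quotient-< {r} {r′} {q} {q′} r<n q<q′ = begin-strict
      + r ℤ.+ q ℤ.* + n     <⟨ ℤP.+-monoˡ-< (q ℤ.* + n) (ℤ.+<+ r<n) ⟩
      + n ℤ.+ q ℤ.* + n     ≡⟨ sym (ℤP.suc-* q (+ n)) ⟩
      ℤ.suc q ℤ.* + n       ≤⟨ ℤP.*-monoʳ-≤-nonNeg (+ n) (ℤP.i<j⇒suc[i]≤j q<q′) ⟩
      q′ ℤ.* + n            ≡⟨ sym (ℤP.+-identityˡ _) ⟩
      0ℤ ℤ.+ q′ ℤ.* + n     ≤⟨ ℤP.+-monoˡ-≤ (q′ ℤ.* + n) (ℤ.+≤+ z≤n) ⟩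
      + r′ ℤ.+ q′ ℤ.* + n   ∎
      where open ℤP.≤-Reasoning

  divMod-unique : ∀ {r r′ q q′} → r ℕ.< n → r′ ℕ.< n → (+ r) ⊹ q ≡ (+ r′) ⊹ q′ → r ≡ r′ × q ≡ q′
  divMod-unique {r} {r′} {q} {q′} r<n r′<n eq with ℤP.<-cmp q q′
  ... | tri< q<q′ _ _ = ⊥-elim (ℤP.<-irrefl eq (lower-quotient-< r<n q<q′))
  ... | tri> _ _ q>q′ = ⊥-elim (ℤP.<-irrefl (sym eq) (lower-quotient-< r′<n q>q′))
  ... | tri≈ _ refl _ = ℤP.+-injective (⊹-cancelʳ eq) , refl

  res<n : ∀ x → res n x ℕ.< n
  res<n x = n%ℕd<d x n

  divMod : ∀ x → x ≡ (+ res n x) ⊹ quo n x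
  divMod x = trans (a≡a%ℕn+[a/ℕn]*n x n) (sym (⊹-def (+ res n x) (quo n x)))

  divMod-⊹ : ∀ x c → (+ res n (x ⊹ c)) ⊹ quo n (x ⊹ c) ≡ (+ res n x) ⊹ (quo n x ℤ.+ c)
  divMod-⊹ x c = trans (sym (divMod (x ⊹ c))) (trans (cong (_⊹ c) (divMod x)) (⊹-assoc (+ res n x) (quo n x) c))

  res-⊹ : ∀ x c → res n (x ⊹ c) ≡ res n x
  res-⊹ x c = proj₁ (divMod-unique (res<n (x ⊹ c)) (res<n x) (divMod-⊹ x c))

  quo-⊹ : ∀ x c → quo n (x ⊹ c) ≡ quo n x ℤ.+ c
  quo-⊹ x c = proj₂ (divMod-unique (res<n (x ⊹ c)) (res<n x) (divMod-⊹ x c))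

  res-≡⇒⊹ : ∀ {x y} → res n x ≡ res n y → ∃ λ c → x ≡ y ⊹ c
  res-≡⇒⊹ {x} {y} eq = quo n x ℤ.- quo n y , (begin
    x                                              ≡⟨ divMod x ⟩
    (+ res n x) ⊹ quo n x                          ≡⟨ cong (λ r → (+ r) ⊹ quo n x) eq ⟩
    (+ res n y) ⊹ quo n x                          ≡⟨ cong ((+ res n y) ⊹_) (e (quo n x) (quo n y)) ⟩
    (+ res n y) ⊹ (quo n y ℤ.+ (quo n x ℤ.- quo n y)) ≡⟨ sym (⊹-assoc (+ res n y) _ _) ⟩
    (+ res n y) ⊹ quo n y ⊹ (quo n x ℤ.- quo n y)  ≡⟨ cong (_⊹ (quo n x ℤ.- quo n y)) (sym (divMod y)) ⟩
    y ⊹ (quo n x ℤ.- quo n y)                      ∎)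
    where
    open ≡-Reasoning
    e : ∀ a b → a ≡ b ℤ.+ (a ℤ.- b)
    e = solve-∀

  ⊹⇒res-≡ : ∀ {x y c} → x ≡ y ⊹ c → res n x ≡ res n y
  ⊹⇒res-≡ {y = y} {c} refl = res-⊹ y c

  ∈-oneTo⁻ : ∀ {x} → x ∈ oneTo n → ∃ λ r → r ℕ.< n × x ≡ + suc r
  ∈-oneTo⁻ x∈ with ∈-map⁻ (λ k → + suc k) x∈
  ... | r , r∈ , eq = r , ∈-upTo⁻ r∈ , eq

  ∈-oneTo⁺ : ∀ {r} → r ℕ.< n → + suc r ∈ oneTo n
  ∈-oneTo⁺ r<n = ∈-map⁺ (λ k → + suc k) (∈-upTo⁺ r<n)

  oneTo-unique : Unique (oneTo n)
  oneTo-unique = UniqueP.map⁺ (λ eq → ℕP.suc-injective (ℤP.+-injective eq)) (UniqueP.upTo⁺ n)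

  length-oneTo : length (oneTo n) ≡ n
  length-oneTo = trans (LP.length-map _ (upTo n)) (LP.length-applyUpTo (λ x → x) n)

  lookupD-map-oneTo : ∀ f {r} → r ℕ.< n → lookupD (map f (oneTo n)) r ≡ f (+ suc r)
  lookupD-map-oneTo f {r} r<n = trans
    (lookupD-map f (oneTo n) (subst (r ℕ.<_) (sym length-oneTo) r<n))
    (cong f (trans (cong (λ xs → lookupD xs r) (LP.map-upTo (λ k → + suc k) n)) (lookupD-applyUpTo (λ k → + suc k) n r<n)))

  -- Windows start at 1, so list position r holds the value at `+ suc r`; hence the shift by one
  -- before the division.
  window-⊹ : ∀ x → x ≡ (+ suc (res n (x ℤ.- + 1))) ⊹ quo n (x ℤ.- + 1)
  window-⊹ x = trans (e x) (trans (cong (λ z → + 1 ℤ.+ z) (divMod (x ℤ.- + 1)))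
      (sym (⊹-+ (+ 1) (+ res n (x ℤ.- + 1)) (quo n (x ℤ.- + 1)))))
    where
    e : ∀ x → x ≡ + 1 ℤ.+ (x ℤ.- + 1)
    e = solve-∀

  oneTo-representative : ∀ x → ∃ λ i → i ∈ oneTo n × ∃ λ c → x ≡ i ⊹ c
  oneTo-representative x = _ , ∈-oneTo⁺ (res<n (x ℤ.- + 1)) , _ , window-⊹ x

  oneTo-⊹-injective : ∀ {i i′ c c′} → i ∈ oneTo n → i′ ∈ oneTo n → i ⊹ c ≡ i′ ⊹ c′ → i ≡ i′ × c ≡ c′
  oneTo-⊹-injective {c = c} {c′} i∈ i′∈ eq with ∈-oneTo⁻ i∈ | ∈-oneTo⁻ i′∈
  ... | r , r<n , refl | r′ , r′<n , refl with divMod-unique {q = c} {c′} r<n r′<n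
      (+-cancelˡ (+ 1) _ _ (trans (sym (⊹-+ (+ 1) (+ r) c)) (trans eq (⊹-+ (+ 1) (+ r′) c′))))
  ... | refl , refl = refl , refl

  Periodic : (ℤ → ℤ) → Set
  Periodic f = ∀ x c → f (x ⊹ c) ≡ f x ⊹ c

  Injective : (ℤ → ℤ) → Set
  Injective f = ∀ {x y} → f x ≡ f y → x ≡ y

  ∘-periodic : ∀ {f g} → Periodic f → Periodic g → Periodic (f ∘ g)
  ∘-periodic {f} {g} pf pg x c = trans (cong f (pg x c)) (pf (g x) c)

  ev-⊹ : ∀ ws x → ev n ws x ≡ lookupD ws (res n (x ℤ.- + 1)) ⊹ quo n (x ℤ.- + 1)
  ev-⊹ ws x = sym (⊹-def (lookupD ws (res n (x ℤ.- + 1))) (quo n (x ℤ.- + 1)))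

  ev-periodic : ∀ ws → Periodic (ev n ws)
  ev-periodic ws x c = begin
    ev n ws (x ⊹ c)  ≡⟨ ev-⊹ ws (x ⊹ c) ⟩
    lookupD ws (res n (x ⊹ c ℤ.- + 1)) ⊹ quo n (x ⊹ c ℤ.- + 1)
      ≡⟨ cong (λ y → lookupD ws (res n y) ⊹ quo n y) (e x c) ⟩
    lookupD ws (res n ((x ℤ.- + 1) ⊹ c)) ⊹ quo n ((x ℤ.- + 1) ⊹ c)
      ≡⟨ cong₂ (λ r q → lookupD ws r ⊹ q) (res-⊹ (x ℤ.- + 1) c) (quo-⊹ (x ℤ.- + 1) c) ⟩
    lookupD ws (res n (x ℤ.- + 1)) ⊹ (quo n (x ℤ.- + 1) ℤ.+ c)
      ≡⟨ sym (⊹-assoc (lookupD ws (res n (x ℤ.- + 1))) _ c) ⟩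
    lookupD ws (res n (x ℤ.- + 1)) ⊹ quo n (x ℤ.- + 1) ⊹ c
      ≡⟨ cong (_⊹ c) (sym (ev-⊹ ws x)) ⟩
    ev n ws x ⊹ c ∎
    where
    open ≡-Reasoning
    e : ∀ x c → x ⊹ c ℤ.- + 1 ≡ (x ℤ.- + 1) ⊹ c
    e x c = trans (ℤP.+-comm (x ⊹ c) (ℤ.- + 1)) (trans (sym (⊹-+ (ℤ.- + 1) x c)) (cong (_⊹ c) (ℤP.+-comm (ℤ.- + 1) x)))

  -- Both `comp` and `mulT` tabulate a periodic function on the window, so this one computation
  -- evaluates products and reflections everywhere.
  ev-window : ∀ {f} → Periodic f → ∀ x → ev n (map f (oneTo n)) x ≡ f x
  ev-window {f} pf x = begin
    ev n (map f (oneTo n)) x         ≡⟨ ev-⊹ (map f (oneTo n)) x ⟩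
    lookupD (map f (oneTo n)) r ⊹ q  ≡⟨ cong (_⊹ q) (lookupD-map-oneTo f (res<n (x ℤ.- + 1))) ⟩
    f (+ suc r) ⊹ q                  ≡⟨ sym (pf (+ suc r) q) ⟩
    f ((+ suc r) ⊹ q)                ≡⟨ cong f (sym (window-⊹ x)) ⟩
    f x                              ∎
    where
    open ≡-Reasoning
    r = res n (x ℤ.- + 1)
    q = quo n (x ℤ.- + 1)

  ev-suc : ∀ ws {r} → r ℕ.< n → ev n ws (+ suc r) ≡ lookupD ws r
  ev-suc ws {r} r<n with divMod-unique {q = 0ℤ} r<n (res<n (+ suc r ℤ.- + 1))
                           (trans (⊹-0 (+ r)) (trans (e (+ r)) (divMod (+ suc r ℤ.- + 1))))
    where
    e : ∀ x → x ≡ (+ 1 ℤ.+ x) ℤ.- + 1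
    e = solve-∀
  ... | r≡ , 0≡ = trans (ev-⊹ ws (+ suc r)) (trans (cong₂ (λ s q → lookupD ws s ⊹ q) (sym r≡) (sym 0≡)) (⊹-0 (lookupD ws r)))

  map-ev-oneTo : ∀ ws → length ws ≡ n → map (ev n ws) (oneTo n) ≡ ws
  map-ev-oneTo ws len≡n = lookupD-ext _ ws
    (trans (LP.length-map (ev n ws) (oneTo n)) (trans length-oneTo (sym len≡n)))
    λ {r} r< → let r<n = subst (r ℕ.<_) (trans (LP.length-map (ev n ws) (oneTo n)) length-oneTo) r< in
      trans (lookupD-map-oneTo (ev n ws) r<n) (ev-suc ws r<n)

  -- Equal values have equal residues, which forces the same window position; the number of periods
  -- then agrees as well.
  ev-injective : ∀ ws → length ws ≡ n → Unique (map (res n) ws) → Injective (ev n ws)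
  ev-injective ws len≡n u {x} {y} eq = trans (window-⊹ x) (trans (cong₂ (λ r q → (+ suc r) ⊹ q) r≡ q≡) (sym (window-⊹ y)))
    where
    rx = res n (x ℤ.- + 1)
    ry = res n (y ℤ.- + 1)
    qx = quo n (x ℤ.- + 1)
    qy = quo n (y ℤ.- + 1)
    in-range : ∀ z → res n (z ℤ.- + 1) ℕ.< length ws
    in-range z = subst (res n (z ℤ.- + 1) ℕ.<_) (sym len≡n) (res<n (z ℤ.- + 1))
    eq′ : lookupD ws rx ⊹ qx ≡ lookupD ws ry ⊹ qy
    eq′ = trans (sym (ev-⊹ ws x)) (trans eq (ev-⊹ ws y))
    r≡ : rx ≡ ry
    r≡ = lookupD-injective-on (res n) ws u (in-range x) (in-range y)
           (trans (sym (res-⊹ (lookupD ws rx) qx)) (trans (cong (res n) eq′) (res-⊹ (lookupD ws ry) qy)))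
    q≡ : qx ≡ qy
    q≡ = ⊹-cancelˡ (trans eq′ (cong (λ r → lookupD ws r ⊹ qy) (sym r≡)))

  ev-comp : ∀ u v x → ev n (comp n u v) x ≡ ev n u (ev n v x)
  ev-comp u v = ev-window {ev n u ∘ ev n v} (∘-periodic {ev n u} {ev n v} (ev-periodic u) (ev-periodic v))

-- Inversions and length

==ℕ-true : ∀ {a b} → a ≡ b → (a ==ℕ b) ≡ true
==ℕ-true {a} {b} a≡b with a ℕ.≟ b
... | yes _ = refl
... | no a≢b = ⊥-elim (a≢b a≡b)

==ℕ-false : ∀ {a b} → a ≢ b → (a ==ℕ b) ≡ false
==ℕ-false {a} {b} a≢b with a ℕ.≟ b
... | yes a≡b = ⊥-elim (a≢b a≡b)
... | no _ = refl

length-concatMap-map : ∀ {X Y Z : Set} (g : X → Y → Z) (f : X → List Y) xs →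
  length (concatMap (λ x → map (g x) (f x)) xs) ≡ length (concatMap f xs)
length-concatMap-map g f [] = refl
length-concatMap-map g f (x ∷ xs) = trans (LP.length-++ (map (g x) (f x)))
  (trans (cong₂ ℕ._+_ (LP.length-map (g x) (f x)) (length-concatMap-map g f xs)) (sym (LP.length-++ (f x))))

module Length (k : ℕ) where
  open Affine k

  -- A record and not a bare inequality of residues, so that `i` and `j` can be inferred from a
  -- proof of it.
  record Incongruent (i j : ℤ) : Set where
    constructor incongruent
    field res-≢ : res n i ≢ res n j
  open Incongruent public

  opaque
    t : ℤ → ℤ → ℤ → ℤ
    t = tr n

    t-def : ∀ i j x → t i j x ≡ tr n i j x
    t-def i j x = refl

    t-at-first : ∀ i j x → res n x ≡ res n i → t i j x ≡ x ℤ.+ (j ℤ.- i)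
    t-at-first i j x eq = cong (λ b → if b then x ℤ.+ (j ℤ.- i) else
      if res n x ==ℕ res n j then x ℤ.- (j ℤ.- i) else x) (==ℕ-true eq)

    t-at-second : ∀ i j x → res n x ≢ res n i → res n x ≡ res n j → t i j x ≡ x ℤ.- (j ℤ.- i)
    t-at-second i j x neq eq = trans
      (cong (λ b → if b then x ℤ.+ (j ℤ.- i) else
        if res n x ==ℕ res n j then x ℤ.- (j ℤ.- i) else x) (==ℕ-false neq))
      (cong (λ b → if b then x ℤ.- (j ℤ.- i) else x) (==ℕ-true eq))

    t-fixes : ∀ i j x → res n x ≢ res n i → res n x ≢ res n j → t i j x ≡ x
    t-fixes i j x neq neq′ = trans
      (cong (λ b → if b then x ℤ.+ (j ℤ.- i) else
        if res n x ==ℕ res n j then x ℤ.- (j ℤ.- i) else x) (==ℕ-false neq))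
      (cong (λ b → if b then x ℤ.- (j ℤ.- i) else x) (==ℕ-false neq′))

  t-first : ∀ i j c → t i j (i ⊹ c) ≡ j ⊹ c
  t-first i j c = trans (t-at-first i j (i ⊹ c) (res-⊹ i c))
    (trans (cong (ℤ._+ (j ℤ.- i)) (⊹-def i c)) (trans (e i j (c ℤ.* + n)) (sym (⊹-def j c))))
    where
    e : ∀ i j y → i ℤ.+ y ℤ.+ (j ℤ.- i) ≡ j ℤ.+ y
    e = solve-∀

  t-second : ∀ i j c → Incongruent i j → t i j (j ⊹ c) ≡ i ⊹ c
  t-second i j c i≢j = trans (t-at-second i j (j ⊹ c) (λ eq → res-≢ i≢j (trans (sym eq) (res-⊹ j c))) (res-⊹ j c))
    (trans (cong (ℤ._- (j ℤ.- i)) (⊹-def j c)) (trans (e i j (c ℤ.* + n)) (sym (⊹-def i c))))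
    where
    e : ∀ i j y → j ℤ.+ y ℤ.- (j ℤ.- i) ≡ i ℤ.+ y
    e = solve-∀

  data TCase (i j x : ℤ) : Set where
    first  : ∀ c → x ≡ i ⊹ c → TCase i j x
    second : ∀ c → x ≡ j ⊹ c → TCase i j x
    fixed  : res n x ≢ res n i → res n x ≢ res n j → TCase i j x

  tCase : ∀ i j x → TCase i j x
  tCase i j x with res n x ℕ.≟ res n i
  ... | yes eq = let c , x≡ = res-≡⇒⊹ eq in first c x≡
  ... | no neq with res n x ℕ.≟ res n j
  ... | yes eq = let c , x≡ = res-≡⇒⊹ eq in second c x≡
  ... | no neq′ = fixed neq neq′

  t-periodic : ∀ {i j} → Incongruent i j → Periodic (t i j)
  t-periodic {i} {j} i≢j x d with tCase i j x
  ... | first c refl = trans (cong (t i j) (⊹-assoc i c d))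
        (trans (t-first i j (c ℤ.+ d)) (trans (sym (⊹-assoc j c d)) (cong (_⊹ d) (sym (t-first i j c)))))
  ... | second c refl = trans (cong (t i j) (⊹-assoc j c d))
        (trans (t-second i j (c ℤ.+ d) i≢j) (trans (sym (⊹-assoc i c d)) (cong (_⊹ d) (sym (t-second i j c i≢j)))))
  ... | fixed x≢i x≢j = trans
        (t-fixes i j (x ⊹ d) (λ eq → x≢i (trans (sym (res-⊹ x d)) eq)) (λ eq → x≢j (trans (sym (res-⊹ x d)) eq)))
        (cong (_⊹ d) (sym (t-fixes i j x x≢i x≢j)))

  t-involutive : ∀ {i j} → Incongruent i j → ∀ x → t i j (t i j x) ≡ x
  t-involutive {i} {j} i≢j x with tCase i j x
  ... | first c refl = trans (cong (t i j) (t-first i j c)) (t-second i j c i≢j)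
  ... | second c refl = trans (cong (t i j) (t-second i j c i≢j)) (t-first i j c)
  ... | fixed x≢i x≢j = trans (cong (t i j) (t-fixes i j x x≢i x≢j)) (t-fixes i j x x≢i x≢j)

  t-injective : ∀ {i j} → Incongruent i j → Injective (t i j)
  t-injective {i} {j} i≢j {x} {y} eq =
    trans (sym (t-involutive i≢j x)) (trans (cong (t i j) eq) (t-involutive i≢j y))

  -- χ ∈ {1, -1, 0}; treating it as an integer spares a case analysis on pairs of points in reversed-inversion.
  t-displacement : ∀ {i j} → Incongruent i j → ∀ {f} → Periodic f → ∀ x → ∃ λ χ →
    (t i j x ≡ x ℤ.+ χ ℤ.* (j ℤ.- i)) × (f (t i j x) ≡ f x ℤ.- χ ℤ.* (f i ℤ.- f j))
  t-displacement {i} {j} i≢j {f} pf x with tCase i j x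
  ... | first c refl = + 1
      , trans (t-first i j c) (e₁ i j c)
      , trans (cong f (t-first i j c)) (trans (pf j c) (trans (e₂ (f i) (f j) c) (cong (ℤ._- (+ 1 ℤ.* (f i ℤ.- f j))) (sym (pf i c)))))
    where
    e₁ : ∀ i j c → j ⊹ c ≡ (i ⊹ c) ℤ.+ + 1 ℤ.* (j ℤ.- i)
    e₁ i j c = trans (⊹-def j c) (trans (e i j (c ℤ.* + n)) (cong (ℤ._+ (+ 1 ℤ.* (j ℤ.- i))) (sym (⊹-def i c))))
      where
      e : ∀ i j y → j ℤ.+ y ≡ (i ℤ.+ y) ℤ.+ + 1 ℤ.* (j ℤ.- i)
      e = solve-∀
    e₂ : ∀ a b c → b ⊹ c ≡ (a ⊹ c) ℤ.- + 1 ℤ.* (a ℤ.- b)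
    e₂ a b c = trans (⊹-def b c) (trans (e a b (c ℤ.* + n)) (cong (ℤ._- (+ 1 ℤ.* (a ℤ.- b))) (sym (⊹-def a c))))
      where
      e : ∀ a b y → b ℤ.+ y ≡ (a ℤ.+ y) ℤ.- + 1 ℤ.* (a ℤ.- b)
      e = solve-∀
  ... | second c refl = -[1+ 0 ]
      , trans (t-second i j c i≢j) (e₁ i j c)
      , trans (cong f (t-second i j c i≢j)) (trans (pf i c) (trans (e₂ (f i) (f j) c) (cong (ℤ._- (-[1+ 0 ] ℤ.* (f i ℤ.- f j))) (sym (pf j c)))))
    where
    e₁ : ∀ i j c → i ⊹ c ≡ (j ⊹ c) ℤ.+ -[1+ 0 ] ℤ.* (j ℤ.- i)
    e₁ i j c = trans (⊹-def i c) (trans (e i j (c ℤ.* + n)) (cong (ℤ._+ (-[1+ 0 ] ℤ.* (j ℤ.- i))) (sym (⊹-def j c))))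
      where
      e : ∀ i j y → i ℤ.+ y ≡ (j ℤ.+ y) ℤ.+ -[1+ 0 ] ℤ.* (j ℤ.- i)
      e = solve-∀
    e₂ : ∀ a b c → a ⊹ c ≡ (b ⊹ c) ℤ.- -[1+ 0 ] ℤ.* (a ℤ.- b)
    e₂ a b c = trans (⊹-def a c) (trans (e a b (c ℤ.* + n)) (cong (ℤ._- (-[1+ 0 ] ℤ.* (a ℤ.- b))) (sym (⊹-def b c))))
      where
      e : ∀ a b y → a ℤ.+ y ≡ (b ℤ.+ y) ℤ.- -[1+ 0 ] ℤ.* (a ℤ.- b)
      e = solve-∀
  ... | fixed x≢i x≢j = 0ℤ
      , trans (t-fixes i j x x≢i x≢j) (sym (ℤP.+-identityʳ x))
      , trans (cong f (t-fixes i j x x≢i x≢j)) (sym (ℤP.+-identityʳ (f x)))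

  -- The reflection moves `a` by χ(j - i) and `b` by ψ(j - i). As j - i is positive, reversing the
  -- order of `a` and `b` forces ψ < χ. Undoing the reflection adds χ(f i - f j) to the value at `a`
  -- and ψ(f i - f j) to the value at `b`; since f i - f j is positive too, the inequality between
  -- the values survives.
  reversed-inversion : ∀ {i j} → i ℤ.< j → Incongruent i j → ∀ {f} → Periodic f → f j ℤ.< f i →
    ∀ {a b} → a ℤ.< b → t i j b ℤ.< t i j a → f (t i j b) ℤ.< f (t i j a) → f b ℤ.< f a
  reversed-inversion {i} {j} i<j i≢j {f} pf fj<fi {a} {b} a<b tb<ta ftb<fta
    with t-displacement i≢j {f} pf a | t-displacement i≢j {f} pf b
  ... | χ , ta≡ , fta≡ | ψ , tb≡ , ftb≡ =
    <-by-difference (ℤP.+-mono-<-≤ (subst₂ ℤ._<_ ftb≡ fta≡ ftb<fta) ψε≤χε) (e₂ (f a) (f b) χ ψ ε)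
    where
    δ ε : ℤ
    δ = j ℤ.- i
    ε = f i ℤ.- f j
    0<δ : 0ℤ ℤ.< δ
    0<δ = <-by-difference i<j (sym (ℤP.+-identityʳ δ))
    0<ε : 0ℤ ℤ.< ε
    0<ε = <-by-difference fj<fi (sym (ℤP.+-identityʳ ε))
    e₁ : ∀ a b χ ψ δ → ((a ℤ.+ χ ℤ.* δ) ℤ.+ b) ℤ.- ((b ℤ.+ ψ ℤ.* δ) ℤ.+ a) ≡ χ ℤ.* δ ℤ.- ψ ℤ.* δ
    e₁ = solve-∀
    e₂ : ∀ fa fb χ ψ ε → ((fa ℤ.- χ ℤ.* ε) ℤ.+ (χ ℤ.* ε)) ℤ.- ((fb ℤ.- ψ ℤ.* ε) ℤ.+ (ψ ℤ.* ε)) ≡ fa ℤ.- fb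
    e₂ = solve-∀
    ψδ<χδ : ψ ℤ.* δ ℤ.< χ ℤ.* δ
    ψδ<χδ = <-by-difference (ℤP.+-mono-< (subst₂ ℤ._<_ tb≡ ta≡ tb<ta) a<b) (e₁ a b χ ψ δ)
    ψ<χ : ψ ℤ.< χ
    ψ<χ = ℤP.*-cancelʳ-<-nonNeg δ {{ℤ.nonNegative (ℤP.<⇒≤ 0<δ)}} ψδ<χδ
    ψε≤χε : ψ ℤ.* ε ℤ.≤ χ ℤ.* ε
    ψε≤χε = ℤP.*-monoʳ-≤-nonNeg ε {{ℤ.nonNegative (ℤP.<⇒≤ 0<ε)}} (ℤP.<⇒≤ ψ<χ)

  Within : ℕ → (ℤ → ℤ) → Set
  Within B f = ∀ x → f x ℤ.≤ x ℤ.+ + B × x ℤ.≤ f x ℤ.+ + B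

  bnd-within : ∀ ws → Within (bnd n ws) (ev n ws)
  bnd-within ws x with oneTo-representative x
  ... | i , i∈ , c , refl = upper , lower
    where
    B = bnd n ws
    D = ev n ws i ℤ.- i
    ∣D∣≤B : ℤ.∣ D ∣ ℕ.≤ B
    ∣D∣≤B = ∈⇒≤maxℕ (∈-map⁺ (λ k → ℤ.∣ ev n ws k ℤ.- k ∣) i∈)
    D≤B : D ℤ.≤ + B
    D≤B = ℤP.≤-trans (i≤+∣i∣ D) (ℤ.+≤+ ∣D∣≤B)
      where
      i≤+∣i∣ : ∀ i → i ℤ.≤ + ℤ.∣ i ∣
      i≤+∣i∣ (+ m) = ℤP.≤-refl
      i≤+∣i∣ -[1+ m ] = ℤ.-≤+
    -B≤D : ℤ.- (+ B) ℤ.≤ D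
    -B≤D = ℤP.≤-trans (ℤP.neg-mono-≤ (ℤ.+≤+ ∣D∣≤B)) (-∣i∣≤i D)
      where
      -∣i∣≤i : ∀ i → ℤ.- (+ ℤ.∣ i ∣) ℤ.≤ i
      -∣i∣≤i (+ zero) = ℤP.≤-refl
      -∣i∣≤i (+ suc m) = ℤ.-≤+
      -∣i∣≤i -[1+ m ] = ℤP.≤-refl
    e₁ : ∀ w i B y → B ℤ.- (w ℤ.- i) ≡ ((i ℤ.+ y) ℤ.+ B) ℤ.- (w ℤ.+ y)
    e₁ = solve-∀
    e₂ : ∀ w i B y → (w ℤ.- i) ℤ.- (ℤ.- B) ≡ ((w ℤ.+ y) ℤ.+ B) ℤ.- (i ℤ.+ y)
    e₂ = solve-∀
    y = c ℤ.* + n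
    upper : ev n ws (i ⊹ c) ℤ.≤ (i ⊹ c) ℤ.+ + B
    upper rewrite ev-periodic ws i c | ⊹-def i c | ⊹-def (ev n ws i) c =
      ≤-by-difference D≤B (e₁ (ev n ws i) i (+ B) y)
    lower : i ⊹ c ℤ.≤ ev n ws (i ⊹ c) ℤ.+ + B
    lower rewrite ev-periodic ws i c | ⊹-def i c | ⊹-def (ev n ws i) c =
      ≤-by-difference -B≤D (e₂ (ev n ws i) i (+ B) y)

  -- Chain y - B ≤ f y < f x ≤ x + B. This is why searching offsets up to 2B misses no inversion.
  inversion-short : ∀ {B f} → Within B f → ∀ {x y} → f y ℤ.< f x → y ℤ.< x ℤ.+ + (2 ℕ.* B)
  inversion-short {B} {f} wB {x} {y} fy<fx =
    <-by-difference (ℤP.+-mono-<-≤ fy<fx (ℤP.+-mono-≤ (proj₁ (wB x)) (proj₂ (wB y))))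
      (trans (e (f x) (f y) x y (+ B)) (cong (λ z → x ℤ.+ z ℤ.- y) (cong +_ (cong (B ℕ.+_) (sym (ℕP.+-identityʳ B))))))
    where
    e : ∀ fx fy x y B → (fx ℤ.+ ((x ℤ.+ B) ℤ.+ (fy ℤ.+ B))) ℤ.- (fy ℤ.+ (fx ℤ.+ y)) ≡ x ℤ.+ (B ℤ.+ B) ℤ.- y
    e = solve-∀

  -- `len` collects bare offsets, which may repeat for different `i`. Keeping `i` alongside makes
  -- the entries distinct, as counting by matching requires.
  inversions : (ℤ → ℤ) → ℕ → List (ℤ × ℕ)
  inversions f B = concatMap
    (λ i → map (i ,_) (filter (λ d → f (i ℤ.+ + suc d) ℤ.<? f i) (upTo (2 ℕ.* B))))
    (oneTo n)

  ∈-inversions⁻ : ∀ {f B i d} → (i , d) ∈ inversions f B → i ∈ oneTo n × f (i ℤ.+ + suc d) ℤ.< f i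
  ∈-inversions⁻ {f} {B} p∈ with find (∈-concatMap⁻
      (λ i → map (i ,_) (filter (λ d → f (i ℤ.+ + suc d) ℤ.<? f i) (upTo (2 ℕ.* B)))) {oneTo n} p∈)
  ... | i , i∈ , p∈′ with ∈-map⁻ (i ,_) p∈′
  ... | d , d∈ , refl = i∈ , proj₂ (∈-filter⁻ (λ d → f (i ℤ.+ + suc d) ℤ.<? f i) {xs = upTo (2 ℕ.* B)} d∈)

  ∈-inversions⁺ : ∀ {f B i d} → Within B f → i ∈ oneTo n → f (i ℤ.+ + suc d) ℤ.< f i → (i , d) ∈ inversions f B
  ∈-inversions⁺ {f} {B} {i} {d} wB i∈ lt = ∈-concatMap⁺
    (λ i → map (i ,_) (filter (λ d → f (i ℤ.+ + suc d) ℤ.<? f i) (upTo (2 ℕ.* B)))) (lose i∈ (∈-map⁺ (i ,_)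
    (∈-filter⁺ (λ d → f (i ℤ.+ + suc d) ℤ.<? f i) (∈-upTo⁺ d<) lt)))
    where
    e : ∀ i b d → (i ℤ.+ b) ℤ.- (i ℤ.+ d) ≡ b ℤ.- d
    e = solve-∀
    d< : d ℕ.< 2 ℕ.* B
    d< = ℕP.<⇒≤ (ℤP.drop‿+<+ (<-by-difference (inversion-short {f = f} wB {x = i} {y = i ℤ.+ + suc d} lt)
           (e i (+ (2 ℕ.* B)) (+ suc d))))

  inversions-unique : ∀ f B → Unique (inversions f B)
  inversions-unique f B = concatMap-pairs-unique (λ i → filter (λ d → f (i ℤ.+ + suc d) ℤ.<? f i) (upTo (2 ℕ.* B))) oneTo-unique
    (λ i → UniqueP.filter⁺ (λ d → f (i ℤ.+ + suc d) ℤ.<? f i) (UniqueP.upTo⁺ (2 ℕ.* B)))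

  inversion-representative : ∀ {f B} → Periodic f → Within B f → ∀ {a b} → a ℤ.< b → f b ℤ.< f a →
    ∃ λ p → p ∈ inversions f B × ∃ λ c → a ≡ proj₁ p ⊹ c × b ≡ (proj₁ p ℤ.+ + suc (proj₂ p)) ⊹ c
  inversion-representative {f} {B} pf wB {a} {b} a<b lt with <⇒+suc a<b | oneTo-representative a
  ... | d , refl | i , i∈ , c , refl = (i , d) , ∈-inversions⁺ {f} wB i∈ lt′ , c , refl , b≡
    where
    b≡ : (i ⊹ c) ℤ.+ + suc d ≡ (i ℤ.+ + suc d) ⊹ c
    b≡ = trans (cong (ℤ._+ + suc d) (⊹-def i c)) (trans (e i (c ℤ.* + n) (+ suc d)) (sym (⊹-def (i ℤ.+ + suc d) c)))
      where
      e : ∀ i y d → i ℤ.+ y ℤ.+ d ≡ i ℤ.+ d ℤ.+ y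
      e = solve-∀
    lt′ : f (i ℤ.+ + suc d) ℤ.< f i
    lt′ = ⊹-cancel-< c (subst₂ ℤ._<_ (trans (cong f b≡) (pf (i ℤ.+ + suc d) c)) (pf i c) lt)

  +suc-injective : ∀ {i d d′} → i ℤ.+ + suc d ≡ i ℤ.+ + suc d′ → d ≡ d′
  +suc-injective {i} {d} {d′} eq = ℕP.suc-injective (ℤP.+-injective (+-cancelˡ i (+ suc d) (+ suc d′) eq))

  -- Translating `i` by c′ and `i′` by c gives equal images, hence equal integers. Both start in one
  -- window, so i = i′ and c = c′, and then the second endpoints have the same image.
  shifted-image-injective : ∀ {f} → Periodic f → Injective f → ∀ {i i′ d d′ p q c c′} → i ∈ oneTo n → i′ ∈ oneTo n →
    f i ≡ p ⊹ c → f i′ ≡ p ⊹ c′ → f (i ℤ.+ + suc d) ≡ q ⊹ c → f (i′ ℤ.+ + suc d′) ≡ q ⊹ c′ → (i , d) ≡ (i′ , d′)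
  shifted-image-injective {f} pf inj {i} {i′} {d} {d′} {p} {q} {c} {c′} i∈ i′∈ fi fi′ fj fj′
    with oneTo-⊹-injective {c = c′} {c} i∈ i′∈ (inj (trans (pf i c′) (trans (cong (_⊹ c′) fi)
      (trans (⊹-assoc p c c′) (trans (cong (p ⊹_) (ℤP.+-comm c c′))
      (trans (sym (⊹-assoc p c′ c)) (trans (cong (_⊹ c) (sym fi′)) (sym (pf i′ c)))))))))
  ... | refl , refl = cong (i ,_) (+suc-injective {i} (inj (trans fj (sym fj′))))

  -- An inversion of u ∘ v is either inverted already by `v`, and is matched with itself, or `v`
  -- keeps its order, and its image under `v` is a translate of a listed inversion of `u`.
  inversions-∘-≤ : ∀ {u v h Bu Bv} B → Periodic u → Periodic v → Injective v → Within Bu u → Within Bv v →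
    (∀ x → h x ≡ u (v x)) →
    length (inversions h B) ℕ.≤ length (inversions u Bu) ℕ.+ length (inversions v Bv)
  inversions-∘-≤ {u} {v} {h} {Bu} {Bv} B pu pv inj wu wv h≡ = begin
    length (inversions h B)   ≤⟨ matching-length-≤ R (inversions-unique h B) total R-inj ⟩
    length targets            ≡⟨ trans (LP.length-++ (map inj₁ (inversions u Bu)))
                                  (cong₂ ℕ._+_ (LP.length-map inj₁ (inversions u Bu)) (LP.length-map inj₂ (inversions v Bv))) ⟩
    length (inversions u Bu) ℕ.+ length (inversions v Bv) ∎
    where
    open ℕP.≤-Reasoning
    targets : List ((ℤ × ℕ) ⊎ (ℤ × ℕ))
    targets = map inj₁ (inversions u Bu) ++ map inj₂ (inversions v Bv)
    R : ℤ × ℕ → (ℤ × ℕ) ⊎ (ℤ × ℕ) → Set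
    R (i , d) (inj₁ (i′ , d′)) = ∃ λ c → v i ≡ i′ ⊹ c × v (i ℤ.+ + suc d) ≡ (i′ ℤ.+ + suc d′) ⊹ c
    R p (inj₂ q) = p ≡ q
    total : ∀ {p} → p ∈ inversions h B → ∃ λ t → t ∈ targets × R p t
    total {i , d} p∈ with ∈-inversions⁻ {h} {B} p∈
    ... | i∈ , lt with ℤP.<-cmp (v i) (v (i ℤ.+ + suc d))
    ... | tri< vi<vj _ _ with inversion-representative {u} pu wu vi<vj (subst₂ ℤ._<_ (h≡ (i ℤ.+ + suc d)) (h≡ i) lt)
    ... | p′ , p′∈ , c , eq₁ , eq₂ = inj₁ p′ , ∈-++⁺ˡ (∈-map⁺ inj₁ p′∈) , c , eq₁ , eq₂
    total {i , d} p∈ | i∈ , lt | tri≈ _ vi≡vj _ = ⊥-elim (ℤP.<-irrefl (inj vi≡vj) (a<a+suc i d))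
    total {i , d} p∈ | i∈ , lt | tri> _ _ vi>vj =
      inj₂ (i , d) , ∈-++⁺ʳ (map inj₁ (inversions u Bu)) (∈-map⁺ inj₂ (∈-inversions⁺ {v} wv i∈ vi>vj)) , refl
    R-inj : ∀ {p p′ t} → p ∈ inversions h B → p′ ∈ inversions h B → R p t → R p′ t → p ≡ p′
    R-inj {t = inj₁ _} p∈ p′∈ (c , eq₁ , eq₂) (c′ , eq₁′ , eq₂′) =
      shifted-image-injective {v} pv inj (proj₁ (∈-inversions⁻ {h} {B} p∈)) (proj₁ (∈-inversions⁻ {h} {B} p′∈)) eq₁ eq₁′ eq₂ eq₂′
    R-inj {t = inj₂ _} _ _ refl refl = refl

  -- An inversion of f ∘ t is matched with its image under t if t keeps the order of its two points,
  -- and with itself if t reverses them; `reversed-inversion` makes the latter an inversion of `f`.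
  -- The class of the pair (i, j) is missed: t reverses it, and f ∘ t does not invert it. This gives
  -- strictness.
  inversions-∘t-< : ∀ {f h i j B} B′ → Periodic f → Within B f → i ℤ.< j → Incongruent i j → f j ℤ.< f i →
    (∀ x → h x ≡ f (t i j x)) →
    length (inversions h B′) ℕ.< length (inversions f B)
  inversions-∘t-< {f} {h} {i} {j} {B} B′ pf wB i<j i≢j fj<fi h≡
    with inversion-representative {f} pf wB i<j fj<fi
  ... | y₀ , y₀∈ , c₀ , i≡ , j≡ =
    matching-length-< R (inversions-unique h B′) total R-inj y₀∈ missed
    where
    s : ℤ → ℤ
    s = t i j
    R : ℤ × ℕ → ℤ × ℕ → Set
    R (a , d) (a′ , d′) =
      (s a ℤ.< s (a ℤ.+ + suc d) × ∃ λ c → s a ≡ a′ ⊹ c × s (a ℤ.+ + suc d) ≡ (a′ ℤ.+ + suc d′) ⊹ c)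
      ⊎ (s (a ℤ.+ + suc d) ℤ.< s a × (a , d) ≡ (a′ , d′))
    total : ∀ {p} → p ∈ inversions h B′ → ∃ λ p′ → p′ ∈ inversions f B × R p p′
    total {a , d} p∈ with ∈-inversions⁻ {h} {B′} p∈
    ... | a∈ , lt with subst₂ ℤ._<_ (h≡ (a ℤ.+ + suc d)) (h≡ a) lt
    ... | lt′ with ℤP.<-cmp (s a) (s (a ℤ.+ + suc d))
    ... | tri< ta<tb _ _ with inversion-representative {f} pf wB ta<tb lt′
    ... | p′ , p′∈ , c , eq₁ , eq₂ = p′ , p′∈ , inj₁ (ta<tb , c , eq₁ , eq₂)
    total {a , d} p∈ | a∈ , lt | lt′ | tri≈ _ ta≡tb _ = ⊥-elim (ℤP.<-irrefl (t-injective i≢j ta≡tb) (a<a+suc a d))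
    total {a , d} p∈ | a∈ , lt | lt′ | tri> _ _ ta>tb = (a , d) ,
      ∈-inversions⁺ {f} wB a∈ (reversed-inversion i<j i≢j {f} pf fj<fi (a<a+suc a d) ta>tb lt′) , inj₂ (ta>tb , refl)
    untwist : ∀ {x y c} → s x ≡ y ⊹ c → x ≡ s y ⊹ c
    untwist {x} {y} {c} eq = trans (sym (t-involutive i≢j x)) (trans (cong s eq) (t-periodic i≢j y c))
    -- The two kinds of partner cannot collide: t is an involution, so it keeps the order of a
    -- partner of the first kind but reverses a partner of the second kind.
    mixed : ∀ {a d a′ d′ c} → s a ≡ a′ ⊹ c → s (a ℤ.+ + suc d) ≡ (a′ ℤ.+ + suc d′) ⊹ c →
            s (a′ ℤ.+ + suc d′) ℤ.< s a′ → ⊥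
    mixed {a} {d} {a′} {d′} {c} eq₁ eq₂ lt = ℤP.<-asym lt
      (⊹-cancel-< c (subst₂ ℤ._<_ (untwist eq₁) (untwist eq₂) (a<a+suc a d)))
    R-inj : ∀ {p p′ q} → p ∈ inversions h B′ → p′ ∈ inversions h B′ → R p q → R p′ q → p ≡ p′
    R-inj p∈ p′∈ (inj₁ (_ , c , eq₁ , eq₂)) (inj₁ (_ , c′ , eq₁′ , eq₂′)) =
      shifted-image-injective {s} (t-periodic i≢j) (t-injective i≢j) (proj₁ (∈-inversions⁻ {h} {B′} p∈)) (proj₁ (∈-inversions⁻ {h} {B′} p′∈)) eq₁ eq₁′ eq₂ eq₂′
    R-inj _ _ (inj₁ (_ , c , eq₁ , eq₂)) (inj₂ (lt , refl)) = ⊥-elim (mixed eq₁ eq₂ lt)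
    R-inj _ _ (inj₂ (lt , refl)) (inj₁ (_ , c , eq₁ , eq₂)) = ⊥-elim (mixed eq₁ eq₂ lt)
    R-inj _ _ (inj₂ (_ , refl)) (inj₂ (_ , refl)) = refl
    ti≡j : s i ≡ j
    ti≡j = trans (cong s (sym (⊹-0 i))) (trans (t-first i j 0ℤ) (⊹-0 j))
    tj≡i : s j ≡ i
    tj≡i = trans (cong s (sym (⊹-0 j))) (trans (t-second i j 0ℤ i≢j) (⊹-0 i))
    t-y₀-reversed : s (proj₁ y₀ ℤ.+ + suc (proj₂ y₀)) ℤ.< s (proj₁ y₀)
    t-y₀-reversed = ⊹-cancel-< c₀ (subst₂ ℤ._<_
      (trans (sym tj≡i) (trans (cong s j≡) (t-periodic i≢j _ c₀)))
      (trans (sym ti≡j) (trans (cong s i≡) (t-periodic i≢j _ c₀))) i<j)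
    missed : ∀ {p} → p ∈ inversions h B′ → ¬ R p y₀
    missed p∈ (inj₁ (_ , c , eq₁ , eq₂)) = mixed eq₁ eq₂ t-y₀-reversed
    missed p∈ (inj₂ (_ , refl)) with ∈-inversions⁻ {h} {B′} p∈
    ... | _ , lt = ℤP.<-asym fj<fi (subst₂ ℤ._<_ (at-shift j≡ tj≡i) (at-shift i≡ ti≡j) (⊹-mono-< c₀ lt))
      where
      at-shift : ∀ {x y z} → x ≡ y ⊹ c₀ → s x ≡ z → h y ⊹ c₀ ≡ f z
      ph : Periodic h
      ph x c = trans (h≡ (x ⊹ c)) (trans (cong f (t-periodic i≢j x c)) (trans (pf (s x) c) (cong (_⊹ c) (sym (h≡ x)))))
      at-shift {x} {y} x≡ sx≡z = trans (sym (ph y c₀)) (trans (cong h (sym x≡)) (trans (h≡ x) (cong f sx≡z)))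

  length-inversions : ∀ ws → length (inversions (ev n ws) (bnd n ws)) ≡ len n ws
  length-inversions ws = trans (length-concatMap-map _,_
    (λ i → filter (λ d → ev n ws (i ℤ.+ + suc d) ℤ.<? ev n ws i) (upTo (2 ℕ.* bnd n ws))) (oneTo n))
    (cong length (LP.concatMap-cong (λ i → filter-≐ (λ d → ev n ws (i ℤ.+ + suc d) ℤ.<? ev n ws i) (upTo (2 ℕ.* bnd n ws))) (oneTo n)))
    where
    filter-≐ : ∀ {P : ℕ → Set} (P? : ∀ d → Dec (P d)) xs → filter P? xs ≡ filterᵇ (λ d → ⌊ P? d ⌋) xs
    filter-≐ P? [] = refl
    filter-≐ P? (x ∷ xs) with P? x
    ... | yes _ = cong (x ∷_) (filter-≐ P? xs)
    ... | no _ = filter-≐ P? xs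

  ev-mulT : ∀ w {i j} → Incongruent i j → ∀ x → ev n (mulT n w i j) x ≡ ev n w (t i j x)
  ev-mulT w {i} {j} i≢j x = trans (cong (λ ws → ev n ws x) (LP.map-cong (λ y → cong (ev n w) (sym (t-def i j y))) (oneTo n)))
    (ev-window {ev n w ∘ t i j} (∘-periodic {ev n w} {t i j} (ev-periodic w) (t-periodic i≢j)) x)

  -- Opaque copies, so that the unifier never unfolds windows and lengths.
  opaque
    evₙ : List ℤ → ℤ → ℤ
    evₙ = ev n

    compₙ : List ℤ → List ℤ → List ℤ
    compₙ = comp n

    mulTₙ : List ℤ → ℤ → ℤ → List ℤ
    mulTₙ = mulT n

    ℓ : List ℤ → ℕ
    ℓ = len n

    compₙ-def : ∀ u v → compₙ u v ≡ comp n u v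
    compₙ-def u v = refl

    mulTₙ-def : ∀ w i j → mulTₙ w i j ≡ mulT n w i j
    mulTₙ-def w i j = refl

    ℓ-def : ∀ w → ℓ w ≡ len n w
    ℓ-def w = refl

    evₙ-periodic : ∀ ws → Periodic (evₙ ws)
    evₙ-periodic = ev-periodic

    evₙ-injective : ∀ ws → length ws ≡ n → Unique (map (res n) ws) → Injective (evₙ ws)
    evₙ-injective = ev-injective

    evₙ-suc : ∀ ws {r} → r ℕ.< n → evₙ ws (+ suc r) ≡ lookupD ws r
    evₙ-suc = ev-suc

    evₙ-within : ∀ ws → Within (bnd n ws) (evₙ ws)
    evₙ-within = bnd-within

    map-evₙ-oneTo : ∀ ws → length ws ≡ n → map (evₙ ws) (oneTo n) ≡ ws
    map-evₙ-oneTo = map-ev-oneTo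

    evₙ-comp : ∀ u v x → evₙ (compₙ u v) x ≡ evₙ u (evₙ v x)
    evₙ-comp = ev-comp

    evₙ-mulT : ∀ w {i j} → Incongruent i j → ∀ x → evₙ (mulTₙ w i j) x ≡ evₙ w (t i j x)
    evₙ-mulT = ev-mulT

    compₙ-map : ∀ u v → compₙ u v ≡ map (λ x → evₙ u (evₙ v x)) (oneTo n)
    compₙ-map u v = refl

    mulTₙ-map : ∀ w i j → mulTₙ w i j ≡ map (λ x → evₙ w (t i j x)) (oneTo n)
    mulTₙ-map w i j = LP.map-cong (λ x → cong (ev n w) (sym (t-def i j x))) (oneTo n)

    ℓ-comp-≤ : ∀ u v → Injective (evₙ v) → ℓ (compₙ u v) ℕ.≤ ℓ u ℕ.+ ℓ v
    ℓ-comp-≤ u v inj = subst₂ ℕ._≤_ (length-inversions (comp n u v)) (cong₂ ℕ._+_ (length-inversions u) (length-inversions v))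
      (inversions-∘-≤ {ev n u} {ev n v} {ev n (comp n u v)} (bnd n (comp n u v)) (ev-periodic u) (ev-periodic v) inj
        (bnd-within u) (bnd-within v) (ev-comp u v))

    ℓ-mulT-< : ∀ w {i j} → i ℤ.< j → Incongruent i j → evₙ w j ℤ.< evₙ w i → ℓ (mulTₙ w i j) ℕ.< ℓ w
    ℓ-mulT-< w {i} {j} i<j i≢j wj<wi = subst₂ ℕ._<_ (length-inversions (mulT n w i j)) (length-inversions w)
      (inversions-∘t-< {ev n w} {ev n (mulT n w i j)} (bnd n (mulT n w i j)) (ev-periodic w) (bnd-within w) i<j i≢j wj<wi (ev-mulT w i≢j))

-- The right action on the nilCoxeter algebra

module Action (k : ℕ) where
  open Affine k
  open Length k

  -- The properties of an element of S_n used from here on, chosen so that the inverse has them as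
  -- well. `nonpositive` and `positive` keep letters letters; `within` yields the margin of the
  -- truncation.
  record FiniteSymmetry (σ : ℤ → ℤ) : Set where
    field
      periodic    : Periodic σ
      injective   : Injective σ
      surjective  : ∀ y → ∃ λ x → σ x ≡ y
      nonpositive : ∀ {x} → x ℤ.≤ 0ℤ → σ x ℤ.≤ 0ℤ
      positive    : ∀ {x} → 0ℤ ℤ.< x → 0ℤ ℤ.< σ x
      within      : Within n σ

  -- The translates of the window by negative numbers of periods fill exactly the integers up to 0.
  -- Permuting each translate within itself therefore respects the two sides of the cut.
  ⊹-nonpositive : ∀ {r c} → r ℕ.< n → c ℤ.< 0ℤ → (+ suc r) ⊹ c ℤ.≤ 0ℤ
  ⊹-nonpositive {r} {c} r<n c<0 = subst (ℤ._≤ 0ℤ) (sym (⊹-+ (+ 1) (+ r) c))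
    (ℤP.i<j⇒suc[i]≤j (subst ((+ r) ⊹ c ℤ.<_) (⊹-0 0ℤ) (lower-quotient-< {r′ = 0} r<n c<0)))

  ⊹-positive : ∀ {r c} → ¬ c ℤ.< 0ℤ → 0ℤ ℤ.< (+ suc r) ⊹ c
  ⊹-positive {r} {c} c≮0 = subst (0ℤ ℤ.<_) (sym (⊹-+ (+ 1) (+ r) c))
    (ℤP.≤-<-trans 0≤r⊹c (ℤP.suc[i]≤j⇒i<j ℤP.≤-refl))
    where
    0≤r⊹c : 0ℤ ℤ.≤ (+ r) ⊹ c
    0≤r⊹c with ℤP.<-cmp 0ℤ c
    ... | tri< 0<c _ _ = ℤP.<⇒≤ (subst (ℤ._< (+ r) ⊹ c) (⊹-0 0ℤ) (lower-quotient-< {r = 0} (s≤s z≤n) 0<c))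
    ... | tri≈ _ refl _ = subst (0ℤ ℤ.≤_) (sym (⊹-0 (+ r))) (ℤ.+≤+ z≤n)
    ... | tri> _ _ c<0 = ⊥-elim (c≮0 c<0)

  ⊹-nonpositive⁻ : ∀ {r c} → (+ suc r) ⊹ c ℤ.≤ 0ℤ → c ℤ.< 0ℤ
  ⊹-nonpositive⁻ {r} {c} le with c ℤ.<? 0ℤ
  ... | yes c<0 = c<0
  ... | no c≮0 = ⊥-elim (ℤP.<⇒≱ (⊹-positive {r} c≮0) le)

  module _ (w′ : List ℤ) (w′↭ : IsFinPerm n w′) where

    private
      σ : ℤ → ℤ
      σ = evₙ w′

      len′ : length w′ ≡ n
      len′ = trans (PermP.↭-length w′↭) length-oneTo

      image : ∀ {r} → r ℕ.< n → ∃ λ s → s ℕ.< n × σ (+ suc r) ≡ + suc s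
      image {r} r<n with ∈-oneTo⁻ (PermP.∈-resp-↭ w′↭ (lookupD-∈ w′ (subst (r ℕ.<_) (sym len′) r<n)))
      ... | s , s<n , eq = s , s<n , trans (evₙ-suc w′ r<n) eq

      image-⊹ : ∀ {r} c → r ℕ.< n → ∃ λ s → s ℕ.< n × σ ((+ suc r) ⊹ c) ≡ (+ suc s) ⊹ c
      image-⊹ {r} c r<n with image r<n
      ... | s , s<n , eq = s , s<n , trans (evₙ-periodic w′ (+ suc r) c) (cong (_⊹ c) eq)

      residues-unique : Unique (map (res n) w′)
      residues-unique = Unique-resp-↭ (PermP.map⁺ (res n) (↭-sym w′↭)) (go (oneTo n) oneTo-unique (λ x∈ → x∈))
        where
        go : ∀ xs → Unique xs → (∀ {x} → x ∈ xs → x ∈ oneTo n) → Unique (map (res n) xs)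
        go [] _ _ = []
        go (x ∷ xs) (px ∷ u) sub = AllP.map⁺ (All.tabulate λ {y} y∈ eq → All.lookup px y∈ (same (sub (here refl)) (sub (there y∈)) eq))
                                 ∷ go xs u (sub ∘ there)
          where
          same : ∀ {x y} → x ∈ oneTo n → y ∈ oneTo n → res n x ≡ res n y → x ≡ y
          same x∈ y∈ eq with res-≡⇒⊹ eq
          ... | c , x≡ = proj₁ (oneTo-⊹-injective {c = 0ℤ} x∈ y∈ (trans (⊹-0 _) x≡))

    finiteSymmetry : FiniteSymmetry σ
    finiteSymmetry = record
      { periodic = evₙ-periodic w′
      ; injective = evₙ-injective w′ len′ residues-unique
      ; surjective = surj
      ; nonpositive = nonpos
      ; positive = pos
      ; within = near
      }
      where
      surj : ∀ y → ∃ λ x → σ x ≡ y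
      surj y with oneTo-representative y
      ... | i , i∈ , c , refl with ∈-lookupD (PermP.∈-resp-↭ (↭-sym w′↭) i∈)
      ... | r , r< , eq = (+ suc r) ⊹ c , trans (evₙ-periodic w′ (+ suc r) c)
            (cong (_⊹ c) (trans (evₙ-suc w′ (subst (r ℕ.<_) len′ r<)) eq))
      nonpos : ∀ {x} → x ℤ.≤ 0ℤ → σ x ℤ.≤ 0ℤ
      nonpos {x} x≤0 with oneTo-representative x
      ... | i , i∈ , c , refl with ∈-oneTo⁻ i∈
      ... | r , r<n , refl with image-⊹ c r<n
      ... | s , s<n , eq = subst (ℤ._≤ 0ℤ) (sym eq) (⊹-nonpositive s<n (⊹-nonpositive⁻ {r} x≤0))
      pos : ∀ {x} → 0ℤ ℤ.< x → 0ℤ ℤ.< σ x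
      pos {x} 0<x with oneTo-representative x
      ... | i , i∈ , c , refl with ∈-oneTo⁻ i∈
      ... | r , r<n , refl with image-⊹ c r<n
      ... | s , s<n , eq = subst (0ℤ ℤ.<_) (sym eq) (⊹-positive {s} λ c<0 → ℤP.<⇒≱ 0<x (⊹-nonpositive r<n c<0))
      close : ∀ {r s} c → r ℕ.< n → (+ suc r) ⊹ c ℤ.≤ ((+ suc s) ⊹ c) ℤ.+ + n
      close {r} {s} c r<n = ≤-by-difference
        {+ suc r} {+ suc s ℤ.+ + n} (ℤ.+≤+ (ℕP.≤-trans r<n (ℕP.m≤n+m n (suc s))))
        (trans (e (+ suc r) (+ suc s) (c ℤ.* + n) (+ n)) (sym (cong₂ (λ x y → x ℤ.+ + n ℤ.- y) (⊹-def (+ suc s) c) (⊹-def (+ suc r) c))))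
        where
        e : ∀ r s y n → (s ℤ.+ n) ℤ.- r ≡ ((s ℤ.+ y) ℤ.+ n) ℤ.- (r ℤ.+ y)
        e = solve-∀
      near : Within n σ
      near x with oneTo-representative x
      ... | i , i∈ , c , refl with ∈-oneTo⁻ i∈
      ... | r , r<n , refl with image-⊹ c r<n
      ... | s , s<n , eq = subst (ℤ._≤ ((+ suc r) ⊹ c) ℤ.+ + n) (sym eq) (close c s<n)
                         , subst (λ z → (+ suc r) ⊹ c ℤ.≤ z ℤ.+ + n) (sym eq) (close c r<n)

  res-reflect : ∀ {σ} → Periodic σ → Injective σ → ∀ {x y} → res n (σ x) ≡ res n (σ y) → res n x ≡ res n y
  res-reflect {σ} p inj {x} {y} eq with res-≡⇒⊹ eq
  ... | c , σx≡ = ⊹⇒res-≡ {x} {y} {c} (inj (trans σx≡ (sym (p y c))))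

  incongruent-image : ∀ {σ} → Periodic σ → Injective σ → ∀ {i j} → Incongruent i j → Incongruent (σ i) (σ j)
  incongruent-image {σ} p inj i≢j = incongruent λ eq → res-≢ i≢j (res-reflect {σ} p inj eq)

  t-conjugate : ∀ {σ} → Periodic σ → Injective σ → ∀ {i j} → Incongruent i j → ∀ x → σ (t i j x) ≡ t (σ i) (σ j) (σ x)
  t-conjugate {σ} p inj {i} {j} i≢j x with tCase i j x
  ... | first c refl = trans (cong σ (t-first i j c)) (trans (p j c)
        (sym (trans (cong (t (σ i) (σ j)) (p i c)) (t-first (σ i) (σ j) c))))
  ... | second c refl = trans (cong σ (t-second i j c i≢j)) (trans (p i c)
        (sym (trans (cong (t (σ i) (σ j)) (p j c)) (t-second (σ i) (σ j) c (incongruent-image {σ} p inj i≢j)))))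
  ... | fixed x≢i x≢j = trans (cong σ (t-fixes i j x x≢i x≢j))
        (sym (t-fixes (σ i) (σ j) (σ x) (x≢i ∘ res-reflect {σ} p inj) (x≢j ∘ res-reflect {σ} p inj)))

  -- Disjointness modulo n, the condition under which two reflections commute; disjointness of
  -- integer supports alone does not give it.
  record Apart (a b : Box) : Set where
    constructor apart
    field
      ₁₁ : res n (proj₁ a) ≢ res n (proj₁ b)
      ₁₂ : res n (proj₁ a) ≢ res n (proj₂ b)
      ₂₁ : res n (proj₂ a) ≢ res n (proj₁ b)
      ₂₂ : res n (proj₂ a) ≢ res n (proj₂ b)

  apart-sym : ∀ {a b} → Apart a b → Apart b a
  apart-sym (apart p q r s) = apart (p ∘ sym) (r ∘ sym) (q ∘ sym) (s ∘ sym)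

  t-fixes-⊹ : ∀ i j x c → res n i ≢ res n x → res n j ≢ res n x → t i j (x ⊹ c) ≡ x ⊹ c
  t-fixes-⊹ i j x c i≢x j≢x = t-fixes i j (x ⊹ c)
    (λ eq → i≢x (trans (sym eq) (res-⊹ x c))) (λ eq → j≢x (trans (sym eq) (res-⊹ x c)))

  t-comm : ∀ {i j p q} → Apart (i , j) (p , q) → Incongruent i j → Incongruent p q → ∀ x → t i j (t p q x) ≡ t p q (t i j x)
  t-comm {i} {j} {p} {q} (apart ip iq jp jq) i≢j p≢q x with tCase p q x
  ... | first c refl = trans (cong (t i j) (t-first p q c)) (trans (t-fixes-⊹ i j q c iq jq)
        (sym (trans (cong (t p q) (t-fixes-⊹ i j p c ip jp)) (t-first p q c))))
  ... | second c refl = trans (cong (t i j) (t-second p q c p≢q)) (trans (t-fixes-⊹ i j p c ip jp)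
        (sym (trans (cong (t p q) (t-fixes-⊹ i j q c iq jq)) (t-second p q c p≢q))))
  ... | fixed x≢p x≢q = trans (cong (t i j) (t-fixes p q x x≢p x≢q)) (sym fixes-tx)
    where
    fixes-tx : t p q (t i j x) ≡ t i j x
    fixes-tx with tCase i j x
    ... | first c refl = trans (cong (t p q) (t-first i j c))
          (trans (t-fixes-⊹ p q j c (jp ∘ sym) (jq ∘ sym)) (sym (t-first i j c)))
    ... | second c refl = trans (cong (t p q) (t-second i j c i≢j))
          (trans (t-fixes-⊹ p q i c (ip ∘ sym) (iq ∘ sym)) (sym (t-second i j c i≢j)))
    ... | fixed x≢i x≢j = trans (cong (t p q) (t-fixes i j x x≢i x≢j)) (trans (t-fixes p q x x≢p x≢q) (sym (t-fixes i j x x≢i x≢j)))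

  -- The length allows the window to be rebuilt from its values, which makes multiplication by a
  -- reflection an involution on windows.
  record Valid (w : List ℤ) : Set where
    field
      length≡n  : length w ≡ n
      injective : Injective (evₙ w)

  mulT-valid : ∀ {w i j} → Incongruent i j → Valid w → Valid (mulTₙ w i j)
  mulT-valid {w} {i} {j} i≢j v = record
    { length≡n = trans (cong length (mulTₙ-map w i j)) (trans (LP.length-map _ (oneTo n)) length-oneTo)
    ; injective = λ {x} {y} eq → t-injective i≢j (Valid.injective v
        (trans (sym (evₙ-mulT w i≢j x)) (trans eq (evₙ-mulT w i≢j y))))
    }

  comp-valid : ∀ {u v} → Valid u → Injective (evₙ v) → Valid (compₙ u v)
  comp-valid {u} {v} vu inj = record
    { length≡n = trans (cong length (compₙ-map u v)) (trans (LP.length-map _ (oneTo n)) length-oneTo)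
    ; injective = λ {x} {y} eq → inj (Valid.injective vu (trans (sym (evₙ-comp u v x)) (trans eq (evₙ-comp u v y))))
    }

  mulT-mulT : ∀ w {i j} p q → Incongruent i j →
    mulTₙ (mulTₙ w i j) p q ≡ map (λ x → evₙ w (t i j (t p q x))) (oneTo n)
  mulT-mulT w {i} {j} p q i≢j = trans (mulTₙ-map (mulTₙ w i j) p q)
    (LP.map-cong (λ x → evₙ-mulT w i≢j (t p q x)) (oneTo n))

  mulT-involutive : ∀ {w i j} → Incongruent i j → length w ≡ n → mulTₙ (mulTₙ w i j) i j ≡ w
  mulT-involutive {w} {i} {j} i≢j len≡n = trans (mulT-mulT w i j i≢j)
    (trans (LP.map-cong (λ x → cong (evₙ w) (t-involutive i≢j x)) (oneTo n)) (map-evₙ-oneTo w len≡n))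

  mulT-comm : ∀ w {i j p q} → Apart (i , j) (p , q) → Incongruent i j → Incongruent p q →
    mulTₙ (mulTₙ w i j) p q ≡ mulTₙ (mulTₙ w p q) i j
  mulT-comm w {i} {j} {p} {q} ap i≢j p≢q = trans (mulT-mulT w p q i≢j)
    (trans (LP.map-cong (λ x → cong (evₙ w) (t-comm ap i≢j p≢q x)) (oneTo n)) (sym (mulT-mulT w i j p≢q)))

  mulT-comp : ∀ w w′ {i j} → Injective (evₙ w′) → Incongruent i j →
    mulTₙ (compₙ w w′) i j ≡ compₙ (mulTₙ w (evₙ w′ i) (evₙ w′ j)) w′
  mulT-comp w w′ {i} {j} inj i≢j = trans (mulTₙ-map (compₙ w w′) i j)
    (trans (LP.map-cong pointwise (oneTo n)) (sym (compₙ-map (mulTₙ w (evₙ w′ i) (evₙ w′ j)) w′)))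
    where
    σ = evₙ w′
    σi≢σj : Incongruent (σ i) (σ j)
    σi≢σj = incongruent-image {σ} (evₙ-periodic w′) inj i≢j
    pointwise : ∀ x → evₙ (compₙ w w′) (t i j x) ≡ evₙ (mulTₙ w (σ i) (σ j)) (σ x)
    pointwise x = trans (evₙ-comp w w′ (t i j x)) (trans (cong (evₙ w) (t-conjugate {σ} (evₙ-periodic w′) inj i≢j x))
      (sym (evₙ-mulT w σi≢σj (σ x))))

  Covers : List ℤ → ℤ → ℤ → Set
  Covers w i j = ℓ (mulTₙ w i j) ℕ.+ 1 ≡ ℓ w

  Factors : List ℤ → List ℤ → Set
  Factors u v = ℓ (compₙ u v) ≡ ℓ u ℕ.+ ℓ v

  -- If w(i) < w(j), the product with the reflection has an inversion at (i, j). Reflecting once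
  -- more shortens it back to `w`, so the first reflection lengthened `w`, against `Covers`.
  covers⇒inversion : ∀ {w i j} → Valid w → i ℤ.< j → Incongruent i j → Covers w i j → evₙ w j ℤ.< evₙ w i
  covers⇒inversion {w} {i} {j} v i<j i≢j cov with ℤP.<-cmp (evₙ w i) (evₙ w j)
  ... | tri> _ _ gt = gt
  ... | tri≈ _ eq _ = ⊥-elim (ℤP.<-irrefl (Valid.injective v eq) i<j)
  ... | tri< lt _ _ = ⊥-elim (ℕP.<-asym len-increases len-decreases)
    where
    t-swaps-i : t i j i ≡ j
    t-swaps-i = trans (cong (t i j) (sym (⊹-0 i))) (trans (t-first i j 0ℤ) (⊹-0 j))
    t-swaps-j : t i j j ≡ i
    t-swaps-j = trans (cong (t i j) (sym (⊹-0 j))) (trans (t-second i j 0ℤ i≢j) (⊹-0 i))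
    lt′ : evₙ (mulTₙ w i j) j ℤ.< evₙ (mulTₙ w i j) i
    lt′ = subst₂ ℤ._<_ (sym (trans (evₙ-mulT w i≢j j) (cong (evₙ w) t-swaps-j)))
                       (sym (trans (evₙ-mulT w i≢j i) (cong (evₙ w) t-swaps-i))) lt
    len-increases : ℓ w ℕ.< ℓ (mulTₙ w i j)
    len-increases = subst (λ z → ℓ z ℕ.< ℓ (mulTₙ w i j)) (mulT-involutive i≢j (Valid.length≡n v))
      (ℓ-mulT-< (mulTₙ w i j) i<j i≢j lt′)
    len-decreases : ℓ (mulTₙ w i j) ℕ.< ℓ w
    len-decreases = subst (ℓ (mulTₙ w i j) ℕ.<_) cov (ℕP.m<m+n _ (s≤s z≤n))

  record Letter (b : Box) : Set where
    constructor letter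
    field
      row≤0 : proj₁ b ℤ.≤ 0ℤ
      col>0 : 0ℤ ℤ.< proj₂ b
      i≢j   : Incongruent (proj₁ b) (proj₂ b)
    row<col : proj₁ b ℤ.< proj₂ b
    row<col = ℤP.≤-<-trans row≤0 col>0
  open Letter

  move : (ℤ → ℤ) → Box → Box
  move σ (i , j) = σ i , σ j

  module _ {w w′ : List ℤ} (vw : Valid w) (fs : FiniteSymmetry (evₙ w′)) {b : Box} (lb : Letter b) where
    private
      σ = evₙ w′
      i = proj₁ b
      j = proj₂ b
      module S = FiniteSymmetry fs
      σi<σj : σ i ℤ.< σ j
      σi<σj = ℤP.≤-<-trans (S.nonpositive (row≤0 lb)) (S.positive (col>0 lb))
      σi≢σj : Incongruent (σ i) (σ j)
      σi≢σj = incongruent-image {σ} S.periodic S.injective (i≢j lb)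
      wt = mulTₙ w (σ i) (σ j)
      same-window : mulTₙ (compₙ w w′) i j ≡ compₙ wt w′
      same-window = mulT-comp w w′ S.injective (i≢j lb)

    -- Both sides force w(σ i) > w(σ j); subadditivity of the length then leaves no slack.
    covers-after : Factors w w′ → Covers (compₙ w w′) i j → Covers w (σ i) (σ j) × Factors wt w′
    covers-after fac cov = cov′ , fac′
      where
      inv : evₙ w (σ j) ℤ.< evₙ w (σ i)
      inv = subst₂ ℤ._<_ (evₙ-comp w w′ j) (evₙ-comp w w′ i)
        (covers⇒inversion (comp-valid vw S.injective) (row<col lb) (i≢j lb) cov)
      shorter : ℓ wt ℕ.< ℓ w
      shorter = ℓ-mulT-< w σi<σj σi≢σj inv
      total : ℓ (compₙ wt w′) ℕ.+ 1 ≡ ℓ w ℕ.+ ℓ w′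
      total = trans (cong (λ z → ℓ z ℕ.+ 1) (sym same-window)) (trans cov fac)
      arith : ∀ {a b c d} → a ℕ.+ 1 ≡ b ℕ.+ c → a ℕ.≤ d ℕ.+ c → d ℕ.< b → d ℕ.+ 1 ≡ b
      arith {a} {b} {c} {d} eq a≤ d<b = ℕP.≤-antisym (subst (ℕ._≤ b) (ℕP.+-comm 1 d) d<b)
        (ℕP.+-cancelʳ-≤ c b (d ℕ.+ 1) (subst₂ ℕ._≤_ eq e (ℕP.+-monoˡ-≤ 1 a≤)))
        where
        e : d ℕ.+ c ℕ.+ 1 ≡ d ℕ.+ 1 ℕ.+ c
        e = trans (ℕP.+-assoc d c 1) (trans (cong (d ℕ.+_) (ℕP.+-comm c 1)) (sym (ℕP.+-assoc d 1 c)))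
      cov′ : Covers w (σ i) (σ j)
      cov′ = arith {ℓ (compₙ wt w′)} total (ℓ-comp-≤ wt w′ S.injective) shorter
      fac′ : Factors wt w′
      fac′ = ℕP.+-cancelʳ-≡ 1 _ _ (trans total (trans (cong (ℕ._+ ℓ w′) (sym cov′))
        (trans (ℕP.+-assoc (ℓ wt) 1 _) (trans (cong (ℓ wt ℕ.+_) (ℕP.+-comm 1 (ℓ w′))) (sym (ℕP.+-assoc (ℓ wt) _ 1))))))

    -- Here the length of w w′ t is known to be one below ℓ(w) + ℓ(w′). The length of w w′ is
    -- strictly larger than it and at most that sum, so both conditions hold with equality.
    covers-before : Covers w (σ i) (σ j) → Factors wt w′ → Factors w w′ × Covers (compₙ w w′) i j
    covers-before cov fac = fac′ , cov′
      where
      inv : evₙ (compₙ w w′) j ℤ.< evₙ (compₙ w w′) i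
      inv = subst₂ ℤ._<_ (sym (evₙ-comp w w′ j)) (sym (evₙ-comp w w′ i)) (covers⇒inversion vw σi<σj σi≢σj cov)
      total : ℓ (mulTₙ (compₙ w w′) i j) ℕ.+ 1 ≡ ℓ w ℕ.+ ℓ w′
      total = trans (cong (λ z → ℓ z ℕ.+ 1) same-window) (trans (cong (ℕ._+ 1) fac)
        (trans (ℕP.+-assoc (ℓ wt) _ 1) (trans (cong (ℓ wt ℕ.+_) (ℕP.+-comm (ℓ w′) 1))
        (trans (sym (ℕP.+-assoc (ℓ wt) 1 _)) (cong (ℕ._+ ℓ w′) cov)))))
      shorter : ℓ (mulTₙ (compₙ w w′) i j) ℕ.+ 1 ℕ.≤ ℓ (compₙ w w′)
      shorter = subst (ℕ._≤ ℓ (compₙ w w′)) (ℕP.+-comm 1 _) (ℓ-mulT-< (compₙ w w′) (row<col lb) (i≢j lb) inv)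
      fac′ : Factors w w′
      fac′ = ℕP.≤-antisym (ℓ-comp-≤ w w′ S.injective) (subst (ℕ._≤ ℓ (compₙ w w′)) total shorter)
      cov′ : Covers (compₙ w w′) i j
      cov′ = trans total (sym fac′)

  opaque
    actₙ : Box → Alg → Alg
    actₙ = actSym n

    mulₙ : List ℤ → Alg → Alg
    mulₙ w′ x = mulA n x (A w′)

    actₙ-def : ∀ b x → actₙ b x ≡ actSym n b x
    actₙ-def b x = refl

    mulₙ-def : ∀ w′ x → mulₙ w′ x ≡ mulA n x (A w′)
    mulₙ-def w′ x = refl

    actₙ-[] : ∀ b → actₙ b [] ≡ []
    actₙ-[] b = refl

    mulₙ-[] : ∀ w′ → mulₙ w′ [] ≡ []
    mulₙ-[] w′ = refl

    factors-test : ∀ w w′ → (len n (comp n w w′) ==ℕ (len n w ℕ.+ len n w′)) ≡ (ℓ (compₙ w w′) ==ℕ (ℓ w ℕ.+ ℓ w′))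
    factors-test w w′ = cong₂ _==ℕ_ (trans (sym (ℓ-def (comp n w w′))) (cong ℓ (sym (compₙ-def w w′))))
      (cong₂ ℕ._+_ (sym (ℓ-def w)) (sym (ℓ-def w′)))

    covers-test : ∀ w i j → ((len n (mulT n w i j) ℕ.+ 1) ==ℕ len n w) ≡ ((ℓ (mulTₙ w i j) ℕ.+ 1) ==ℕ ℓ w)
    covers-test w i j = cong₂ _==ℕ_
      (cong (ℕ._+ 1) (trans (sym (ℓ-def (mulT n w i j))) (cong ℓ (sym (mulTₙ-def w i j))))) (sym (ℓ-def w))

    mulA-factors : ∀ {c w w′} → Factors w w′ → mulₙ w′ ((c , w) ∷ []) ≡ (c ℚ.* 1ℚ , compₙ w w′) ∷ []
    mulA-factors {c} {w} {w′} fac =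
      cong₂ (λ b u → ((if b then (c ℚ.* 1ℚ , u) ∷ [] else []) ++ []) ++ [])
        (trans (factors-test w w′) (==ℕ-true fac)) (sym (compₙ-def w w′))

    mulA-¬factors : ∀ {c w w′} → ¬ Factors w w′ → mulₙ w′ ((c , w) ∷ []) ≡ []
    mulA-¬factors {c} {w} {w′} ¬fac =
      cong (λ b → ((if b then (c ℚ.* 1ℚ , comp n w w′) ∷ [] else []) ++ []) ++ []) (trans (factors-test w w′) (==ℕ-false ¬fac))

    actSym-covers : ∀ {c w i j} → Covers w i j → actₙ (i , j) ((c , w) ∷ []) ≡ (c , mulTₙ w i j) ∷ []
    actSym-covers {c} {w} {i} {j} cov =
      cong₂ (λ b u → (if b then (c , u) ∷ [] else []) ++ []) (trans (covers-test w i j) (==ℕ-true cov)) (sym (mulTₙ-def w i j))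

    actSym-¬covers : ∀ {c w i j} → ¬ Covers w i j → actₙ (i , j) ((c , w) ∷ []) ≡ []
    actSym-¬covers {c} {w} {i} {j} ¬cov =
      cong (λ b → (if b then (c , mulT n w i j) ∷ [] else []) ++ []) (trans (covers-test w i j) (==ℕ-false ¬cov))

  covers? : ∀ w i j → Dec (Covers w i j)
  covers? w i j = ℓ (mulTₙ w i j) ℕ.+ 1 ℕ.≟ ℓ w

  factors? : ∀ u v → Dec (Factors u v)
  factors? u v = ℓ (compₙ u v) ℕ.≟ ℓ u ℕ.+ ℓ v

  -- A word sends a basis element to zero or to a single term. On such elements a case distinction
  -- on the length tests proves the identities below as equalities of lists.
  data Monomial : Alg → Set where
    none : Monomial []
    one  : ∀ {c w} → Valid w → Monomial ((c , w) ∷ [])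

  actSym-monomial : ∀ {b x} → Letter b → Monomial x → Monomial (actₙ b x)
  actSym-monomial {b} lb none = subst Monomial (sym (actₙ-[] b)) none
  actSym-monomial {i , j} lb (one {c} {w} v) with covers? w i j
  ... | yes cov = subst Monomial (sym (actSym-covers cov)) (one (mulT-valid (i≢j lb) v))
  ... | no ¬cov = subst Monomial (sym (actSym-¬covers ¬cov)) none

  mulA-actSym-vanishes : ∀ {c w w′ i j} → ¬ (Covers w i j × Factors (mulTₙ w i j) w′) → mulₙ w′ (actₙ (i , j) ((c , w) ∷ [])) ≡ []
  mulA-actSym-vanishes {c} {w} {w′} {i} {j} ¬both with covers? w i j
  ... | no ¬cov = trans (cong (mulₙ w′) (actSym-¬covers ¬cov)) (mulₙ-[] w′)
  ... | yes cov = trans (cong (mulₙ w′) (actSym-covers cov)) (mulA-¬factors λ fac → ¬both (cov , fac))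

  -- Each side is subject to two length tests. `covers-after` and `covers-before` show that the two
  -- pairs of tests succeed together; when they fail, both sides are empty.
  actSym-mulA : ∀ {w′ b x} → FiniteSymmetry (evₙ w′) → Letter b → Monomial x →
    actₙ b (mulₙ w′ x) ≡ mulₙ w′ (actₙ (move (evₙ w′) b) x)
  actSym-mulA {w′} {b} fs lb none = trans (cong (actₙ b) (mulₙ-[] w′)) (trans (actₙ-[] b)
    (sym (trans (cong (mulₙ w′) (actₙ-[] (move (evₙ w′) b))) (mulₙ-[] w′))))
  actSym-mulA {w′} {i , j} fs lb (one {c} {w} v) with factors? w w′ | covers? (compₙ w w′) i j
  ... | yes fac | yes cov = trans (cong (actₙ (i , j)) (mulA-factors fac)) (trans (actSym-covers cov)
        (trans (cong (λ z → (c ℚ.* 1ℚ , z) ∷ []) (mulT-comp w w′ (FiniteSymmetry.injective fs) (i≢j lb)))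
        (sym (trans (cong (mulₙ w′) (actSym-covers (proj₁ after))) (mulA-factors (proj₂ after))))))
    where after = covers-after v fs lb fac cov
  ... | yes fac | no ¬cov = trans (cong (actₙ (i , j)) (mulA-factors fac)) (trans (actSym-¬covers ¬cov)
        (sym (mulA-actSym-vanishes λ (cov′ , fac′) → ¬cov (proj₂ (covers-before v fs lb cov′ fac′)))))
  ... | no ¬fac | _ = trans (cong (actₙ (i , j)) (mulA-¬factors ¬fac)) (trans (actₙ-[] (i , j))
        (sym (mulA-actSym-vanishes λ (cov′ , fac′) → ¬fac (proj₁ (covers-before v fs lb cov′ fac′)))))

  move-letter : ∀ {σ b} → FiniteSymmetry σ → Letter b → Letter (move σ b)
  move-letter {σ} fs (letter i≤0 j>0 i≢j) = letter (S.nonpositive i≤0) (S.positive j>0) (incongruent-image {σ} S.periodic S.injective i≢j)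
    where module S = FiniteSymmetry fs

  actWordₙ : List Box → Alg → Alg
  actWordₙ [] x = x
  actWordₙ (b ∷ L) x = actWordₙ L (actₙ b x)

  actWordₙ-def : ∀ L x → actWordₙ L x ≡ actWord n L x
  actWordₙ-def [] x = refl
  actWordₙ-def (b ∷ L) x = trans (actWordₙ-def L (actₙ b x)) (cong (actWord n L) (actₙ-def b x))

  actWord-mulA : ∀ {w′ x} L → FiniteSymmetry (evₙ w′) → All Letter L → Monomial x →
    actWordₙ L (mulₙ w′ x) ≡ mulₙ w′ (actWordₙ (map (move (evₙ w′)) L) x)
  actWord-mulA [] fs _ _ = refl
  actWord-mulA {w′} (b ∷ L) fs (lb ∷ lL) mx = trans (cong (actWordₙ L) (actSym-mulA fs lb mx))
    (actWord-mulA {w′} L fs lL (actSym-monomial (move-letter {evₙ w′} fs lb) mx))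

  -- Each reflection fixes the two points of the other letter, so both inversions persist when the
  -- order is exchanged. The total drop is two, and two strict decreases leave exactly one for each.
  covers-comm : ∀ {w i j p q} → Valid w → Letter (i , j) → Letter (p , q) → Apart (i , j) (p , q) →
    Covers w i j → Covers (mulTₙ w i j) p q → Covers w p q × Covers (mulTₙ w p q) i j
  covers-comm {w} {i} {j} {p} {q} v la lb ap cov₁ cov₂ = arith cov₁ cov₂ shorter-pq shorter-pqij (mulT-comm w ap (i≢j la) (i≢j lb))
    where
    fixed-point : ∀ {i j} x → Incongruent i j → res n i ≢ res n x → res n j ≢ res n x → evₙ (mulTₙ w i j) x ≡ evₙ w x
    fixed-point {i} {j} x i≢j i≢x j≢x = trans (evₙ-mulT w i≢j x) (cong (evₙ w) (t-fixes i j x (i≢x ∘ sym) (j≢x ∘ sym)))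
    inv-ij : evₙ (mulTₙ w p q) j ℤ.< evₙ (mulTₙ w p q) i
    inv-ij = subst₂ ℤ._<_ (sym (fixed-point j (i≢j lb) (Apart.₂₁ ap ∘ sym) (Apart.₂₂ ap ∘ sym)))
                          (sym (fixed-point i (i≢j lb) (Apart.₁₁ ap ∘ sym) (Apart.₁₂ ap ∘ sym)))
      (covers⇒inversion v (row<col la) (i≢j la) cov₁)
    inv-pq : evₙ w q ℤ.< evₙ w p
    inv-pq = subst₂ ℤ._<_ (fixed-point q (i≢j la) (Apart.₁₂ ap) (Apart.₂₂ ap)) (fixed-point p (i≢j la) (Apart.₁₁ ap) (Apart.₂₁ ap))
      (covers⇒inversion (mulT-valid (i≢j la) v) (row<col lb) (i≢j lb) cov₂)
    shorter-pq : ℓ (mulTₙ w p q) ℕ.< ℓ w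
    shorter-pq = ℓ-mulT-< w (row<col lb) (i≢j lb) inv-pq
    shorter-pqij : ℓ (mulTₙ (mulTₙ w p q) i j) ℕ.< ℓ (mulTₙ w p q)
    shorter-pqij = ℓ-mulT-< (mulTₙ w p q) (row<col la) (i≢j la) inv-ij
    arith : ∀ {a b c d e} → b ℕ.+ 1 ≡ ℓ a → ℓ c ℕ.+ 1 ≡ b → d ℕ.< ℓ a → ℓ e ℕ.< d → c ≡ e →
      d ℕ.+ 1 ≡ ℓ a × ℓ e ℕ.+ 1 ≡ d
    arith {a} {b} {c} {d} {e} b+1≡a c+1≡b d<a c<d refl = trans (cong (ℕ._+ 1) (sym b≡d)) b+1≡a , trans c+1≡b b≡d
      where
      b≡d : b ≡ d
      b≡d = ℕP.≤-antisym (subst (ℕ._≤ d) (trans (ℕP.+-comm 1 (ℓ c)) c+1≡b) c<d)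
        (ℕP.+-cancelʳ-≤ 1 d b (subst₂ ℕ._≤_ (ℕP.+-comm 1 d) (sym b+1≡a) d<a))

  actSym-comm : ∀ {a b x} → Monomial x → Letter a → Letter b → Apart a b →
    actₙ b (actₙ a x) ≡ actₙ a (actₙ b x)
  actSym-comm {a} {b} none _ _ _ = trans (cong (actₙ b) (actₙ-[] a)) (trans (actₙ-[] b)
    (sym (trans (cong (actₙ a) (actₙ-[] b)) (actₙ-[] a))))
  actSym-comm {i , j} {p , q} (one {c} {w} v) la lb ap with both? w i j p q | both? w p q i j
    where
    both? : ∀ w i j p q → Dec (Covers w i j × Covers (mulTₙ w i j) p q)
    both? w i j p q with covers? w i j | covers? (mulTₙ w i j) p q
    ... | yes x | yes y = yes (x , y)
    ... | no ¬x | _ = no (¬x ∘ proj₁)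
    ... | _ | no ¬y = no (¬y ∘ proj₂)
  ... | yes (x , y) | yes (x′ , y′) = trans (two x y) (trans (cong (λ z → (c , z) ∷ []) (mulT-comm w ap (i≢j la) (i≢j lb))) (sym (two x′ y′)))
    where
    two : ∀ {i j p q} → Covers w i j → Covers (mulTₙ w i j) p q →
      actₙ (p , q) (actₙ (i , j) ((c , w) ∷ [])) ≡ (c , mulTₙ (mulTₙ w i j) p q) ∷ []
    two {p = p} {q} x y = trans (cong (actₙ (p , q)) (actSym-covers x)) (actSym-covers y)
  ... | no ¬both | no ¬both′ = trans (vanishes ¬both) (sym (vanishes ¬both′))
    where
    vanishes : ∀ {i j p q} → ¬ (Covers w i j × Covers (mulTₙ w i j) p q) → actₙ (p , q) (actₙ (i , j) ((c , w) ∷ [])) ≡ []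
    vanishes {i} {j} {p} {q} ¬b with covers? w i j
    ... | no ¬x = trans (cong (actₙ (p , q)) (actSym-¬covers ¬x)) (actₙ-[] (p , q))
    ... | yes x = trans (cong (actₙ (p , q)) (actSym-covers x)) (actSym-¬covers λ y → ¬b (x , y))
  ... | yes (x , y) | no ¬both′ = ⊥-elim (¬both′ (covers-comm v la lb ap x y))
  ... | no ¬both | yes (x , y) = ⊥-elim (¬both (covers-comm v lb la (apart-sym ap) x y))

  -- A bound on the letters that act nontrivially

  -- If values are displaced by at most B, a letter acting nontrivially has both ends within 2B of
  -- 0, and afterwards displacements are at most 3B. The sum serves as a common upper bound for the
  -- present letter and all later ones.
  reach : ℕ → ℕ → ℕ
  reach zero B = 0
  reach (suc m) B = 2 ℕ.* B ℕ.+ reach m (3 ℕ.* B)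

  InRange : ℕ → Box → Set
  InRange N (i , j) = ℤ.- (+ N) ℤ.≤ i × j ℤ.≤ + N

  inRange-mono : ∀ {N N′ b} → N ℕ.≤ N′ → InRange N b → InRange N′ b
  inRange-mono N≤N′ (lo , hi) = ℤP.≤-trans (ℤP.neg-mono-≤ (ℤ.+≤+ N≤N′)) lo , ℤP.≤-trans hi (ℤ.+≤+ N≤N′)

  -- The ends lie on opposite sides of the cut at 0 and less than 2B apart, so neither is far from
  -- it.
  inversion⇒inRange : ∀ {f B b} → Within B f → Letter b → f (proj₂ b) ℤ.< f (proj₁ b) → InRange (2 ℕ.* B) b
  inversion⇒inRange {f} {B} {i , j} wB lb fj<fi = low , high
    where
    j<i+2B : j ℤ.< i ℤ.+ + (2 ℕ.* B)
    j<i+2B = inversion-short {f = f} wB fj<fi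
    low : ℤ.- (+ (2 ℕ.* B)) ℤ.≤ i
    low = ℤP.<⇒≤ (<-by-difference (ℤP.+-mono-< j<i+2B (col>0 lb)) (e′ i j (+ (2 ℕ.* B))))
      where
      e′ : ∀ i j B → (i ℤ.+ B ℤ.+ j) ℤ.- (j ℤ.+ 0ℤ) ≡ i ℤ.- (ℤ.- B)
      e′ = solve-∀
    high : j ℤ.≤ + (2 ℕ.* B)
    high = ℤP.<⇒≤ (<-by-difference (ℤP.+-mono-<-≤ j<i+2B (row≤0 lb)) (e′ i j (+ (2 ℕ.* B))))
      where
      e′ : ∀ i j B → (i ℤ.+ B ℤ.+ 0ℤ) ℤ.- (j ℤ.+ i) ≡ B ℤ.- j
      e′ = solve-∀

  -- The reflection displaces points by at most j - i, which is below 2B because (i, j) is inverted;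
  -- `w` contributes another B.
  within-mulT : ∀ {w B b} → Within B (evₙ w) → Letter b → evₙ w (proj₂ b) ℤ.< evₙ w (proj₁ b) →
    Within (3 ℕ.* B) (evₙ (mulTₙ w (proj₁ b) (proj₂ b)))
  within-mulT {w} {B} {i , j} wB lb wj<wi x = upper , lower
    where
    C : ℤ
    C = + (2 ℕ.* B)
    j<i+C : j ℤ.< i ℤ.+ C
    j<i+C = inversion-short {f = evₙ w} wB wj<wi
    y = t i j x
    3B≡ : + (3 ℕ.* B) ≡ C ℤ.+ + B
    3B≡ = cong +_ (ℕP.+-comm B (2 ℕ.* B))
    far : ∀ c → j ⊹ c ℤ.≤ (i ⊹ c) ℤ.+ C
    far c = ≤-by-difference (ℤP.<⇒≤ j<i+C) (trans (e i j (c ℤ.* + n) C) (cong₂ (λ a b → a ℤ.+ C ℤ.- b) (sym (⊹-def i c)) (sym (⊹-def j c))))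
      where
      e : ∀ i j y C → (i ℤ.+ C) ℤ.- j ≡ ((i ℤ.+ y) ℤ.+ C) ℤ.- (j ℤ.+ y)
      e = solve-∀
    far′ : ∀ c → i ⊹ c ℤ.≤ (j ⊹ c) ℤ.+ C
    far′ c = ℤP.≤-trans (ℤP.<⇒≤ (⊹-mono-< c (row<col lb))) (ℤP.i≤i+j (j ⊹ c) C)
    shift : y ℤ.≤ x ℤ.+ C × x ℤ.≤ y ℤ.+ C
    shift with tCase i j x
    ... | first c refl = subst (λ y → y ℤ.≤ (i ⊹ c) ℤ.+ C × i ⊹ c ℤ.≤ y ℤ.+ C) (sym (t-first i j c)) (far c , far′ c)
    ... | second c refl = subst (λ y → y ℤ.≤ (j ⊹ c) ℤ.+ C × j ⊹ c ℤ.≤ y ℤ.+ C) (sym (t-second i j c (i≢j lb))) (far′ c , far c)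
    ... | fixed x≢i x≢j = subst (λ y → y ℤ.≤ x ℤ.+ C × x ℤ.≤ y ℤ.+ C) (sym (t-fixes i j x x≢i x≢j)) (ℤP.i≤i+j x C , ℤP.i≤i+j x C)
    e-upper : ∀ v y x C B → ((y ℤ.+ B) ℤ.+ (x ℤ.+ C)) ℤ.- (v ℤ.+ y) ≡ (x ℤ.+ (C ℤ.+ B)) ℤ.- v
    e-upper = solve-∀
    e-lower : ∀ v y x C B → ((v ℤ.+ B) ℤ.+ (y ℤ.+ C)) ℤ.- (y ℤ.+ x) ≡ (v ℤ.+ (C ℤ.+ B)) ℤ.- x
    e-lower = solve-∀
    upper : evₙ (mulTₙ w i j) x ℤ.≤ x ℤ.+ + (3 ℕ.* B)
    upper = subst₂ (λ a b → a ℤ.≤ x ℤ.+ b) (sym (evₙ-mulT w (i≢j lb) x)) (sym 3B≡)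
      (≤-by-difference (ℤP.+-mono-≤ (proj₁ (wB y)) (proj₁ shift)) (e-upper (evₙ w y) y x C (+ B)))
    lower : x ℤ.≤ evₙ (mulTₙ w i j) x ℤ.+ + (3 ℕ.* B)
    lower = subst₂ (λ a b → x ℤ.≤ a ℤ.+ b) (sym (evₙ-mulT w (i≢j lb) x)) (sym 3B≡)
      (≤-by-difference (ℤP.+-mono-≤ (proj₂ (wB y)) (proj₂ shift)) (e-lower (evₙ w y) y x C (+ B)))

  actWord-[] : ∀ L → actWordₙ L [] ≡ []
  actWord-[] [] = refl
  actWord-[] (b ∷ L) = trans (cong (actWordₙ L) (actₙ-[] b)) (actWord-[] L)

  actWord-support : ∀ {c w B} L → Valid w → Within B (evₙ w) → All Letter L → actWordₙ L ((c , w) ∷ []) ≢ [] →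
    All (InRange (reach (length L) B)) L
  actWord-support [] _ _ _ _ = []
  actWord-support {c} {w} {B} ((i , j) ∷ L) v wB (lb ∷ lL) nz with covers? w i j
  ... | no ¬cov = ⊥-elim (nz (trans (cong (actWordₙ L) (actSym-¬covers ¬cov)) (actWord-[] L)))
  ... | yes cov = inRange-mono (ℕP.m≤m+n _ _) (inversion⇒inRange {evₙ w} wB lb inv)
                ∷ All.map (λ {b} → inRange-mono {b = b} (ℕP.m≤n+m _ _))
                    (actWord-support L (mulT-valid (i≢j lb) v) (within-mulT {w} wB lb inv) lL
                      (λ eq → nz (trans (cong (actWordₙ L) (actSym-covers cov)) eq)))
    where
    inv : evₙ w j ℤ.< evₙ w i
    inv = covers⇒inversion v (row<col lb) (i≢j lb) cov

-- Words up to commutation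

T-∧⁻ : ∀ {a b} → T (a ∧ b) → T a × T b
T-∧⁻ = Equivalence.to T-∧

T-∧⁺ : ∀ {a b} → T a → T b → T (a ∧ b)
T-∧⁺ p q = Equivalence.from T-∧ (p , q)

T-∨⁻ : ∀ {a b} → T (a ∨ b) → T a ⊎ T b
T-∨⁻ = Equivalence.to T-∨

T-∨⁺ : ∀ {a b} → T a ⊎ T b → T (a ∨ b)
T-∨⁺ = Equivalence.from T-∨

==ℤ-sound : ∀ {a b} → T (a ==ℤ b) → a ≡ b
==ℤ-sound = toWitness

==ℤ-complete : ∀ {a b} → a ≡ b → T (a ==ℤ b)
==ℤ-complete = fromWitness

==ℕ-sound : ∀ {a b} → T (a ==ℕ b) → a ≡ b
==ℕ-sound = toWitness

==ℕ-complete : ∀ {a b} → a ≡ b → T (a ==ℕ b)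
==ℕ-complete = fromWitness

module _ {X : Set} {eq : X → X → Bool} (sound : ∀ {x y} → T (eq x y) → x ≡ y) (complete : ∀ {x y} → x ≡ y → T (eq x y)) where

  any-∈⁺ : ∀ {x xs} → x ∈ xs → T (any (eq x) xs)
  any-∈⁺ x∈ = AnyP.any⁺ _ (Any.map complete x∈)

  any-∈⁻ : ∀ {x} xs → T (any (eq x) xs) → x ∈ xs
  any-∈⁻ {x} xs p = Any.map sound (AnyP.any⁻ (eq x) xs p)

  distinctB⇒Unique : ∀ xs → T (distinctB eq xs) → Unique xs
  distinctB⇒Unique [] _ = []
  distinctB⇒Unique (x ∷ xs) d with T-∧⁻ d
  ... | p , q = ∉⇒All≢ (λ x∈ → T-not⇒¬T p (any-∈⁺ x∈)) ∷ distinctB⇒Unique xs q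

  Unique⇒distinctB : ∀ {xs} → Unique xs → T (distinctB eq xs)
  Unique⇒distinctB [] = tt
  Unique⇒distinctB {x ∷ xs} u@(_ ∷ u′) =
    T-∧⁺ (¬T⇒T-not λ p → UniqueP.Unique[x∷xs]⇒x∉xs u (any-∈⁻ xs p)) (Unique⇒distinctB u′)

  ∈-dedupB⁻ : ∀ xs {x} → x ∈ dedupB eq xs → x ∈ xs
  ∈-dedupB⁻ (x ∷ xs) (here refl) = here refl
  ∈-dedupB⁻ (x ∷ xs) (there y∈) =
    there (∈-dedupB⁻ xs (proj₁ (∈-filter⁻ (T? ∘ λ y → not (eq x y)) {xs = dedupB eq xs} y∈)))

  ∈-dedupB⁺ : ∀ {xs x} → x ∈ xs → x ∈ dedupB eq xs
  ∈-dedupB⁺ (here refl) = here refl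
  ∈-dedupB⁺ {x ∷ xs} {y} (there y∈) with T? (eq x y)
  ... | yes p = here (sym (sound p))
  ... | no ¬p = there (∈-filter⁺ (T? ∘ λ y → not (eq x y)) (∈-dedupB⁺ y∈) (¬T⇒T-not ¬p))

  dedupB-unique : ∀ xs → Unique (dedupB eq xs)
  dedupB-unique [] = []
  dedupB-unique (x ∷ xs) =
    ∉⇒All≢ (λ x∈ → T-not⇒¬T (proj₂ (∈-filter⁻ (T? ∘ λ y → not (eq x y)) {xs = dedupB eq xs} x∈)) (complete refl))
    ∷ UniqueP.filter⁺ (T? ∘ λ y → not (eq x y)) (dedupB-unique xs)

  dedupB-image : ∀ {g : X → X} → (∀ {x y} → g x ≡ g y → x ≡ y) →
    ∀ {xs ys} → ys ↭ map g xs → dedupB eq ys ↭ map g (dedupB eq xs)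
  dedupB-image {g} inj {xs} {ys} p = Unique∧⊆∧⊇⇒↭ (dedupB-unique ys) (UniqueP.map⁺ inj (dedupB-unique xs)) to from
    where
    to : ∀ {y} → y ∈ dedupB eq ys → y ∈ map g (dedupB eq xs)
    to y∈ with ∈-map⁻ g (PermP.∈-resp-↭ p (∈-dedupB⁻ ys y∈))
    ... | x , x∈ , refl = ∈-map⁺ g (∈-dedupB⁺ x∈)
    from : ∀ {y} → y ∈ map g (dedupB eq xs) → y ∈ dedupB eq ys
    from y∈ with ∈-map⁻ g y∈
    ... | x , x∈ , refl = ∈-dedupB⁺ (PermP.∈-resp-↭ (↭-sym p) (∈-map⁺ g (∈-dedupB⁻ xs x∈)))

-- Enumeration of orderings and of subsets

module _ {X : Set} where

  ∈-select⁻ : ∀ (xs : List X) {x rest} → (x , rest) ∈ select xs → xs ↭ x ∷ rest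
  ∈-select⁻ (y ∷ xs) (here refl) = ↭-refl
  ∈-select⁻ (y ∷ xs) (there p∈) with ∈-map⁻ (λ p → proj₁ p , y ∷ proj₂ p) p∈
  ... | (x , rest) , q∈ , refl = ↭-trans (prep y (∈-select⁻ xs q∈)) (Perm.swap y x ↭-refl)

  ∈-select⁺ : ∀ {xs : List X} {x} → x ∈ xs → ∃ λ rest → (x , rest) ∈ select xs
  ∈-select⁺ {xs = y ∷ xs} (here refl) = xs , here refl
  ∈-select⁺ {xs = y ∷ xs} (there x∈) with ∈-select⁺ x∈
  ... | rest , p∈ = y ∷ rest , there (∈-map⁺ (λ p → proj₁ p , y ∷ proj₂ p) p∈)

  private
    extend : ℕ → X × List X → List (List X)
    extend f p = map (proj₁ p ∷_) (permsF f (proj₂ p))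

  ∈-permsF⁻ : ∀ f (xs : List X) {ys} → length xs ≡ f → ys ∈ permsF f xs → ys ↭ xs
  ∈-permsF⁻ zero [] _ (here refl) = ↭-refl
  ∈-permsF⁻ (suc f) xs@(x₀ ∷ xs₀) eq ys∈ with find (∈-concatMap⁻ (extend f) {select xs} ys∈)
  ... | (x , rest) , p∈ , ys∈′ with ∈-map⁻ (x ∷_) ys∈′
  ... | zs , zs∈ , refl = ↭-trans (prep x (∈-permsF⁻ f rest len≡ zs∈)) (↭-sym (∈-select⁻ xs p∈))
    where
    len≡ : length rest ≡ f
    len≡ = ℕP.suc-injective (trans (sym (PermP.↭-length (∈-select⁻ xs p∈))) eq)

  ∈-permsF⁺ : ∀ f (xs : List X) {ys} → length xs ≡ f → ys ↭ xs → ys ∈ permsF f xs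
  ∈-permsF⁺ zero [] _ p = here (PermP.↭-empty-inv p)
  ∈-permsF⁺ (suc f) xs@(_ ∷ _) {[]} eq p with () ← trans (PermP.↭-length p) eq
  ∈-permsF⁺ (suc f) xs@(x₀ ∷ xs₀) {y ∷ ys} eq p with ∈-select⁺ (PermP.∈-resp-↭ p (here refl))
  ... | rest , q∈ = ∈-concatMap⁺ (extend f) {select xs} (lose q∈ (∈-map⁺ (y ∷_) (∈-permsF⁺ f rest len≡ (PermP.drop-∷ (↭-trans p xs↭)))))
    where
    xs↭ : xs ↭ y ∷ rest
    xs↭ = ∈-select⁻ xs q∈
    len≡ : length rest ≡ f
    len≡ = ℕP.suc-injective (trans (sym (PermP.↭-length xs↭)) eq)

  ∈-orderings⁻ : ∀ (xs : List X) {ys} → ys ∈ orderings xs → ys ↭ xs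
  ∈-orderings⁻ xs = ∈-permsF⁻ (length xs) xs refl

  ∈-orderings⁺ : ∀ (xs : List X) {ys} → ys ↭ xs → ys ∈ orderings xs
  ∈-orderings⁺ xs = ∈-permsF⁺ (length xs) xs refl

  ∈-choose⁻ : ∀ m (xs : List X) {D} → D ∈ choose m xs → length D ≡ m × (∀ {x} → x ∈ D → x ∈ xs)
  ∈-choose⁻ zero xs (here refl) = refl , λ ()
  ∈-choose⁻ (suc m) (x ∷ xs) D∈ with ∈-++⁻ (map (x ∷_) (choose m xs)) D∈
  ... | inj₂ D∈′ with ∈-choose⁻ (suc m) xs D∈′
  ... | len≡ , sub = len≡ , there ∘ sub
  ∈-choose⁻ (suc m) (x ∷ xs) D∈ | inj₁ D∈′ with ∈-map⁻ (x ∷_) D∈′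
  ... | D′ , D′∈ , refl with ∈-choose⁻ m xs D′∈
  ... | len≡ , sub = cong suc len≡ , λ { (here refl) → here refl ; (there y∈) → there (sub y∈) }

  choose-unique : ∀ m {xs : List X} {D} → Unique xs → D ∈ choose m xs → Unique D
  choose-unique zero _ (here refl) = []
  choose-unique (suc m) {x ∷ xs} (px ∷ u) D∈ with ∈-++⁻ (map (x ∷_) (choose m xs)) D∈
  ... | inj₂ D∈′ = choose-unique (suc m) u D∈′
  ... | inj₁ D∈′ with ∈-map⁻ (x ∷_) D∈′
  ... | D′ , D′∈ , refl = All.tabulate (λ y∈ → All.lookup px (proj₂ (∈-choose⁻ m xs D′∈) y∈)) ∷ choose-unique m u D′∈

  -- A choice containing the head is never a permutation of one that omits it. This is what keeps
  -- terms belonging to different trees inequivalent.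
  choose-↭-distinct : ∀ m {xs : List X} → Unique xs → AllPairs (λ D D′ → ¬ (D ↭ D′)) (choose m xs)
  choose-↭-distinct zero _ = [] ∷ []
  choose-↭-distinct (suc m) {[]} _ = []
  choose-↭-distinct (suc m) {x ∷ xs} u@(_ ∷ u′) = AllPairsP.++⁺
    (AllPairsP.map⁺ (AllPairs.map (λ ¬p p → ¬p (PermP.drop-∷ p)) (choose-↭-distinct m u′)))
    (choose-↭-distinct (suc m) u′)
    (All.tabulate λ D∈ → All.tabulate λ D′∈ D↭D′ →
      UniqueP.Unique[x∷xs]⇒x∉xs u (proj₂ (∈-choose⁻ (suc m) xs D′∈) (PermP.∈-resp-↭ D↭D′ (∈-map∷⁻ D∈))))

module _ {X : Set} (_≟_ : DecidableEquality X) where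
  open import Data.List.Membership.DecPropositional _≟_ using (_∈?_)

  -- Each subset is enumerated only in the order of the ambient list. The image of a tree under σ
  -- generally comes in another order, hence the permutation in the conclusion.
  choose-complete : ∀ m (xs : List X) {L} → Unique xs → Unique L → length L ≡ m → (∀ {x} → x ∈ L → x ∈ xs) →
    ∃ λ D → D ∈ choose m xs × D ↭ L
  choose-complete zero xs {[]} _ _ _ _ = [] , here refl , ↭-refl
  choose-complete (suc m) [] {x ∷ L} _ _ _ sub with () ← sub (here refl)
  choose-complete (suc m) (x ∷ xs) {L} (px ∷ u) uL len≡ sub with x ∈? L
  ... | yes x∈L with ∈-split-↭ x∈L
  ... | L′ , L↭ with Unique-resp-↭ L↭ uL
  ... | pL ∷ uL′ with choose-complete m xs u uL′ (ℕP.suc-injective (trans (sym (PermP.↭-length L↭)) len≡))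
                     (λ {y} y∈ → ∈-∷⁻ (sub (PermP.∈-resp-↭ (↭-sym L↭) (there y∈))) (λ y≡x → All.lookup pL y∈ (sym y≡x)))
  ... | D , D∈ , D↭ = x ∷ D , ∈-++⁺ˡ (∈-map⁺ (x ∷_) D∈) , ↭-trans (prep x D↭) (↭-sym L↭)
  choose-complete (suc m) (x ∷ xs) {L} (px ∷ u) uL len≡ sub | no x∉L
    with choose-complete (suc m) xs u uL len≡ (λ {y} y∈ → ∈-∷⁻ (sub y∈) (λ y≡x → x∉L (subst (_∈ L) y≡x y∈)))
  ... | D , D∈ , D↭ = D , ∈-++⁺ʳ (map (x ∷_) (choose m xs)) D∈ , D↭

_≟B_ : DecidableEquality Box
_≟B_ = ×-≡-dec ℤ._≟_ ℤ._≟_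

_≟W_ : DecidableEquality (List Box)
_≟W_ = LP.≡-dec _≟B_

Disjoint : Box → Box → Set
Disjoint (a , b) (c , d) = a ≢ c × a ≢ d × b ≢ c × b ≢ d

disjB-sound : ∀ {x y} → T (disjB x y) → Disjoint x y
disjB-sound {a , b} {c , d} p =
    (λ e → q (T-∨⁺ (inj₁ (==ℤ-complete e))))
  , (λ e → q (T-∨⁺ {a ==ℤ c} (inj₂ (T-∨⁺ (inj₁ (==ℤ-complete e))))))
  , (λ e → q (T-∨⁺ {a ==ℤ c} (inj₂ (T-∨⁺ {a ==ℤ d} (inj₂ (T-∨⁺ (inj₁ (==ℤ-complete e))))))))
  , (λ e → q (T-∨⁺ {a ==ℤ c} (inj₂ (T-∨⁺ {a ==ℤ d} (inj₂ (T-∨⁺ {b ==ℤ c} (inj₂ (==ℤ-complete e))))))))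
  where
  q : ¬ T ((a ==ℤ c) ∨ (a ==ℤ d) ∨ (b ==ℤ c) ∨ (b ==ℤ d))
  q = T-not⇒¬T p

disjB-complete : ∀ {x y} → Disjoint x y → T (disjB x y)
disjB-complete {a , b} {c , d} (ac , ad , bc , bd) = ¬T⇒T-not q
  where
  q : ¬ T ((a ==ℤ c) ∨ (a ==ℤ d) ∨ (b ==ℤ c) ∨ (b ==ℤ d))
  q p with T-∨⁻ {a ==ℤ c} p
  ... | inj₁ e = ac (==ℤ-sound e)
  ... | inj₂ p with T-∨⁻ {a ==ℤ d} p
  ... | inj₁ e = ad (==ℤ-sound e)
  ... | inj₂ p with T-∨⁻ {b ==ℤ c} p
  ... | inj₁ e = bc (==ℤ-sound e)
  ... | inj₂ e = bd (==ℤ-sound e)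

disjoint-sym : ∀ {x y} → Disjoint x y → Disjoint y x
disjoint-sym (ac , ad , bc , bd) = ac ∘ sym , bc ∘ sym , ad ∘ sym , bd ∘ sym

infix 4 _⇝_ _~_

data _⇝_ : List Box → List Box → Set where
  swap : ∀ {x y zs} → Disjoint x y → x ∷ y ∷ zs ⇝ y ∷ x ∷ zs
  skip : ∀ {x ys zs} → ys ⇝ zs → x ∷ ys ⇝ x ∷ zs

⇝-sym : ∀ {u v} → u ⇝ v → v ⇝ u
⇝-sym (swap d) = swap (disjoint-sym d)
⇝-sym (skip s) = skip (⇝-sym s)

⇝⇒↭ : ∀ {u v} → u ⇝ v → u ↭ v
⇝⇒↭ (swap {x} {y} _) = Perm.swap x y ↭-refl
⇝⇒↭ (skip {x} s) = prep x (⇝⇒↭ s)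

∈-swaps⁻ : ∀ {u v} → v ∈ swaps u → u ⇝ v
∈-swaps⁻ {x ∷ y ∷ zs} v∈ with ∈-++⁻ (if disjB x y then (y ∷ x ∷ zs) ∷ [] else []) v∈
... | inj₂ v∈′ with ∈-map⁻ (x ∷_) v∈′
... | _ , z∈ , refl = skip (∈-swaps⁻ z∈)
∈-swaps⁻ {x ∷ y ∷ zs} v∈ | inj₁ v∈′ with disjB x y in eq
∈-swaps⁻ {x ∷ y ∷ zs} v∈ | inj₁ (here refl) | true = swap (disjB-sound {x} {y} (subst T (sym eq) tt))

∈-swaps⁺ : ∀ {u v} → u ⇝ v → v ∈ swaps u
∈-swaps⁺ (swap {x} {y} d) with disjB x y | disjB-complete {x} {y} d
... | true | _ = here refl
∈-swaps⁺ (skip {x} {y ∷ ys} s) = ∈-++⁺ʳ (if disjB x y then (y ∷ x ∷ ys) ∷ [] else []) (∈-map⁺ (x ∷_) (∈-swaps⁺ s))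

_~_ : List Box → List Box → Set
_~_ = Path _≟W_ _⇝_

~-sym : ∀ {u v} → u ~ v → v ~ u
~-sym = path-sym _≟W_ _⇝_ ⇝-sym

~-trans : ∀ {u v w} → u ~ v → v ~ w → u ~ w
~-trans = path-trans _≟W_ _⇝_

~⇒↭ : ∀ {u v} → u ~ v → u ↭ v
~⇒↭ stop = ↭-refl
~⇒↭ (step s p) = ↭-trans (⇝⇒↭ s) (~⇒↭ p)

~-skip : ∀ x {u v} → u ~ v → x ∷ u ~ x ∷ v
~-skip x stop = stop
~-skip x (step s p) = step (skip s) (~-skip x p)

~-++ˡ : ∀ xs {u v} → u ~ v → xs ++ u ~ xs ++ v
~-++ˡ [] p = p
~-++ˡ (x ∷ xs) p = ~-skip x (~-++ˡ xs p)

~-++ʳ : ∀ {u v} ys → u ~ v → u ++ ys ~ v ++ ys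
~-++ʳ ys stop = stop
~-++ʳ ys (step s p) = step (⇝-++ s) (~-++ʳ ys p)
  where
  ⇝-++ : ∀ {u v} → u ⇝ v → u ++ ys ⇝ v ++ ys
  ⇝-++ (swap d) = swap d
  ⇝-++ (skip s) = skip (⇝-++ s)

==B-sound : ∀ {x y} → T (x ==B y) → x ≡ y
==B-sound {a , b} {c , d} p with T-∧⁻ p
... | p , q = cong₂ _,_ (==ℤ-sound p) (==ℤ-sound q)

==Wd-sound : ∀ {u v} → T (u ==Wd v) → u ≡ v
==Wd-sound {[]} {[]} _ = refl
==Wd-sound {x ∷ u} {y ∷ v} p with T-∧⁻ p
... | p , q = cong₂ _∷_ (==B-sound p) (==Wd-sound q)

==Wd-refl : ∀ u → T (u ==Wd u)
==Wd-refl [] = tt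
==Wd-refl ((a , b) ∷ u) = T-∧⁺ (T-∧⁺ {a ==ℤ a} (==ℤ-complete refl) (==ℤ-complete refl)) (==Wd-refl u)

==Wd-complete : ∀ {u v} → u ≡ v → T (u ==Wd v)
==Wd-complete {u} refl = ==Wd-refl u

∈-reachF⁻ : ∀ f {u v} → v ∈ reachF f u → u ~ v
∈-reachF⁻ zero (here refl) = stop
∈-reachF⁻ (suc f) {u} v∈ with ∈-++⁻ (reachF f u) v∈
... | inj₁ v∈′ = ∈-reachF⁻ f v∈′
... | inj₂ v∈′ with find (∈-concatMap⁻ swaps {reachF f u} v∈′)
... | x , x∈ , v∈x = ~-trans (∈-reachF⁻ f x∈) (step (∈-swaps⁻ v∈x) stop)

-- `reachF` extends words at the far end of the search, whereas a path is consumed from its start;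
-- `g` records the rounds already spent. The bound is `suc f` because `visited` counts vertices, one
-- more than the steps.
∈-reachF⁺ : ∀ f g {u x v} (p : x ~ v) → length (visited _≟W_ _⇝_ p) ℕ.≤ suc f → x ∈ reachF g u → v ∈ reachF (f ℕ.+ g) u
∈-reachF⁺ zero g stop _ x∈ = x∈
∈-reachF⁺ zero g (step _ stop) (s≤s ()) x∈
∈-reachF⁺ zero g (step _ (step _ _)) (s≤s ()) x∈
∈-reachF⁺ (suc f) g stop _ x∈ = ∈-++⁺ˡ (∈-reachF⁺ f g stop (s≤s z≤n) x∈)
∈-reachF⁺ (suc f) g {u} {v = v} (step s p) (s≤s le) x∈ = subst (λ h → v ∈ reachF h u) (ℕP.+-suc f g)
  (∈-reachF⁺ f (suc g) p le (∈-++⁺ʳ (reachF g u) (∈-concatMap⁺ swaps (lose x∈ (∈-swaps⁺ s)))))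

equivLab-sound : ∀ {u v} → T (equivLab u v) → u ~ v
equivLab-sound {u} {v} p = ∈-reachF⁻ (length (orderings u))
  (any-∈⁻ {eq = _==Wd_} ==Wd-sound ==Wd-complete (reachF (length (orderings u)) u) p)

-- Every word equivalent to `u` is an ordering of `u`, so a path without repetitions fits into the
-- fuel.
equivLab-complete : ∀ {u v} → u ~ v → T (equivLab u v)
equivLab-complete {u} {v} p with bounded-path _≟W_ _⇝_ (∈-orderings⁺ u ↭-refl)
    (λ a⇝b a∈ → ∈-orderings⁺ u (↭-trans (↭-sym (⇝⇒↭ a⇝b)) (∈-orderings⁻ u a∈))) p
... | q , le = any-∈⁺ {eq = _==Wd_} ==Wd-sound ==Wd-complete
      (subst (λ f → v ∈ reachF f u) (ℕP.+-identityʳ (length (orderings u)))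
        (∈-reachF⁺ (length (orderings u)) 0 q (ℕP.m≤n⇒m≤1+n le) (here refl)))

reps-⊆ : ∀ f {ws v} → v ∈ reps f ws → v ∈ ws
reps-⊆ zero v∈ = v∈
reps-⊆ (suc f) {w ∷ ws} (here refl) = here refl
reps-⊆ (suc f) {w ∷ ws} (there v∈) = there (proj₁ (∈-filter⁻ (T? ∘ λ w′ → not (equivLab w w′)) {xs = ws} (reps-⊆ f v∈)))

-- With no fuel left, `reps` returns the remaining words unfiltered; the bound ensures that none
-- remain by then, each round having removed the head.
reps-inequivalent : ∀ f {ws} → length ws ℕ.≤ f → AllPairs (λ u v → ¬ u ~ v) (reps f ws)
reps-inequivalent zero {[]} _ = []
reps-inequivalent (suc f) {[]} _ = []
reps-inequivalent (suc f) {w ∷ ws} (s≤s le) =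
  All.tabulate (λ v∈ w~v → T-not⇒¬T (proj₂ (∈-filter⁻ (T? ∘ λ w′ → not (equivLab w w′)) {xs = ws} (reps-⊆ f v∈))) (equivLab-complete w~v))
  ∷ reps-inequivalent f (ℕP.≤-trans (LP.length-filter (T? ∘ λ w′ → not (equivLab w w′)) ws) le)

reps-complete : ∀ f {ws w} → w ∈ ws → ∃ λ r → r ∈ reps f ws × r ~ w
reps-complete zero {ws} {w} w∈ = w , w∈ , stop
reps-complete (suc f) {w₀ ∷ ws} (here refl) = w₀ , here refl , stop
reps-complete (suc f) {w₀ ∷ ws} {w} (there w∈) with T? (equivLab w₀ w)
... | yes eq = w₀ , here refl , equivLab-sound eq
... | no ¬eq with reps-complete f (∈-filter⁺ (T? ∘ λ w′ → not (equivLab w₀ w′)) w∈ (¬T⇒T-not ¬eq))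
... | r , r∈ , r~w = r , there r∈ , r~w

∈-MD⁻ : ∀ D {L} → L ∈ MD D → L ↭ D × T (goodLab D L)
∈-MD⁻ D L∈ with ∈-filter⁻ (T? ∘ goodLab D) {xs = orderings D} (reps-⊆ (length (filterᵇ (goodLab D) (orderings D))) L∈)
... | L∈ord , good = ∈-orderings⁻ D L∈ord , good

MD-inequivalent : ∀ D → AllPairs (λ u v → ¬ u ~ v) (MD D)
MD-inequivalent D = reps-inequivalent (length (filterᵇ (goodLab D) (orderings D))) ℕP.≤-refl

MD-complete : ∀ {D L} → L ↭ D → T (goodLab D L) → ∃ λ r → r ∈ MD D × r ~ L
MD-complete {D} L↭D good = reps-complete (length (filterᵇ (goodLab D) (orderings D)))
  (∈-filter⁺ (T? ∘ goodLab D) (∈-orderings⁺ D L↭D) good)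

module _ (key : Box → ℤ) where

  Movable : Box → Box → Set
  Movable x y = key x ≢ key y → Disjoint x y

  -- Sorting by key only ever exchanges adjacent letters with disjoint supports.
  sorted-equivalent : ∀ L → AllPairs Movable L → ∃ λ L′ → T (sortedℤ (map key L′)) × L ~ L′
  sorted-equivalent [] [] = [] , tt , stop
  sorted-equivalent (x ∷ L) (px ∷ pL) with sorted-equivalent L pL
  ... | L′ , sorted , L~L′ with insert-sorted x L′ (PermP.All-resp-↭ (~⇒↭ L~L′) px) sorted
    where
    Lower : Box → List Box → Set
    Lower x [] = ⊤
    Lower x (y ∷ _) = key x ℤ.≤ key y
    cons-sorted : ∀ x L → Lower x L → T (sortedℤ (map key L)) → T (sortedℤ (map key (x ∷ L)))
    cons-sorted x [] _ _ = tt
    cons-sorted x (y ∷ L) le s = T-∧⁺ {key x ≤ℤ key y} (fromWitness le) s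
    tail-sorted : ∀ y L → T (sortedℤ (map key (y ∷ L))) → Lower y L × T (sortedℤ (map key L))
    tail-sorted y [] _ = tt , tt
    tail-sorted y (z ∷ L) s with T-∧⁻ {key y ≤ℤ key z} s
    ... | le , s′ = toWitness le , s′
    -- The last component strengthens the induction: when `x` passes `z`, it shows that `z` still
    -- bounds the head of the list into which `x` was inserted.
    insert-sorted : ∀ x L → All (Movable x) L → T (sortedℤ (map key L)) →
      ∃ λ L′ → T (sortedℤ (map key L′)) × x ∷ L ~ L′ × (∀ y → key y ℤ.≤ key x → Lower y L → Lower y L′)
    insert-sorted x [] _ _ = x ∷ [] , tt , stop , λ y le _ → le
    insert-sorted x (z ∷ L) (xz ∷ px) s with key x ℤ.≤? key z
    ... | yes le = x ∷ z ∷ L , cons-sorted x (z ∷ L) le s , stop , λ y le _ → le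
    ... | no gt with tail-sorted z L s
    ... | z≤L , s′ with insert-sorted x L px s′
    ... | L′ , sL′ , xL~L′ , lower = z ∷ L′
        , cons-sorted z L′ (lower z (ℤP.<⇒≤ (ℤP.≰⇒> gt)) z≤L) sL′
        , step (swap (xz λ eq → gt (ℤP.≤-reflexive eq))) (~-skip z xL~L′)
        , λ y _ le → le
  ... | L″ , sorted″ , xL′~L″ , _ = L″ , sorted″ , ~-trans (~-skip x L~L′) xL′~L″

-- Trees and their labelings

ends : List Box → List ℤ
ends = concatMap (λ b → proj₁ b ∷ proj₂ b ∷ [])

∈-ends₁ : ∀ {D b} → b ∈ D → proj₁ b ∈ ends D
∈-ends₁ b∈ = ∈-concatMap⁺ _ (lose b∈ (here refl))

∈-ends₂ : ∀ {D b} → b ∈ D → proj₂ b ∈ ends D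
∈-ends₂ b∈ = ∈-concatMap⁺ _ (lose b∈ (there (here refl)))

ends-↭ : ∀ {D D′} → D ↭ D′ → ends D ↭ ends D′
ends-↭ Perm.refl = ↭-refl
ends-↭ (prep (i , j) p) = prep i (prep j (ends-↭ p))
ends-↭ (Perm.swap (a , b) (c , d) p) =
  ↭-trans (PermP.shifts (a ∷ b ∷ []) (c ∷ d ∷ [])) (prep c (prep d (prep a (prep b (ends-↭ p)))))
ends-↭ (Perm.trans p q) = ↭-trans (ends-↭ p) (ends-↭ q)

∈-verts⁺ : ∀ {D v} → v ∈ ends D → v ∈ verts D
∈-verts⁺ = ∈-dedupB⁺ {eq = _==ℤ_} ==ℤ-sound ==ℤ-complete

Adjacent : List Box → ℤ → ℤ → Set
Adjacent D u v = (u , v) ∈ D ⊎ (v , u) ∈ D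

Joined : List Box → ℤ → ℤ → Set
Joined D = Path ℤ._≟_ (Adjacent D)

joined-sym : ∀ {D u v} → Joined D u v → Joined D v u
joined-sym = path-sym ℤ._≟_ _ (λ { (inj₁ p) → inj₂ p ; (inj₂ p) → inj₁ p })

joined-trans : ∀ {D u v w} → Joined D u v → Joined D v w → Joined D u w
joined-trans = path-trans ℤ._≟_ _

private
  touched : List ℤ → Box → List ℤ
  touched S b = if any (_==ℤ_ (proj₁ b)) S ∨ any (_==ℤ_ (proj₂ b)) S then proj₁ b ∷ proj₂ b ∷ [] else []

  ∈-touched⁻ : ∀ S b {v} → v ∈ touched S b → (proj₁ b ∈ S ⊎ proj₂ b ∈ S) × v ∈ proj₁ b ∷ proj₂ b ∷ []
  ∈-touched⁻ S b v∈ with any (_==ℤ_ (proj₁ b)) S ∨ any (_==ℤ_ (proj₂ b)) S in eq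
  ... | true with T-∨⁻ {any (_==ℤ_ (proj₁ b)) S} (subst T (sym eq) tt)
  ... | inj₁ p = inj₁ (any-∈⁻ {eq = _==ℤ_} ==ℤ-sound ==ℤ-complete S p) , v∈
  ... | inj₂ p = inj₂ (any-∈⁻ {eq = _==ℤ_} ==ℤ-sound ==ℤ-complete S p) , v∈

  ∈-touched⁺ : ∀ S b {v} → proj₁ b ∈ S ⊎ proj₂ b ∈ S → v ∈ proj₁ b ∷ proj₂ b ∷ [] → v ∈ touched S b
  ∈-touched⁺ S b hit v∈ with any (_==ℤ_ (proj₁ b)) S ∨ any (_==ℤ_ (proj₂ b)) S | test hit
    where
    test : proj₁ b ∈ S ⊎ proj₂ b ∈ S → T (any (_==ℤ_ (proj₁ b)) S ∨ any (_==ℤ_ (proj₂ b)) S)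
    test (inj₁ p) = T-∨⁺ (inj₁ (any-∈⁺ {eq = _==ℤ_} ==ℤ-sound ==ℤ-complete p))
    test (inj₂ p) = T-∨⁺ {any (_==ℤ_ (proj₁ b)) S} (inj₂ (any-∈⁺ {eq = _==ℤ_} ==ℤ-sound ==ℤ-complete p))
  ... | true | _ = v∈

∈-grow⁻ : ∀ D S {v} → v ∈ grow D S → ∃ λ u → u ∈ S × Joined D u v
∈-grow⁻ D S {v} v∈ with ∈-++⁻ S v∈
... | inj₁ v∈S = v , v∈S , stop
... | inj₂ v∈′ with find (∈-concatMap⁻ (touched S) {D} v∈′)
... | (i , j) , b∈ , v∈b with ∈-touched⁻ S (i , j) v∈b
... | inj₁ i∈S , here refl = i , i∈S , stop
... | inj₁ i∈S , there (here refl) = i , i∈S , step (inj₁ b∈) stop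
... | inj₂ j∈S , here refl = j , j∈S , step (inj₂ b∈) stop
... | inj₂ j∈S , there (here refl) = j , j∈S , stop

∈-grow⁺ : ∀ D S {u v} → u ∈ S → Adjacent D u v → v ∈ grow D S
∈-grow⁺ D S u∈ (inj₁ b∈) = ∈-++⁺ʳ S (∈-concatMap⁺ (touched S) (lose b∈ (∈-touched⁺ S _ (inj₁ u∈) (there (here refl)))))
∈-grow⁺ D S u∈ (inj₂ b∈) = ∈-++⁺ʳ S (∈-concatMap⁺ (touched S) (lose b∈ (∈-touched⁺ S _ (inj₂ u∈) (here refl))))

∈-growF⁻ : ∀ f D S {v} → v ∈ growF f D S → ∃ λ u → u ∈ S × Joined D u v
∈-growF⁻ zero D S {v} v∈ = v , v∈ , stop
∈-growF⁻ (suc f) D S v∈ with ∈-growF⁻ f D (grow D S) v∈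
... | x , x∈ , x⋯v with ∈-grow⁻ D S x∈
... | u , u∈ , u⋯x = u , u∈ , joined-trans u⋯x x⋯v

∈-growF⁺ : ∀ f D S {u v} (p : Joined D u v) → length (visited ℤ._≟_ (Adjacent D) p) ℕ.≤ suc f → u ∈ S → v ∈ growF f D S
∈-growF⁺ zero D S stop _ u∈ = u∈
∈-growF⁺ zero D S (step _ stop) (s≤s ()) u∈
∈-growF⁺ zero D S (step _ (step _ _)) (s≤s ()) u∈
∈-growF⁺ (suc f) D S stop _ u∈ = ∈-growF⁺ f D (grow D S) stop (s≤s z≤n) (∈-++⁺ˡ u∈)
∈-growF⁺ (suc f) D S (step a p) (s≤s le) u∈ = ∈-growF⁺ f D (grow D S) p le (∈-grow⁺ D S u∈ a)

Connected : List Box → Set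
Connected D = ∀ {u v} → u ∈ verts D → v ∈ verts D → Joined D u v

connectedB-sound : ∀ D → T (connectedB D) → Connected D
connectedB-sound D c {a} {b} a∈ b∈ with verts D
... | v ∷ vs = joined-trans (joined-sym (from-v a∈)) (from-v b∈)
  where
  from-v : ∀ {u} → u ∈ v ∷ vs → Joined D v u
  from-v {u} u∈ with ∈-growF⁻ (length (v ∷ vs)) D (v ∷ [])
      (any-∈⁻ {eq = _==ℤ_} ==ℤ-sound ==ℤ-complete _ (All.lookup (AllP.all⁺ _ (v ∷ vs) c) u∈))
  ... | _ , here refl , v⋯u = v⋯u

-- The fuel is the number of vertices, and a walk without repetitions stays among them.
connectedB-complete : ∀ D → Connected D → T (connectedB D)
connectedB-complete D conn with verts D in eq
... | [] = tt
... | v ∷ vs = AllP.all⁻ (λ u → any (_==ℤ_ u) (growF (length (v ∷ vs)) D (v ∷ []))) {v ∷ vs} (All.tabulate reached)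
  where
  closed : ∀ {a b} → Adjacent D a b → a ∈ v ∷ vs → b ∈ v ∷ vs
  closed (inj₁ b∈) _ = subst (_ ∈_) eq (∈-verts⁺ {D} (∈-ends₂ b∈))
  closed (inj₂ b∈) _ = subst (_ ∈_) eq (∈-verts⁺ {D} (∈-ends₁ b∈))
  reached : ∀ {u} → u ∈ v ∷ vs → T (any (_==ℤ_ u) (growF (length (v ∷ vs)) D (v ∷ [])))
  reached u∈ with bounded-path ℤ._≟_ (Adjacent D) (here refl) closed (conn (here refl) u∈)
  ... | q , le = any-∈⁺ {eq = _==ℤ_} ==ℤ-sound ==ℤ-complete
        (∈-growF⁺ (length (v ∷ vs)) D (v ∷ []) q (ℕP.m≤n⇒m≤1+n le) (here refl))

take-length-++ : ∀ {X : Set} (xs ys : List X) → take (length xs) (xs ++ ys) ≡ xs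
take-length-++ [] ys = refl
take-length-++ (x ∷ xs) ys = cong (x ∷_) (take-length-++ xs ys)

drop-length-++ : ∀ {X : Set} (xs ys : List X) → drop (length xs) (xs ++ ys) ≡ ys
drop-length-++ [] ys = refl
drop-length-++ (x ∷ xs) ys = drop-length-++ xs ys

Unique-map-reflect : ∀ {X Y Z : Set} (f : X → Y) (g : X → Z) → (∀ {x y} → g x ≡ g y → f x ≡ f y) →
  ∀ {xs} → Unique (map f xs) → Unique (map g xs)
Unique-map-reflect f g refl-g u = AllPairsP.map⁺ (AllPairs.map (λ ne eq → ne (refl-g eq)) (AllPairsP.map⁻ u))

Unique-map-injective : ∀ {X Y : Set} (f : X → Y) {xs} → Unique (map f xs) → ∀ {x y} → x ∈ xs → y ∈ xs → f x ≡ f y → x ≡ y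
Unique-map-injective f u x∈ y∈ eq with ∈-AllPairs₂ (AllPairsP.map⁻ u) x∈ y∈
... | inj₁ x≡y = x≡y
... | inj₂ (inj₁ ne) = ⊥-elim (ne eq)
... | inj₂ (inj₂ ne) = ⊥-elim (ne (sym eq))

columns : List Box → ℕ
columns D = length (dedupB _==ℤ_ (map proj₂ D))

-- Ensures that the first part of a labeling really has l - 1 letters, so that a word reassembled
-- after sorting is cut at the same place.
columns≤length : ∀ D → columns D ℕ.≤ length D
columns≤length D = subst (columns D ℕ.≤_) (LP.length-map proj₂ D)
  (Unique⊆⇒length-≤ (dedupB-unique {eq = _==ℤ_} ==ℤ-sound ==ℤ-complete (map proj₂ D))
    (∈-dedupB⁻ {eq = _==ℤ_} ==ℤ-sound ==ℤ-complete (map proj₂ D)))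

Straddles : Box → Set
Straddles b = proj₁ b ℤ.≤ 0ℤ × 0ℤ ℤ.< proj₂ b

-- A first coordinate never equals a second one, as they lie on opposite sides of 0. With first
-- coordinates distinct, only equal second coordinates, that is equal keys, can make two letters
-- overlap.
rows-distinct⇒movable : ∀ {L} → All Straddles L → Unique (map proj₁ L) → AllPairs (Movable proj₂) L
rows-distinct⇒movable [] _ = []
rows-distinct⇒movable {x ∷ L} ((x₁ , x₂) ∷ sL) (px ∷ u) = All.tabulate (λ {y} y∈ ne →
    (λ eq → All.lookup px (∈-map⁺ proj₁ y∈) eq)
  , (λ eq → ℤP.<-irrefl eq (ℤP.≤-<-trans x₁ (proj₂ (All.lookup sL y∈))))
  , (λ eq → ℤP.<-irrefl (sym eq) (ℤP.≤-<-trans (proj₁ (All.lookup sL y∈)) x₂))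
  , ne) ∷ rows-distinct⇒movable sL u

columns-distinct⇒movable : ∀ {L} → All Straddles L → Unique (map proj₂ L) → AllPairs (Movable proj₁) L
columns-distinct⇒movable [] _ = []
columns-distinct⇒movable {x ∷ L} ((x₁ , x₂) ∷ sL) (px ∷ u) = All.tabulate (λ {y} y∈ ne →
    ne
  , (λ eq → ℤP.<-irrefl eq (ℤP.≤-<-trans x₁ (proj₂ (All.lookup sL y∈))))
  , (λ eq → ℤP.<-irrefl (sym eq) (ℤP.≤-<-trans (proj₁ (All.lookup sL y∈)) x₂))
  , (λ eq → All.lookup px (∈-map⁺ proj₂ y∈) eq)) ∷ columns-distinct⇒movable sL u

-- goodLab without its two sorting conditions: up to equivalence these are automatic.
record Split (l : ℕ) (L : List Box) : Set where
  field
    rows-distinct    : Unique (map proj₁ (take (l ℕ.∸ 1) L))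
    columns-distinct : Unique (map proj₂ (drop (l ℕ.∸ 1) L))

goodLab⇒Split : ∀ D L → T (goodLab D L) → Split (columns D) L
goodLab⇒Split D L g with T-∧⁻ {distinctB _==ℤ_ (map proj₁ (take (columns D ℕ.∸ 1) L))} g
... | p , g′ with T-∧⁻ {sortedℤ (map proj₂ (take (columns D ℕ.∸ 1) L))} g′
... | _ , g″ with T-∧⁻ {distinctB _==ℤ_ (map proj₂ (drop (columns D ℕ.∸ 1) L))} g″
... | q , _ = record { rows-distinct = distinctB⇒Unique {eq = _==ℤ_} ==ℤ-sound ==ℤ-complete _ p
                     ; columns-distinct = distinctB⇒Unique {eq = _==ℤ_} ==ℤ-sound ==ℤ-complete _ q }

-- The two parts are sorted separately and no letter crosses the cut. Sorting permutes each part, so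
-- the distinctness conditions carry over.
Split⇒goodLab : ∀ D {L} → L ↭ D → All Straddles L → Split (columns D) L → ∃ λ L′ → L ~ L′ × T (goodLab D L′)
Split⇒goodLab D {L} L↭D sL split = P′ ++ Q′ , L~L′ , good
  where
  m = columns D ℕ.∸ 1
  P = take m L
  Q = drop m L
  sorted₁ = sorted-equivalent proj₂ P (rows-distinct⇒movable (AllP.take⁺ m sL) (Split.rows-distinct split))
  sorted₂ = sorted-equivalent proj₁ Q (columns-distinct⇒movable (AllP.drop⁺ m sL) (Split.columns-distinct split))
  P′ = proj₁ sorted₁
  Q′ = proj₁ sorted₂
  P~P′ : P ~ P′
  P~P′ = proj₂ (proj₂ sorted₁)
  Q~Q′ : Q ~ Q′
  Q~Q′ = proj₂ (proj₂ sorted₂)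
  L~L′ : L ~ P′ ++ Q′
  L~L′ = subst (_~ P′ ++ Q′) (LP.take++drop≡id m L) (~-trans (~-++ʳ Q P~P′) (~-++ˡ P′ Q~Q′))
  length-P′ : length P′ ≡ m
  length-P′ = trans (sym (PermP.↭-length (~⇒↭ P~P′))) (trans (LP.length-take m L)
    (ℕP.m≤n⇒m⊓n≡m (ℕP.≤-trans (ℕP.m∸n≤m (columns D) 1) (ℕP.≤-trans (columns≤length D) (ℕP.≤-reflexive (sym (PermP.↭-length L↭D)))))))
  take≡ : take m (P′ ++ Q′) ≡ P′
  take≡ = trans (cong (λ z → take z (P′ ++ Q′)) (sym length-P′)) (take-length-++ P′ Q′)
  drop≡ : drop m (P′ ++ Q′) ≡ Q′
  drop≡ = trans (cong (λ z → drop z (P′ ++ Q′)) (sym length-P′)) (drop-length-++ P′ Q′)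
  good : T (goodLab D (P′ ++ Q′))
  good = T-∧⁺ {distinctB _==ℤ_ (map proj₁ (take m (P′ ++ Q′)))}
      (subst (λ z → T (distinctB _==ℤ_ (map proj₁ z))) (sym take≡)
        (Unique⇒distinctB {eq = _==ℤ_} ==ℤ-sound ==ℤ-complete (Unique-resp-↭ (PermP.map⁺ proj₁ (~⇒↭ P~P′)) (Split.rows-distinct split))))
    (T-∧⁺ {sortedℤ (map proj₂ (take m (P′ ++ Q′)))} (subst (λ z → T (sortedℤ (map proj₂ z))) (sym take≡) (proj₁ (proj₂ sorted₁)))
    (T-∧⁺ {distinctB _==ℤ_ (map proj₂ (drop m (P′ ++ Q′)))}
      (subst (λ z → T (distinctB _==ℤ_ (map proj₂ z))) (sym drop≡)
        (Unique⇒distinctB {eq = _==ℤ_} ==ℤ-sound ==ℤ-complete (Unique-resp-↭ (PermP.map⁺ proj₂ (~⇒↭ Q~Q′)) (Split.columns-distinct split))))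
      (subst (λ z → T (sortedℤ (map proj₁ z))) (sym drop≡) (proj₁ (proj₂ sorted₂)))))

path-map : ∀ {X : Set} {_≟_ : DecidableEquality X} {R R′ : X → X → Set} {g : X → X} →
  (∀ {x y} → R x y → R′ (g x) (g y)) → ∀ {x y} → Path _≟_ R x y → Path _≟_ R′ (g x) (g y)
path-map h stop = stop
path-map h (step r p) = step (h r) (path-map h p)

-- Distinct residues, and the action of the finite symmetric group on trees

module Trees (k : ℕ) where
  open Affine k
  open Length k
  open Action k

  record Tree (D : List Box) : Set where
    field
      straddles : All Straddles D
      connected : Connected D
      size      : length (verts D) ≡ suc (length D)
      rainbow   : Unique (map (res n) (verts D))

  isTreeB-sound : ∀ D → T (isTreeB n 0ℤ D) → Tree D
  isTreeB-sound D p with T-∧⁻ {all (λ b → (proj₁ b ≤ℤ 0ℤ) ∧ (0ℤ <ℤ proj₂ b)) D} p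
  ... | p₁ , p′ with T-∧⁻ {connectedB D} p′
  ... | p₂ , p″ with T-∧⁻ {length (verts D) ==ℕ suc (length D)} p″
  ... | p₃ , p₄ = record
    { straddles = All.map (λ {b} q → let q₁ , q₂ = T-∧⁻ {proj₁ b ≤ℤ 0ℤ} q in toWitness q₁ , toWitness q₂) (AllP.all⁺ _ D p₁)
    ; connected = connectedB-sound D p₂
    ; size = ==ℕ-sound p₃
    ; rainbow = distinctB⇒Unique {eq = _==ℕ_} ==ℕ-sound ==ℕ-complete _ p₄
    }

  isTreeB-complete : ∀ {D} → Tree D → T (isTreeB n 0ℤ D)
  isTreeB-complete {D} tr = T-∧⁺ {all (λ b → (proj₁ b ≤ℤ 0ℤ) ∧ (0ℤ <ℤ proj₂ b)) D}
    (AllP.all⁻ _ (All.map (λ {b} (q₁ , q₂) → T-∧⁺ {proj₁ b ≤ℤ 0ℤ} (fromWitness q₁) (fromWitness q₂)) straddles))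
    (T-∧⁺ {connectedB D} (connectedB-complete D connected)
    (T-∧⁺ {length (verts D) ==ℕ suc (length D)} (==ℕ-complete size)
      (Unique⇒distinctB {eq = _==ℕ_} ==ℕ-sound ==ℕ-complete rainbow)))
    where open Tree tr

  -- Stated on all ends, where a shared vertex occurs repeatedly, and not on the duplicate-free
  -- vertex list. In this form the property passes at once to tails and to permutations of a word.
  record Rainbow (L : List Box) : Set where
    constructor rainbow-by
    field separated : ∀ {u v} → u ∈ ends L → v ∈ ends L → res n u ≡ res n v → u ≡ v
  open Rainbow

  tree-rainbow : ∀ {D L} → Tree D → L ↭ D → Rainbow L
  tree-rainbow {D} tr L↭D = rainbow-by λ u∈ v∈ → Unique-map-injective (res n) (Tree.rainbow tr)
    (∈-verts⁺ {D} (PermP.∈-resp-↭ (ends-↭ L↭D) u∈)) (∈-verts⁺ {D} (PermP.∈-resp-↭ (ends-↭ L↭D) v∈))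

  rainbow-letters : ∀ {L} → All Straddles L → Rainbow L → All Letter L
  rainbow-letters sL rb = All.tabulate λ {b} b∈ → let i≤0 , j>0 = All.lookup sL b∈ in
    letter i≤0 j>0 (incongruent λ eq → ℤP.<-irrefl (separated rb (∈-ends₁ b∈) (∈-ends₂ b∈) eq) (ℤP.≤-<-trans i≤0 j>0))

  rainbow-tail : ∀ {b L} → Rainbow (b ∷ L) → Rainbow L
  rainbow-tail rb = rainbow-by λ u∈ v∈ → separated rb (there (there u∈)) (there (there v∈))

  -- Turns the integer disjointness in the definition of equivalent labelings into the disjointness
  -- modulo n needed for commutation.
  rainbow-apart : ∀ {L a b} → Rainbow L → a ∈ L → b ∈ L → Disjoint a b → Apart a b
  rainbow-apart rb a∈ b∈ (p , q , r , s) = apart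
    (p ∘ separated rb (∈-ends₁ a∈) (∈-ends₁ b∈)) (q ∘ separated rb (∈-ends₁ a∈) (∈-ends₂ b∈))
    (r ∘ separated rb (∈-ends₂ a∈) (∈-ends₁ b∈)) (s ∘ separated rb (∈-ends₂ a∈) (∈-ends₂ b∈))

  actWord-⇝ : ∀ {L L′ x} → L ⇝ L′ → All Letter L → Rainbow L → Monomial x → actWordₙ L x ≡ actWordₙ L′ x
  actWord-⇝ (swap {zs = zs} d) (la ∷ lb ∷ _) rb mx =
    cong (actWordₙ zs) (actSym-comm mx la lb (rainbow-apart rb (here refl) (there (here refl)) d))
  actWord-⇝ (skip s) (lb ∷ lL) rb mx = actWord-⇝ s lL (rainbow-tail rb) (actSym-monomial lb mx)

  actWord-~ : ∀ {L L′ x} → L ~ L′ → All Letter L → Rainbow L → Monomial x → actWordₙ L x ≡ actWordₙ L′ x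
  actWord-~ stop _ _ _ = refl
  actWord-~ {L} (step {y = M} s p) lL rb mx = trans (actWord-⇝ s lL rb mx)
    (actWord-~ p (PermP.All-resp-↭ (⇝⇒↭ s) lL) (rainbow-by λ u∈ v∈ → separated rb (back u∈) (back v∈)) mx)
    where
    back : ∀ {u} → u ∈ ends M → u ∈ ends L
    back = PermP.∈-resp-↭ (ends-↭ (↭-sym (⇝⇒↭ s)))

  -- Needed because terms are matched in both directions. The inverse preserves each side of the cut
  -- since σ preserves the opposite one.
  inverse : ∀ {σ} → FiniteSymmetry σ → ∃ λ τ → FiniteSymmetry τ × (∀ x → τ (σ x) ≡ x) × (∀ y → σ (τ y) ≡ y)
  inverse {σ} fs = τ , record
      { periodic = λ y c → injective (trans (στ (y ⊹ c)) (trans (cong (_⊹ c) (sym (στ y))) (sym (periodic (τ y) c))))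
      ; injective = λ {x} {y} eq → trans (sym (στ x)) (trans (cong σ eq) (στ y))
      ; surjective = λ x → σ x , τσ x
      ; nonpositive = λ {y} y≤0 → ℤP.≮⇒≥ λ 0<τy → ℤP.<⇒≱ (subst (0ℤ ℤ.<_) (στ y) (positive 0<τy)) y≤0
      ; positive = λ {y} 0<y → ℤP.≰⇒> λ τy≤0 → ℤP.<⇒≱ 0<y (subst (ℤ._≤ 0ℤ) (στ y) (nonpositive τy≤0))
      ; within = λ y → subst (λ z → τ y ℤ.≤ z ℤ.+ + n) (στ y) (proj₂ (within (τ y)))
                     , subst (λ z → z ℤ.≤ τ y ℤ.+ + n) (στ y) (proj₁ (within (τ y)))
      } , τσ , στ
    where
    open FiniteSymmetry fs
    τ : ℤ → ℤ
    τ y = proj₁ (surjective y)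
    στ : ∀ y → σ (τ y) ≡ y
    στ y = proj₂ (surjective y)
    τσ : ∀ x → τ (σ x) ≡ x
    τσ x = injective (στ (σ x))

  module _ {σ : ℤ → ℤ} (fs : FiniteSymmetry σ) where
    open FiniteSymmetry fs

    move-straddles : ∀ {L} → All Straddles L → All Straddles (map (move σ) L)
    move-straddles sL = AllP.map⁺ (All.map (λ (p , q) → nonpositive p , positive q) sL)

    move-disjoint : ∀ {a b} → Disjoint a b → Disjoint (move σ a) (move σ b)
    move-disjoint (p , q , r , s) = p ∘ injective , q ∘ injective , r ∘ injective , s ∘ injective

    move-injective : ∀ {a b} → move σ a ≡ move σ b → a ≡ b
    move-injective {i , j} {i′ , j′} eq = cong₂ _,_ (injective (cong proj₁ eq)) (injective (cong proj₂ eq))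

    move-⇝ : ∀ {L L′} → L ⇝ L′ → map (move σ) L ⇝ map (move σ) L′
    move-⇝ (swap {x} {y} d) = swap (move-disjoint {x} {y} d)
    move-⇝ (skip s) = skip (move-⇝ s)

    move-~ : ∀ {L L′} → L ~ L′ → map (move σ) L ~ map (move σ) L′
    move-~ = path-map move-⇝

    ends-move : ∀ D → ends (map (move σ) D) ≡ map σ (ends D)
    ends-move [] = refl
    ends-move ((i , j) ∷ D) = cong (λ z → σ i ∷ σ j ∷ z) (ends-move D)

    verts-move : ∀ {D D′} → D′ ↭ map (move σ) D → verts D′ ↭ map σ (verts D)
    verts-move {D} {D′} p = dedupB-image {eq = _==ℤ_} ==ℤ-sound ==ℤ-complete {σ} injective
      (↭-trans (ends-↭ p) (↭-reflexive (ends-move D)))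

    tree-move : ∀ {D D′} → D′ ↭ map (move σ) D → Tree D → Tree D′
    tree-move {D} {D′} p tr = record
      { straddles = PermP.All-resp-↭ (↭-sym p) (move-straddles straddles)
      ; connected = conn
      ; size = trans (PermP.↭-length (verts-move {D} {D′} p)) (trans (LP.length-map σ (verts D)) (trans size
          (cong suc (sym (trans (PermP.↭-length p) (LP.length-map (move σ) D))))))
      ; rainbow = Unique-resp-↭ (PermP.map⁺ (res n) (↭-sym (verts-move {D} {D′} p)))
          (subst Unique (LP.map-∘ (verts D)) (Unique-map-reflect (res n) (res n ∘ σ) (res-reflect {σ} periodic injective) rainbow))
      }
      where
      open Tree tr
      adj : ∀ {u v} → Adjacent D u v → Adjacent D′ (σ u) (σ v)
      adj (inj₁ b∈) = inj₁ (PermP.∈-resp-↭ (↭-sym p) (∈-map⁺ (move σ) b∈))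
      adj (inj₂ b∈) = inj₂ (PermP.∈-resp-↭ (↭-sym p) (∈-map⁺ (move σ) b∈))
      conn : Connected D′
      conn u∈ v∈ with ∈-map⁻ σ (PermP.∈-resp-↭ (verts-move {D} {D′} p) u∈) | ∈-map⁻ σ (PermP.∈-resp-↭ (verts-move {D} {D′} p) v∈)
      ... | u , u∈D , refl | v , v∈D , refl = path-map adj (connected u∈D v∈D)

    cD-move : ∀ {D D′} → D′ ↭ map (move σ) D → cD D′ ≡ cD D
    cD-move {D} {D′} p = trans (PermP.↭-length (PermP.filter-↭ (T? ∘ (_≤ℤ 0ℤ)) (verts-move {D} {D′} p))) (go (verts D))
      where
      same-side : ∀ v → (σ v ≤ℤ 0ℤ) ≡ (v ≤ℤ 0ℤ)
      same-side v = T-ext (λ q → fromWitness (ℤP.≮⇒≥ λ 0<v → ℤP.<⇒≱ (positive 0<v) (toWitness q)))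
                          (λ q → fromWitness (nonpositive (toWitness q)))
      go : ∀ vs → length (filterᵇ (_≤ℤ 0ℤ) (map σ vs)) ≡ length (filterᵇ (_≤ℤ 0ℤ) vs)
      go [] = refl
      go (v ∷ vs) with σ v ≤ℤ 0ℤ | v ≤ℤ 0ℤ | same-side v
      ... | true  | true  | _ = cong suc (go vs)
      ... | false | false | _ = go vs

    columns-move : ∀ {D D′} → D′ ↭ map (move σ) D → columns D′ ≡ columns D
    columns-move {D} {D′} p = trans (PermP.↭-length (dedupB-image {eq = _==ℤ_} ==ℤ-sound ==ℤ-complete {σ} injective
        -- Both composites fuse to the same map, as the second coordinate of a moved box is σ of the
        -- second coordinate.
        (↭-trans (PermP.map⁺ proj₂ p) (↭-reflexive (trans (sym (LP.map-∘ D)) (LP.map-∘ D))))))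
      (LP.length-map σ (dedupB _==ℤ_ (map proj₂ D)))

    split-move : ∀ {l L} → Split l L → Split l (map (move σ) L)
    split-move {l} {L} s = record
      { rows-distinct = subst Unique (trans (sym (LP.map-∘ (take (l ℕ.∸ 1) L)))
          (trans (LP.map-∘ (take (l ℕ.∸ 1) L)) (cong (map proj₁) (sym (LP.take-map {f = move σ} (l ℕ.∸ 1) L))))) (UniqueP.map⁺ injective (Split.rows-distinct s))
      ; columns-distinct = subst Unique (trans (sym (LP.map-∘ (drop (l ℕ.∸ 1) L)))
          (trans (LP.map-∘ (drop (l ℕ.∸ 1) L)) (cong (map proj₂) (sym (LP.drop-map {f = move σ} (l ℕ.∸ 1) L))))) (UniqueP.map⁺ injective (Split.columns-distinct s))
      }

    -- The moved labeling keeps the distinctness conditions but may lose sortedness, and its sorted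
    -- form need not be the selected one; hence two passages to an equivalent word.
    MD-move : ∀ {D D′ L} → D′ ↭ map (move σ) D → Tree D → L ∈ MD D → ∃ λ L′ → L′ ∈ MD D′ × map (move σ) L ~ L′
    MD-move {D} {D′} {L} p tr L∈ with ∈-MD⁻ D L∈
    ... | L↭D , good with Split⇒goodLab D′ {map (move σ) L} (↭-trans (PermP.map⁺ (move σ) L↭D) (↭-sym p))
            (move-straddles (PermP.All-resp-↭ (↭-sym L↭D) (Tree.straddles tr)))
            (subst (λ l → Split l (map (move σ) L)) (sym (columns-move {D} {D′} p)) (split-move (goodLab⇒Split D L good)))
    ... | L₁ , σL~L₁ , good₁ with MD-complete {D′} (↭-trans (↭-sym (~⇒↭ σL~L₁)) (↭-trans (PermP.map⁺ (move σ) L↭D) (↭-sym p))) good₁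
    ... | L′ , L′∈ , L′~L₁ = L′ , L′∈ , ~-trans σL~L₁ (~-sym L′~L₁)

-- The signed terms of p_m

-- Equal formal sums can be different lists, so elements are compared by coefficients. The two
-- functionals in play are the coefficient at `u`, taken directly or after right multiplication by a
-- fixed element.
record Linear (φ : Alg → ℚ) : Set where
  field
    zero-hom  : φ [] ≡ 0ℚ
    add-hom   : ∀ x y → φ (x ++ y) ≡ φ x ℚ.+ φ y
    scale-hom : ∀ c x → φ (scale c x) ≡ c ℚ.* φ x

linear-concatMap : ∀ {φ} → Linear φ → ∀ {X : Set} (f : X → Alg) xs → φ (concatMap f xs) ≡ sumℚ (map (φ ∘ f) xs)
linear-concatMap lin f [] = Linear.zero-hom lin
linear-concatMap {φ} lin f (x ∷ xs) = trans (Linear.add-hom lin (f x) _) (cong (λ z → φ (f x) ℚ.+ z) (linear-concatMap lin f xs))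

coeff-linear : ∀ u → Linear (λ x → coeff x u)
coeff-linear u = record { zero-hom = refl ; add-hom = add ; scale-hom = sc }
  where
  add : ∀ x y → coeff (x ++ y) u ≡ coeff x u ℚ.+ coeff y u
  add x y = trans (cong (sumℚ ∘ map proj₁) (LP.filter-++ (T? ∘ λ p → proj₂ p ==W u) x y))
    (trans (cong sumℚ (LP.map-++ proj₁ (filterᵇ (λ p → proj₂ p ==W u) x) _))
      (sumℚ-++ (map proj₁ (filterᵇ (λ p → proj₂ p ==W u) x)) _))
  sc : ∀ c x → coeff (scale c x) u ≡ c ℚ.* coeff x u
  sc c [] = sym (ℚP.*-zeroʳ c)
  sc c ((d , w) ∷ x) with w ==W u
  ... | true = trans (cong (λ z → c ℚ.* d ℚ.+ z) (sc c x)) (sym (ℚP.*-distribˡ-+ c d _))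
  ... | false = sc c x

mulA-scale : ∀ n c x y → mulA n (scale c x) y ≡ scale c (mulA n x y)
mulA-scale n c [] y = refl
mulA-scale n c ((d , u) ∷ x) y = trans (cong₂ _++_ (row y) (mulA-scale n c x y))
  (sym (LP.map-++ (λ p → c ℚ.* proj₁ p , proj₂ p) (products d y) (mulA n x y)))
  where
  entry : ℚ → ℚ × List ℤ → Alg
  entry d q = if len n (comp n u (proj₂ q)) ==ℕ (len n u ℕ.+ len n (proj₂ q))
    then (d ℚ.* proj₁ q , comp n u (proj₂ q)) ∷ [] else []
  products : ℚ → Alg → Alg
  products d = concatMap (entry d)
  entry-scale : ∀ q → entry (c ℚ.* d) q ≡ scale c (entry d q)
  entry-scale (e , v) with len n (comp n u v) ==ℕ (len n u ℕ.+ len n v)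
  ... | true = cong (λ z → (z , comp n u v) ∷ []) (ℚP.*-assoc c d e)
  ... | false = refl
  row : ∀ y → products (c ℚ.* d) y ≡ scale c (products d y)
  row [] = refl
  row (q ∷ y) = trans (cong₂ _++_ (entry-scale q) (row y))
    (sym (LP.map-++ (λ p → c ℚ.* proj₁ p , proj₂ p) (entry d q) (products d y)))

coeff-mulA-linear : ∀ n y u → Linear (λ x → coeff (mulA n x y) u)
coeff-mulA-linear n y u = record
  { zero-hom = refl
  ; add-hom = λ x x′ → trans (cong (λ z → coeff z u) (LP.concatMap-++ _ x x′)) (Linear.add-hom (coeff-linear u) (mulA n x y) (mulA n x′ y))
  ; scale-hom = λ c x → trans (cong (λ z → coeff z u) (mulA-scale n c x y)) (Linear.scale-hom (coeff-linear u) c (mulA n x y))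
  }

opaque
  terms : ℕ → ℕ → ℕ → List (List Box × List Box)
  terms n N m = concatMap (λ D → map (D ,_) (MD D)) (treesN n N m)

sumℚ-concatMap : ∀ {X Y : Set} (g : X → List Y) (h : X → Y → ℚ) xs →
  sumℚ (map (λ x → sumℚ (map (h x) (g x))) xs) ≡ sumℚ (map (λ p → h (proj₁ p) (proj₂ p)) (concatMap (λ x → map (x ,_) (g x)) xs))
sumℚ-concatMap g h [] = refl
sumℚ-concatMap g h (x ∷ xs) = trans
  (cong₂ ℚ._+_ (cong sumℚ (LP.map-∘ (g x))) (sumℚ-concatMap g h xs))
  (trans (sym (sumℚ-++ (map (λ p → h (proj₁ p) (proj₂ p)) (map (x ,_) (g x))) _))
    (cong sumℚ (sym (LP.map-++ (λ p → h (proj₁ p) (proj₂ p)) (map (x ,_) (g x)) _))))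

opaque
  unfolding terms

  linear-actPN : ∀ {φ} → Linear φ → ∀ n N m x →
    φ (actPN n N m x) ≡ sumℚ (map (λ p → signQ (cD (proj₁ p)) ℚ.* φ (actWord n (proj₂ p) x)) (terms n N m))
  linear-actPN {φ} lin n N m x = trans
    (linear-concatMap lin (λ D → concatMap (term D) (MD D)) (treesN n N m))
    (trans (cong sumℚ (LP.map-cong (λ D → trans (linear-concatMap lin (term D) (MD D))
        (cong sumℚ (LP.map-cong (λ L → Linear.scale-hom lin (signQ (cD D)) (actWord n L x)) (MD D)))) (treesN n N m)))
      (sumℚ-concatMap MD (λ D L → signQ (cD D) ℚ.* φ (actWord n L x)) (treesN n N m)))
    where
    term : List Box → List Box → Alg
    term D L = scale (signQ (cD D)) (actWord n L x)

≤⇒+ : ∀ {a b} → a ℤ.≤ b → ∃ λ d → b ≡ a ℤ.+ + d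
≤⇒+ {a} {b} a≤b with b ℤ.- a in eq | ≤-by-difference {c = 0ℤ} {d = b ℤ.- a} a≤b (sym (ℤP.+-identityʳ (b ℤ.- a)))
... | + d | _ = d , trans (e a b) (cong (λ z → a ℤ.+ z) eq)
  where
  e : ∀ a b → b ≡ a ℤ.+ (b ℤ.- a)
  e = solve-∀

∈-rangeℤ⁺ : ∀ {lo N x} → lo ℤ.≤ x → x ℤ.< lo ℤ.+ + N → x ∈ rangeℤ lo N
∈-rangeℤ⁺ {lo} {N} lo≤x x<hi with ≤⇒+ lo≤x
... | d , refl = ∈-map⁺ (λ d → lo ℤ.+ + d) (∈-upTo⁺ (ℤP.drop‿+<+ (<-by-difference x<hi (e lo (+ d) (+ N)))))
  where
  e : ∀ lo d N → (lo ℤ.+ N) ℤ.- (lo ℤ.+ d) ≡ N ℤ.- d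
  e = solve-∀

rangeℤ-unique : ∀ lo N → Unique (rangeℤ lo N)
rangeℤ-unique lo N = UniqueP.map⁺ (λ {d} {d′} eq → ℤP.+-injective (+-cancelˡ lo (+ d) (+ d′) eq)) (UniqueP.upTo⁺ N)

boxesN-unique : ∀ N → Unique (boxesN N)
boxesN-unique N = concatMap-pairs-unique (λ _ → rangeℤ (+ 1) N) (rangeℤ-unique (ℤ.- + N) (suc N)) (λ _ → rangeℤ-unique (+ 1) N)

∈-boxesN⁺ : ∀ {N b} → Straddles b → ℤ.- (+ N) ℤ.≤ proj₁ b × proj₂ b ℤ.≤ + N → b ∈ boxesN N
∈-boxesN⁺ {N} {i , j} (i≤0 , 0<j) (lo , hi) = ∈-concatMap⁺ (λ i → map (i ,_) (rangeℤ (+ 1) N)) (lose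
  -- The row range starts at -N and has N + 1 entries, so its exclusive upper end is 1.
  (∈-rangeℤ⁺ lo (ℤP.≤-<-trans i≤0 (subst (0ℤ ℤ.<_) (e (+ N)) (ℤ.+<+ (s≤s z≤n)))))
  (∈-map⁺ (i ,_) (∈-rangeℤ⁺ (ℤP.i<j⇒suc[i]≤j 0<j) (ℤP.≤-<-trans hi (ℤP.suc[i]≤j⇒i<j ℤP.≤-refl)))))
  where
  e : ∀ N → + 1 ≡ ℤ.- N ℤ.+ (+ 1 ℤ.+ N)
  e = solve-∀

∈-treesN⁻ : ∀ n N m {D} → D ∈ treesN n N m → D ∈ choose m (boxesN N) × T (isTreeB n 0ℤ D)
∈-treesN⁻ n N m = ∈-filter⁻ (T? ∘ isTreeB n 0ℤ) {xs = choose m (boxesN N)}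

∈-treesN⁺ : ∀ n N m {D} → D ∈ choose m (boxesN N) → T (isTreeB n 0ℤ D) → D ∈ treesN n N m
∈-treesN⁺ n N m = ∈-filter⁺ (T? ∘ isTreeB n 0ℤ)

opaque
  unfolding terms

  ∈-terms⁻ : ∀ n N m {D L} → (D , L) ∈ terms n N m → D ∈ treesN n N m × L ∈ MD D
  ∈-terms⁻ n N m p∈ with find (∈-concatMap⁻ (λ D → map (D ,_) (MD D)) {treesN n N m} p∈)
  ... | D , D∈ , p∈D with ∈-map⁻ (D ,_) p∈D
  ... | L , L∈ , refl = D∈ , L∈

  ∈-terms⁺ : ∀ n N m {D L} → D ∈ treesN n N m → L ∈ MD D → (D , L) ∈ terms n N m
  ∈-terms⁺ n N m {D} D∈ L∈ = ∈-concatMap⁺ (λ D → map (D ,_) (MD D)) {treesN n N m} (lose D∈ (∈-map⁺ (D ,_) L∈))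

infix 4 _≈_

-- The trees are compared only through the count that fixes the sign: a moved term keeps its
-- original tree as label while its word is moved.
record _≈_ (p q : List Box × List Box) : Set where
  constructor equivalent
  field
    words    : proj₂ p ~ proj₂ q
    vertices : cD (proj₁ p) ≡ cD (proj₁ q)
open _≈_

≈-sym : ∀ {p q} → p ≈ q → q ≈ p
≈-sym (equivalent p c) = equivalent (~-sym p) (sym c)

≈-trans : ∀ {p q r} → p ≈ q → q ≈ r → p ≈ r
≈-trans (equivalent p c) (equivalent q d) = equivalent (~-trans p q) (trans c d)

opaque
  unfolding terms

  -- Within one tree the representatives are inequivalent by selection. Across trees, equivalent
  -- words would make the trees permutations of each other.
  terms-inequivalent : ∀ n N m → AllPairs (λ p q → ¬ (p ≈ q)) (terms n N m)
  terms-inequivalent n N m = AllPairsP.concat⁺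
    (AllP.map⁺ (All.tabulate λ {D} _ → AllPairsP.map⁺ (AllPairs.map (λ ¬p p → ¬p (words p)) (MD-inequivalent D))))
    (AllPairsP.map⁺ (AllPairs.map across (AllPairsP.filter⁺ (T? ∘ isTreeB n 0ℤ) (choose-↭-distinct m (boxesN-unique N)))))
    where
    across : ∀ {D D′} → ¬ (D ↭ D′) → All (λ p → All (λ q → ¬ (p ≈ q)) (map (D′ ,_) (MD D′))) (map (D ,_) (MD D))
    across {D} {D′} ¬p = AllP.map⁺ (All.tabulate λ L∈ → AllP.map⁺ (All.tabulate λ L′∈ L≈L′ →
      ¬p (↭-trans (↭-sym (proj₁ (∈-MD⁻ D L∈))) (↭-trans (~⇒↭ (words L≈L′)) (proj₁ (∈-MD⁻ D′ L′∈))))))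

-- Matching the terms and the commutation identity

module Commutation (k : ℕ) where
  open Affine k
  open Length k
  open Action k
  open Trees k

  module _ (N m : ℕ) {D L : List Box} (p∈ : (D , L) ∈ terms n N m) where

    term-tree : Tree D
    term-tree = isTreeB-sound D (proj₂ (∈-treesN⁻ n N m (proj₁ (∈-terms⁻ n N m p∈))))

    term-↭ : L ↭ D
    term-↭ = proj₁ (∈-MD⁻ D (proj₂ (∈-terms⁻ n N m p∈)))

    term-length : length L ≡ m
    term-length = trans (PermP.↭-length term-↭) (proj₁ (∈-choose⁻ m (boxesN N) (proj₁ (∈-treesN⁻ n N m (proj₁ (∈-terms⁻ n N m p∈))))))

    term-rainbow : Rainbow L
    term-rainbow = tree-rainbow term-tree term-↭

    term-letters : All Letter L
    term-letters = rainbow-letters (PermP.All-resp-↭ (↭-sym term-↭) (Tree.straddles term-tree)) term-rainbow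

    -- The range condition places the image of the tree among the enumerated boxes; its listed
    -- permutation D′ then carries a representative of the moved word.
    move-term : ∀ {σ} → FiniteSymmetry σ → All (InRange N) (map (move σ) L) →
      ∃ λ q → q ∈ terms n N m × (D , map (move σ) L) ≈ q
    move-term {σ} fs inRange = assemble
      (choose-complete _≟B_ m (boxesN N) {map (move σ) D} (boxesN-unique N)
        (UniqueP.map⁺ (move-injective fs) (choose-unique m (boxesN-unique N) D∈choose))
        (trans (LP.length-map (move σ) D) (proj₁ (∈-choose⁻ m (boxesN N) D∈choose)))
        (λ b∈ → ∈-boxesN⁺ (All.lookup (move-straddles fs (Tree.straddles term-tree)) b∈)
                          (All.lookup inRange (PermP.∈-resp-↭ (PermP.map⁺ (move σ) (↭-sym term-↭)) b∈))))
      where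
      D∈choose : D ∈ choose m (boxesN N)
      D∈choose = proj₁ (∈-treesN⁻ n N m (proj₁ (∈-terms⁻ n N m p∈)))
      assemble : (∃ λ D′ → D′ ∈ choose m (boxesN N) × D′ ↭ map (move σ) D) → ∃ λ q → q ∈ terms n N m × (D , map (move σ) L) ≈ q
      assemble (D′ , D′∈ , D′↭) = (D′ , proj₁ image)
        , ∈-terms⁺ n N m (∈-treesN⁺ n N m D′∈ (isTreeB-complete (tree-move fs D′↭ term-tree))) (proj₁ (proj₂ image))
        , equivalent (proj₂ (proj₂ image)) (sym (cD-move fs D′↭))
        where
        image : ∃ λ L′ → L′ ∈ MD D′ × map (move σ) L ~ L′
        image = MD-move fs D′↭ term-tree (proj₂ (∈-terms⁻ n N m p∈))

  map-move-inverse : ∀ {σ τ} → (∀ x → τ (σ x) ≡ x) → ∀ L → map (move τ) (map (move σ) L) ≡ L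
  map-move-inverse τσ [] = refl
  map-move-inverse τσ ((i , j) ∷ L) = cong₂ _∷_ (cong₂ _,_ (τσ i) (τσ j)) (map-move-inverse τσ L)

  inRange-move : ∀ {σ M} → FiniteSymmetry σ → ∀ {b} → InRange M b → InRange (M ℕ.+ n) (move σ b)
  inRange-move {σ} {M} fs {i , j} (lo , hi) = low , high
    where
    open FiniteSymmetry fs
    e₁ : ∀ i s M n → (i ℤ.+ (s ℤ.+ n)) ℤ.- (ℤ.- M ℤ.+ i) ≡ s ℤ.- (ℤ.- (M ℤ.+ n))
    e₁ = solve-∀
    low : ℤ.- (+ (M ℕ.+ n)) ℤ.≤ σ i
    low = ≤-by-difference (ℤP.+-mono-≤ lo (proj₂ (within i))) (e₁ i (σ i) (+ M) (+ n))
    e₂ : ∀ j s M n → (M ℤ.+ (j ℤ.+ n)) ℤ.- (j ℤ.+ s) ≡ (M ℤ.+ n) ℤ.- s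
    e₂ = solve-∀
    high : σ j ℤ.≤ + (M ℕ.+ n)
    high = ≤-by-difference (ℤP.+-mono-≤ hi (proj₁ (within j))) (e₂ j (σ j) (+ M) (+ n))

  module _ {σ : ℤ → ℤ} (fs : FiniteSymmetry σ) {N m M : ℕ} (M+n≤N : M ℕ.+ n ℕ.≤ N) (F : List Box → ℚ)
           (F-resp : ∀ {L L′} → All Letter L → Rainbow L → L ~ L′ → F L ≡ F L′)
           (F-support : ∀ {L} → length L ≡ m → All Letter L → F L ≢ 0ℚ → All (InRange M) L) where

    private
      f : List Box × List Box → ℚ
      f (D , L) = signQ (cD D) ℚ.* F L

      moved : List Box × List Box → List Box × List Box
      moved (D , L) = D , map (move σ) L

      Admissible : List Box × List Box → Set
      Admissible (_ , L) = All Letter L × Rainbow L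

      f-resp : ∀ {p q} → Admissible p → p ≈ q → f p ≡ f q
      f-resp (lL , rb) (equivalent L~L′ c) = cong₂ ℚ._*_ (cong signQ c) (F-resp lL rb L~L′)

      f-support : ∀ D {L} → length L ≡ m → All Letter L → f (D , L) ≢ 0ℚ → All (InRange M) L
      f-support D len≡ lL f≢0 = F-support len≡ lL
        λ F≡0 → f≢0 (trans (cong (λ z → signQ (cD D) ℚ.* z) F≡0) (ℚP.*-zeroʳ (signQ (cD D))))

      moved-admissible : ∀ {p} → p ∈ terms n N m → Admissible (moved p)
      moved-admissible p∈ = AllP.map⁺ (All.map (move-letter {σ} fs) (term-letters N m p∈))
        , tree-rainbow (tree-move fs ↭-refl (term-tree N m p∈)) (PermP.map⁺ (move σ) (term-↭ N m p∈))

      inv = inverse fs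
      τ = proj₁ inv
      τ-symmetry : FiniteSymmetry τ
      τ-symmetry = proj₁ (proj₂ inv)
      τσ : ∀ x → τ (σ x) ≡ x
      τσ = proj₁ (proj₂ (proj₂ inv))
      στ : ∀ y → σ (τ y) ≡ y
      στ = proj₂ (proj₂ (proj₂ inv))

      moved-reflects-≈ : ∀ {p q} → moved p ≈ moved q → p ≈ q
      moved-reflects-≈ {_ , L} {_ , L′} (equivalent σL~σL′ c) = equivalent
        (subst₂ _~_ (map-move-inverse τσ L) (map-move-inverse τσ L′) (move-~ τ-symmetry σL~σL′)) c

      to : ∀ {p} → p ∈ terms n N m → f (moved p) ≢ 0ℚ → ∃ λ q → q ∈ terms n N m × moved p ≈ q
      to {D , L} p∈ f≢0 = move-term N m p∈ fs (All.map (λ {b} → inRange-mono {b = b} (ℕP.≤-trans (ℕP.m≤m+n M n) M+n≤N))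
        (f-support D (trans (LP.length-map (move σ) L) (term-length N m p∈)) (proj₁ (moved-admissible p∈)) f≢0))

      from : ∀ {p} → p ∈ terms n N m → f p ≢ 0ℚ → ∃ λ q → q ∈ map moved (terms n N m) × q ≈ p
      -- The preimage of a word within M lies within M + n, hence within N; the margin is spent
      -- here.
      from {D , L} p∈ f≢0 = back (move-term N m p∈ τ-symmetry (AllP.map⁺ (All.map
          (λ {b} r → inRange-mono {b = move τ b} M+n≤N (inRange-move {τ} τ-symmetry {b} r))
          (f-support D (term-length N m p∈) (term-letters N m p∈) f≢0))))
        where
        back : (∃ λ q → q ∈ terms n N m × (D , map (move τ) L) ≈ q) → ∃ λ q → q ∈ map moved (terms n N m) × q ≈ (D , L)
        back (q , q∈ , equivalent τL~L′ c) = moved q , ∈-map⁺ moved q∈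
          , equivalent (~-sym (subst (_~ map (move σ) (proj₂ q)) (map-move-inverse στ L) (move-~ fs τL~L′))) (sym c)

    -- The inverse moves words back, so moving keeps inequivalent terms inequivalent. Then `to` and
    -- `from` match the classes of nonzero weight in the two lists.
    terms-sum-invariant :
      sumℚ (map (λ p → signQ (cD (proj₁ p)) ℚ.* F (map (move σ) (proj₂ p))) (terms n N m))
        ≡ sumℚ (map (λ p → signQ (cD (proj₁ p)) ℚ.* F (proj₂ p)) (terms n N m))
    terms-sum-invariant = trans (cong sumℚ (LP.map-∘ (terms n N m)))
      (transversal-sum _≈_ ≈-sym ≈-trans f Admissible (λ {p} {q} → f-resp {p} {q})
        (AllPairsP.map⁺ (AllPairs.map (λ {p} {q} ¬r r → ¬r (moved-reflects-≈ {p} {q} r)) (terms-inequivalent n N m)))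
        (terms-inequivalent n N m)
        (AllP.map⁺ (All.tabulate moved-admissible))
        (All.tabulate λ p∈ → term-letters N m p∈ , term-rainbow N m p∈)
        (λ x∈ → to′ (∈-map⁻ moved x∈)) from)
      where
      to′ : ∀ {x} → (∃ λ p → p ∈ terms n N m × x ≡ moved p) → f x ≢ 0ℚ → ∃ λ q → q ∈ terms n N m × x ≈ q
      to′ (p , p∈ , refl) = to p∈

  -- `F L` is the coefficient at `u` of the product in which the word acts first and A_w′ multiplies
  -- afterwards. Passing words through A_w′ makes the left side the sum of `F` over moved words, and
  -- the right side is its sum over the words themselves.
  actPN-mulA : ∀ {w w′} → Valid w → FiniteSymmetry (evₙ w′) → ∀ {N m} → reach m (bnd n w) ℕ.+ n ℕ.≤ N → ∀ u →
    coeff (actPN n N m (mulA n (A w) (A w′))) u ≡ coeff (mulA n (actPN n N m (A w)) (A w′)) u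
  actPN-mulA {w} {w′} vw fs {N} {m} N₀≤N u =
    trans (linear-actPN (coeff-linear u) n N m (mulA n (A w) (A w′)))
    (trans (cong sumℚ (LP.map-cong-local (All.tabulate λ {p} p∈ → cong (λ z → signQ (cD (proj₁ p)) ℚ.* z) (left p p∈))))
    (trans (terms-sum-invariant fs N₀≤N F F-resp F-support)
    (trans (cong sumℚ (LP.map-cong (λ p → cong (λ z → signQ (cD (proj₁ p)) ℚ.* z) (right p)) (terms n N m)))
    (sym (linear-actPN (coeff-mulA-linear n (A w′) u) n N m (A w))))))
    where
    F : List Box → ℚ
    F L = coeff (mulₙ w′ (actWordₙ L (A w))) u
    F-resp : ∀ {L L′} → All Letter L → Rainbow L → L ~ L′ → F L ≡ F L′
    F-resp lL rb L~L′ = cong (λ z → coeff (mulₙ w′ z) u) (actWord-~ L~L′ lL rb (one vw))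
    F-support : ∀ {L} → length L ≡ m → All Letter L → F L ≢ 0ℚ → All (InRange (reach m (bnd n w))) L
    F-support {L} refl lL F≢0 = actWord-support L vw (evₙ-within w) lL
      λ eq → F≢0 (cong (λ z → coeff z u) (trans (cong (mulₙ w′) eq) (mulₙ-[] w′)))
    left : ∀ p → p ∈ terms n N m → coeff (actWord n (proj₂ p) (mulA n (A w) (A w′))) u ≡ F (map (move (evₙ w′)) (proj₂ p))
    left (D , L) p∈ = cong (λ z → coeff z u) (trans (cong (actWord n L) (sym (mulₙ-def w′ (A w))))
      (trans (sym (actWordₙ-def L (mulₙ w′ (A w)))) (actWord-mulA {w′} L fs (term-letters N m p∈) (one vw))))
    right : ∀ p → F (proj₂ p) ≡ coeff (mulA n (actWord n (proj₂ p) (A w)) (A w′)) u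
    right (D , L) = cong (λ z → coeff z u)
      (trans (mulₙ-def w′ (actWordₙ L (A w))) (cong (λ z → mulA n z (A w′)) (actWordₙ-def L (A w))))

theorem5p3 : (n : ℕ) → 2 ≤ n → (m : ℕ) → 1 ≤ m →
    (w : List ℤ) → IsAffPerm n w → (w′ : List ℤ) → IsFinPerm n w′ →
    ∃ λ N₀ → (N : ℕ) → N₀ ≤ N → (u : List ℤ) →
    coeff (actPN n N m (mulA n (A w) (A w′))) u
    ≡ coeff (mulA n (actPN n N m (A w)) (A w′)) u
theorem5p3 (suc k) _ m _ w (length≡n , residues-unique , _) w′ w′↭ =
  -- Words of m letters with a letter beyond the first summand kill A_w; the second summand, n, is
  -- the largest displacement allowed to the inverse of σ.
  reach m (bnd (suc k) w) ℕ.+ suc k , λ N N₀≤N u → actPN-mulA {w} {w′} valid (finiteSymmetry w′ w′↭) {N} {m} N₀≤N u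
  where
  open Length k using (evₙ-injective)
  open Action k
  open Commutation k
  valid : Valid w
  valid = record { length≡n = length≡n ; injective = evₙ-injective w length≡n residues-unique }
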